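{- Let $r\ge k\ge 2$ be integers. Then, as $x\to\infty$, $$\sum_{n_1,\ldots,n_r\le x}\varrho_{r,k}(n_1,\ldots,n_r)=A_{r,k}\,x^r+O\left(R_{r,k}(x)\right),$$ where $$A_{r,k}=\prod_p\left(1-\sum_{j=k}^r(-1)^{j-k}\binom{r}{j}\binom{j-1}{k-1}\frac1{p^j}\right),$$ the product being over all primes $p$, and $$R_{r,k}(x)=\begin{cases}x^{r-1}, & \text{if } r\ge k\ge 3,\\ x^{r-1}(\log x)^{r-1}, & \text{if } r\ge k=2.\end{cases}$$ The implied constant depends only on $r$.
   Context: Positive integers $n_1,\ldots,n_r$ are called $k$-wise relatively prime if $\gcd(n_{i_1},\ldots,n_{i_k})=1$ for every $1\le i_1<\cdots<i_k\le r$. The function $\varrho_{r,k}$ is the characteristic function of the set of $r$-tuples of positive integers whose components are $k$-wise relatively prime: $\varrho_{r,k}(n_1,\ldots,n_r)=1$ if $n_1,\ldots,n_r$ are $k$-wise relatively prime and $0$ otherwise. The sum runs over all $r$-tuples of positive integers $n_1,\ldots,n_r$ each at most the real number $x$. -}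

module Defs where

open import Algebra.Bundles using (module CommutativeRing)
import Algebra.Properties.AbelianGroup
import Algebra.Properties.CommutativeSemigroup
import Algebra.Properties.Ring
open import Data.Bool using (if_then_else_)
open import Data.Fin as Fin using (Fin)
import Data.Fin.Properties as Fin
open import Data.Integer as ℤ using (+_; -1ℤ)
import Data.List as List
open import Data.Nat.ListAction using (sum)
open import Data.Nat as ℕ using (ℕ; zero; suc; _∸_)
import Data.Nat.Properties as ℕ
open import Data.Nat.Combinatorics using (_C_)
open import Data.Nat.GCD using (gcd)
open import Data.Nat.Primality using (prime?)
open import Data.Product using (∃; _×_; _,_)
open import Data.Rational as ℚ using (ℚ; 0ℚ; 1ℚ)
import Data.Rational.Properties as ℚ
open import Data.Sum using (inj₁; inj₂)
open import Data.Vec as Vec using (Vec; []; _∷_)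
open import Data.Vec.Relation.Unary.Linked using (Linked; linked?)
open import Relation.Binary.PropositionalEquality
  using (_≡_; sym; trans; cong; cong₂; subst; subst₂)
open import Relation.Nullary using (Dec; does)
open import Relation.Nullary.Decidable using (_→-dec_; map′)

------------------------------------------------------------------------
-- Real numbers: Cauchy sequences of rationals.  All operations are
-- termwise.  Two sequences x, y denote the same real number when
-- x ≤ y and y ≤ x.  The proofs that operations preserve IsCauchy are
-- abstract, since normalising them is very expensive.

IsCauchy : (ℕ → ℚ) → Set
IsCauchy s = ∀ ε → 0ℚ ℚ.< ε →
  ∃ λ M → ∀ m n → M ℕ.≤ m → M ℕ.≤ n → ℚ.∣ s m ℚ.- s n ∣ ℚ.< ε

record ℝ : Set where
  constructor mkℝ
  field
    seq    : ℕ → ℚ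
    cauchy : IsCauchy seq

open ℝ public

module _ where
  private
    open CommutativeRing ℚ.+-*-commutativeRing
      using (ring; +-abelianGroup; +-commutativeSemigroup; *-commutativeSemigroup)
    open Algebra.Properties.AbelianGroup +-abelianGroup
      using (//-rightDividesˡ; //-rightDividesʳ; ⁻¹-anti-homo‿-; ⁻¹-∙-comm)
    open Algebra.Properties.CommutativeSemigroup +-commutativeSemigroup
      using (interchange)
    open Algebra.Properties.CommutativeSemigroup *-commutativeSemigroup
      using (x∙yz≈y∙xz)
    open Algebra.Properties.Ring ring using (x[y-z]≈xy-xz; [y-z]x≈yx-zx)

    abstract
      lipschitz-cauchy : ∀ (f : ℚ → ℚ) →
        (∀ p q → ℚ.∣ f p ℚ.- f q ∣ ℚ.≤ ℚ.∣ p ℚ.- q ∣) →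
        ∀ s → IsCauchy s → IsCauchy (λ n → f (s n))
      lipschitz-cauchy f lip s cs ε ε>0 with cs ε ε>0
      ... | M , h = M , λ m n M≤m M≤n →
        ℚ.≤-<-trans (lip (s m) (s n)) (h m n M≤m M≤n)

    half>0 : ∀ ε → 0ℚ ℚ.< ε → 0ℚ ℚ.< ε ℚ.* ℚ.½
    half>0 ε ε>0 =
      ℚ.positive⁻¹ _ {{ℚ.pos*pos⇒pos ε {{ℚ.positive ε>0}} ℚ.½}}

    half+half : ∀ ε → ε ℚ.* ℚ.½ ℚ.+ ε ℚ.* ℚ.½ ≡ ε
    half+half ε = trans (sym (ℚ.*-distribˡ-+ ε ℚ.½ ℚ.½)) (ℚ.*-identityʳ ε)

    ∣-∣-swap : ∀ p q → ℚ.∣ p ℚ.- q ∣ ≡ ℚ.∣ q ℚ.- p ∣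
    ∣-∣-swap p q = trans (sym (ℚ.∣-p∣≡∣p∣ (p ℚ.- q))) (cong ℚ.∣_∣ (⁻¹-anti-homo‿- p q))

    ∣p∣≤∣p-q∣+∣q∣ : ∀ p q → ℚ.∣ p ∣ ℚ.≤ ℚ.∣ p ℚ.- q ∣ ℚ.+ ℚ.∣ q ∣
    ∣p∣≤∣p-q∣+∣q∣ p q =
      subst (λ t → ℚ.∣ t ∣ ℚ.≤ ℚ.∣ p ℚ.- q ∣ ℚ.+ ℚ.∣ q ∣) (//-rightDividesˡ q p)
            (ℚ.∣p+q∣≤∣p∣+∣q∣ (p ℚ.- q) q)

    ∣p∣-∣q∣≤∣p-q∣ : ∀ p q → ℚ.∣ p ∣ ℚ.- ℚ.∣ q ∣ ℚ.≤ ℚ.∣ p ℚ.- q ∣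
    ∣p∣-∣q∣≤∣p-q∣ p q =
      subst (ℚ.∣ p ∣ ℚ.- ℚ.∣ q ∣ ℚ.≤_)
            (//-rightDividesʳ ℚ.∣ q ∣ ℚ.∣ p ℚ.- q ∣)
            (ℚ.+-monoˡ-≤ (ℚ.- ℚ.∣ q ∣) (∣p∣≤∣p-q∣+∣q∣ p q))

    ∣∣-lipschitz : ∀ p q → ℚ.∣ ℚ.∣ p ∣ ℚ.- ℚ.∣ q ∣ ∣ ℚ.≤ ℚ.∣ p ℚ.- q ∣
    ∣∣-lipschitz p q with ℚ.∣p∣≡p∨∣p∣≡-p (ℚ.∣ p ∣ ℚ.- ℚ.∣ q ∣)
    ... | inj₁ eq = subst (ℚ._≤ ℚ.∣ p ℚ.- q ∣) (sym eq) (∣p∣-∣q∣≤∣p-q∣ p q)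
    ... | inj₂ eq =
      subst₂ ℚ._≤_
        (trans (sym (⁻¹-anti-homo‿- ℚ.∣ p ∣ ℚ.∣ q ∣)) (sym eq))
        (∣-∣-swap q p) (∣p∣-∣q∣≤∣p-q∣ q p)

    -‿lipschitz : ∀ p q → ℚ.∣ ℚ.- p ℚ.- ℚ.- q ∣ ℚ.≤ ℚ.∣ p ℚ.- q ∣
    -‿lipschitz p q = ℚ.≤-reflexive
      (trans (cong ℚ.∣_∣ (⁻¹-∙-comm p (ℚ.- q)))
             (ℚ.∣-p∣≡∣p∣ (p ℚ.- q)))

    -‿interchange : ∀ a b c d →
      (a ℚ.- b) ℚ.+ (c ℚ.- d) ≡ (a ℚ.+ c) ℚ.- (b ℚ.+ d)
    -‿interchange a b c d =
      trans (interchange a (ℚ.- b) c (ℚ.- d)) (cong (a ℚ.+ c ℚ.+_) (⁻¹-∙-comm b d))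

    abstract
      +-cauchy : ∀ s t → IsCauchy s → IsCauchy t → IsCauchy (λ n → s n ℚ.+ t n)
      +-cauchy s t cs ct ε ε>0
        with cs (ε ℚ.* ℚ.½) (half>0 ε ε>0) | ct (ε ℚ.* ℚ.½) (half>0 ε ε>0)
      ... | M , h | N , g = M ℕ.⊔ N , λ m n p q →
        ℚ.<-≤-trans
          (ℚ.≤-<-trans
            (subst (λ u → ℚ.∣ u ∣ ℚ.≤ ℚ.∣ s m ℚ.- s n ∣ ℚ.+ ℚ.∣ t m ℚ.- t n ∣)
              (-‿interchange (s m) (s n) (t m) (t n))
              (ℚ.∣p+q∣≤∣p∣+∣q∣ (s m ℚ.- s n) (t m ℚ.- t n)))
            (ℚ.+-mono-<
              (h m n (ℕ.≤-trans (ℕ.m≤m⊔n M N) p) (ℕ.≤-trans (ℕ.m≤m⊔n M N) q))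
              (g m n (ℕ.≤-trans (ℕ.m≤n⊔m M N) p) (ℕ.≤-trans (ℕ.m≤n⊔m M N) q))))
          (ℚ.≤-reflexive (half+half ε))

    EventuallyBounded : (ℕ → ℚ) → Set
    EventuallyBounded s =
      ∃ λ K → 0ℚ ℚ.< K × ∃ λ M → ∀ n → M ℕ.≤ n → ℚ.∣ s n ∣ ℚ.≤ K

    bounded : ∀ s → IsCauchy s → EventuallyBounded s
    bounded s cs with cs 1ℚ (ℚ.positive⁻¹ 1ℚ)
    ... | M , h = 1ℚ ℚ.+ ℚ.∣ s M ∣
                , ℚ.+-mono-<-≤ (ℚ.positive⁻¹ 1ℚ) (ℚ.0≤∣p∣ (s M))
                , M , λ n M≤n → ℚ.≤-trans (∣p∣≤∣p-q∣+∣q∣ (s n) (s M))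
                    (ℚ.+-monoˡ-≤ ℚ.∣ s M ∣ (ℚ.<⇒≤ (h n M M≤n ℕ.≤-refl)))

    shrink : ∀ K ε → 0ℚ ℚ.< K → 0ℚ ℚ.< ε →
             ∃ λ δ → 0ℚ ℚ.< δ × K ℚ.* δ ≡ ε
    shrink K ε K>0 ε>0 = δ , δ>0 , Kδ≡ε
      where
      instance
        posK : ℚ.Positive K
        posK = ℚ.positive K>0
        posε : ℚ.Positive ε
        posε = ℚ.positive ε>0
        nzK : ℚ.NonZero K
        nzK = ℚ.pos⇒nonZero K
      δ : ℚ
      δ = ε ℚ.* ℚ.1/ K
      δ>0 : 0ℚ ℚ.< δ
      δ>0 = ℚ.positive⁻¹ δ {{ℚ.pos*pos⇒pos ε (ℚ.1/ K) {{ℚ.1/pos⇒pos K}}}}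
      Kδ≡ε : K ℚ.* δ ≡ ε
      Kδ≡ε = trans (x∙yz≈y∙xz K ε (ℚ.1/ K))
               (trans (cong (ε ℚ.*_) (ℚ.*-inverseʳ K)) (ℚ.*-identityʳ ε))

    *-mono-∣∣ : ∀ u v {K δ} → ℚ.∣ u ∣ ℚ.≤ K → ℚ.∣ v ∣ ℚ.≤ δ →
                ℚ.∣ u ℚ.* v ∣ ℚ.≤ K ℚ.* δ
    *-mono-∣∣ u v {K} {δ} u≤K v≤δ = subst (ℚ._≤ K ℚ.* δ) (sym (ℚ.∣p*q∣≡∣p∣*∣q∣ u v))
      (ℚ.≤-trans (ℚ.*-monoʳ-≤-nonNeg ℚ.∣ v ∣ {{ℚ.∣-∣-nonNeg v}} u≤K)
                 (ℚ.*-monoˡ-≤-nonNeg K {{ℚ.nonNegative (ℚ.≤-trans (ℚ.0≤∣p∣ u) u≤K)}} v≤δ))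

    *-telescope : ∀ a b c d →
      a ℚ.* (c ℚ.- d) ℚ.+ (a ℚ.- b) ℚ.* d ≡ a ℚ.* c ℚ.- b ℚ.* d
    *-telescope a b c d =
      trans (cong₂ ℚ._+_ (x[y-z]≈xy-xz a c d) ([y-z]x≈yx-zx d a b))
        (trans (sym (ℚ.+-assoc (a ℚ.* c ℚ.- a ℚ.* d) (a ℚ.* d) (ℚ.- (b ℚ.* d))))
               (cong (ℚ._- b ℚ.* d) (//-rightDividesˡ (a ℚ.* d) (a ℚ.* c))))

    *-estimate : ∀ a b c d {K L δ η} →
      ℚ.∣ a ∣ ℚ.≤ K → ℚ.∣ d ∣ ℚ.≤ L →
      ℚ.∣ c ℚ.- d ∣ ℚ.≤ δ → ℚ.∣ a ℚ.- b ∣ ℚ.≤ η →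
      ℚ.∣ a ℚ.* c ℚ.- b ℚ.* d ∣ ℚ.≤ K ℚ.* δ ℚ.+ η ℚ.* L
    *-estimate a b c d {K} {L} {δ} {η} a≤K d≤L c-d≤δ a-b≤η =
      subst (λ u → ℚ.∣ u ∣ ℚ.≤ K ℚ.* δ ℚ.+ η ℚ.* L)
        (*-telescope a b c d)
        (ℚ.≤-trans (ℚ.∣p+q∣≤∣p∣+∣q∣ (a ℚ.* (c ℚ.- d)) ((a ℚ.- b) ℚ.* d))
          (ℚ.+-mono-≤ (*-mono-∣∣ a (c ℚ.- d) a≤K c-d≤δ)
                      (*-mono-∣∣ (a ℚ.- b) d a-b≤η d≤L)))

    half<self : ∀ ε → 0ℚ ℚ.< ε → ε ℚ.* ℚ.½ ℚ.< ε
    half<self ε ε>0 = subst₂ ℚ._<_ (ℚ.+-identityʳ (ε ℚ.* ℚ.½)) (half+half ε)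
      (ℚ.+-monoʳ-< (ε ℚ.* ℚ.½) (half>0 ε ε>0))

    abstract
      *-cauchy : ∀ s t → IsCauchy s → IsCauchy t → IsCauchy (λ n → s n ℚ.* t n)
      *-cauchy s t cs ct ε ε>0 = go (bounded s cs) (bounded t ct)
        where
        ε/2 ε/4 : ℚ
        ε/2 = ε ℚ.* ℚ.½
        ε/4 = ε/2 ℚ.* ℚ.½
        ε/4>0 : 0ℚ ℚ.< ε/4
        ε/4>0 = half>0 ε/2 (half>0 ε ε>0)
        Goal : Set
        Goal = ∃ λ M → ∀ m n → M ℕ.≤ m → M ℕ.≤ n →
               ℚ.∣ s m ℚ.* t m ℚ.- s n ℚ.* t n ∣ ℚ.< ε
        go : EventuallyBounded s → EventuallyBounded t → Goal
        go (K , K>0 , M₁ , h₁) (L , L>0 , M₂ , h₂) =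
          go′ (shrink K ε/4 K>0 ε/4>0) (shrink L ε/4 L>0 ε/4>0)
          where
          go′ : (∃ λ δ → 0ℚ ℚ.< δ × K ℚ.* δ ≡ ε/4) →
                (∃ λ η → 0ℚ ℚ.< η × L ℚ.* η ≡ ε/4) → Goal
          go′ (δ , δ>0 , Kδ) (η , η>0 , Lη) = go″ (ct δ δ>0) (cs η η>0)
            where
            go″ : (∃ λ M → ∀ m n → M ℕ.≤ m → M ℕ.≤ n → ℚ.∣ t m ℚ.- t n ∣ ℚ.< δ) →
                  (∃ λ M → ∀ m n → M ℕ.≤ m → M ℕ.≤ n → ℚ.∣ s m ℚ.- s n ∣ ℚ.< η) → Goal
            go″ (M₃ , h₃) (M₄ , h₄) = (M₁ ℕ.⊔ M₂) ℕ.⊔ (M₃ ℕ.⊔ M₄) , λ m n p q →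
              ℚ.≤-<-trans
                (ℚ.≤-trans
                  (*-estimate (s m) (s n) (t m) (t n)
                    (h₁ m (left (ℕ.m≤m⊔n M₁ M₂) p))
                    (h₂ n (left (ℕ.m≤n⊔m M₁ M₂) q))
                    (ℚ.<⇒≤ (h₃ m n (right (ℕ.m≤m⊔n M₃ M₄) p) (right (ℕ.m≤m⊔n M₃ M₄) q)))
                    (ℚ.<⇒≤ (h₄ m n (right (ℕ.m≤n⊔m M₃ M₄) p) (right (ℕ.m≤n⊔m M₃ M₄) q))))
                  (ℚ.≤-reflexive (trans (cong₂ ℚ._+_ Kδ (trans (ℚ.*-comm η L) Lη)) (half+half ε/2))))
                (half<self ε ε>0)
              where
              left : ∀ {M n} → M ℕ.≤ M₁ ℕ.⊔ M₂ → (M₁ ℕ.⊔ M₂) ℕ.⊔ (M₃ ℕ.⊔ M₄) ℕ.≤ n → M ℕ.≤ n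
              left h p = ℕ.≤-trans h (ℕ.≤-trans (ℕ.m≤m⊔n _ (M₃ ℕ.⊔ M₄)) p)
              right : ∀ {M n} → M ℕ.≤ M₃ ℕ.⊔ M₄ → (M₁ ℕ.⊔ M₂) ℕ.⊔ (M₃ ℕ.⊔ M₄) ℕ.≤ n → M ℕ.≤ n
              right h p = ℕ.≤-trans h (ℕ.≤-trans (ℕ.m≤n⊔m (M₁ ℕ.⊔ M₂) _) p)

    abstract
      const-cauchy : ∀ q → IsCauchy (λ _ → q)
      const-cauchy q ε ε>0 = 0 , λ _ _ _ _ →
        subst (λ u → ℚ.∣ u ∣ ℚ.< ε) (sym (ℚ.+-inverseʳ q)) ε>0

  infixl 6 _+_
  infixl 7 _*_
  infix  8 -_

  _+_ _*_ : ℝ → ℝ → ℝ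
  x + y = mkℝ (λ n → seq x n ℚ.+ seq y n) (+-cauchy (seq x) (seq y) (cauchy x) (cauchy y))
  x * y = mkℝ (λ n → seq x n ℚ.* seq y n) (*-cauchy (seq x) (seq y) (cauchy x) (cauchy y))

  -_ ∣_∣ : ℝ → ℝ
  - x   = mkℝ (λ n → ℚ.- seq x n) (lipschitz-cauchy ℚ.-_ -‿lipschitz (seq x) (cauchy x))
  ∣ x ∣ = mkℝ (λ n → ℚ.∣ seq x n ∣) (lipschitz-cauchy ℚ.∣_∣ ∣∣-lipschitz (seq x) (cauchy x))

  fromℚ : ℚ → ℝ
  fromℚ q = mkℝ (λ _ → q) (const-cauchy q)

infixl 6 _-_
_-_ : ℝ → ℝ → ℝ
x - y = x + - y

fromℕ : ℕ → ℝ
fromℕ n = fromℚ (+ n ℚ./ 1)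

infixr 8 _^_
_^_ : ℝ → ℕ → ℝ
x ^ zero  = fromℕ 1
x ^ suc n = x * x ^ n

infix 4 _≤_ _<_ _⟶_

_≤_ _<_ : ℝ → ℝ → Set
x ≤ y = ∀ ε → 0ℚ ℚ.< ε → ∃ λ M → ∀ n → M ℕ.≤ n → seq x n ℚ.≤ seq y n ℚ.+ ε
x < y = ∃ λ ε → 0ℚ ℚ.< ε × ∃ λ M → ∀ n → M ℕ.≤ n → seq x n ℚ.+ ε ℚ.≤ seq y n

_⟶_ : (ℕ → ℝ) → ℝ → Set
a ⟶ L = ∀ ε → 0ℚ ℚ.< ε → ∃ λ M → ∀ n → M ℕ.≤ n → ∣ a n - L ∣ ≤ fromℚ ε

-- N = ⌊x⌋, a relation because the floor is not computable on Cauchy reals.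
-- A positive integer n satisfies n ≤ x exactly when n ≤ ⌊x⌋.
IsFloor : ℝ → ℕ → Set
IsFloor x N = fromℕ N ≤ x × x < fromℕ (suc N)

-- ℓ = log x, in the form e^ℓ = x with e^ℓ = lim (1 + ℓ/n)^n.
IsLog : ℝ → ℝ → Set
IsLog x ℓ = (λ n → (fromℕ 1 + fromℚ (+ 1 ℚ./ suc n) * ℓ) ^ suc n) ⟶ x

------------------------------------------------------------------------
-- k-wise relatively prime tuples

gcdᵛ : ∀ {k} → Vec ℕ k → ℕ
gcdᵛ = Vec.foldr′ gcd 0

-- Index vectors satisfying Linked _<_ are the i₁ < ⋯ < iₖ.
KWiseCoprime : ∀ {r} → ℕ → Vec ℕ r → Set
KWiseCoprime {r} k n = (i : Vec (Fin r) k) → Linked Fin._<_ i →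
  gcdᵛ (Vec.map (Vec.lookup n) i) ≡ 1

allVec? : ∀ {r} k {P : Vec (Fin r) k → Set} → (∀ i → Dec (P i)) → Dec (∀ i → P i)
allVec? zero    P? = map′ (λ { p [] → p }) (λ p → p []) (P? [])
allVec? (suc k) P? = map′ (λ { p (i ∷ is) → p i is }) (λ p i is → p (i ∷ is))
  (Fin.all? (λ i → allVec? k (λ is → P? (i ∷ is))))

kWiseCoprime? : ∀ {r} k (n : Vec ℕ r) → Dec (KWiseCoprime k n)
kWiseCoprime? k n = allVec? k
  (λ i → linked? Fin._<?_ i →-dec (gcdᵛ (Vec.map (Vec.lookup n) i) ℕ.≟ 1))

ϱ : ∀ {r} → ℕ → Vec ℕ r → ℕ
ϱ k n = if does (kWiseCoprime? k n) then 1 else 0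

-- The sum of f over all r-tuples with entries in {1, …, N}.
sumTuples : ∀ r → ℕ → (Vec ℕ r → ℕ) → ℕ
sumTuples zero    N f = f []
sumTuples (suc r) N f =
  sum (List.map (λ n → sumTuples r N (λ ns → f (n ∷ ns))) (List.applyUpTo suc N))

------------------------------------------------------------------------
-- The constant A and the error term R

-- The index j runs over k, k+1, …, r.
eulerFactor : (r k p : ℕ) .{{_ : ℕ.NonZero p}} → ℚ
eulerFactor r k p =
  1ℚ ℚ.- List.foldr ℚ._+_ 0ℚ (List.map term (List.applyUpTo (k ℕ.+_) (suc r ∸ k)))
  where
  term : ℕ → ℚ
  term j = ((-1ℤ ℤ.^ (j ∸ k)) ℤ.* + ((r C j) ℕ.* ((j ∸ 1) C (k ∸ 1)))) ℚ./ (p ℕ.^ j)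
    where instance _ = ℕ.m^n≢0 p j

-- The product over the primes p ≤ M.
eulerProduct : (r k M : ℕ) → ℚ
eulerProduct r k zero    = 1ℚ
eulerProduct r k (suc m) =
  if does (prime? (suc m))
  then eulerProduct r k m ℚ.* eulerFactor r k (suc m)
  else eulerProduct r k m

-- IsA r k A states that A is the value of the (convergent) infinite product.
IsA : (r k : ℕ) → ℝ → Set
IsA r k A = (λ M → fromℚ (eulerProduct r k M)) ⟶ A

-- IsR r k x R states that R is the value of the error term at x.
data IsR (r k : ℕ) (x : ℝ) : ℝ → Set where
  k≥3 : 3 ℕ.≤ k → IsR r k x (x ^ (r ∸ 1))
  k≡2 : ∀ {ℓ} → k ≡ 2 → IsLog x ℓ → IsR r k x (x ^ (r ∸ 1) * ℓ ^ (r ∸ 1))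

-- A tuple is k-wise relatively prime when every prime divides fewer than k of
-- its entries.  Let F_m(y) count the tuples with entries n_i ≤ y_i in which no
-- prime p ≤ m divides k or more entries.  Inclusion-exclusion at a prime p gives
-- F_p(y) = Σ_s ψ(|s|) F_{p-1}(y with y_i replaced by y_i/p for i ∈ s), and the
-- same recursion is satisfied by the main term y_1 ⋯ y_r times the Euler product
-- over the primes up to p.  Initially F_0 is the product of the ⌊y_i⌋, which differs
-- from the product of the y_i by at most Σ_j min(1, y_j) ∏_{i≠j} y_i.  Errors of the
-- shape Σ_j e(y_j) ∏_{i≠j} y_i keep this shape, and at the prime p the envelope e(y)
-- becomes at most (1 + K/p²) e(y) + (c/p) e(y/p), where c = 0 for k ≥ 3 and c = r − 1
-- for k = 2.  The factors 1 + K/p² multiply to a bounded constant.  The terms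
-- (c/p) e(y/p) cost at most c nested sums Σ_d min(1, y/d)/d over squarefree d,
-- each of them O(log N) for y ≤ N.  This bound is uniform in m, so that for m ≥ N it
-- applies to the given count, and letting m → ∞ turns the Euler product into A.

module Submission where

open import Algebra.Bundles using (CommutativeRing)
open import Data.Bool using (true; false; if_then_else_)
open import Data.Fin as Fin using (Fin)
import Data.Integer as ℤ
import Data.Integer.Properties as ℤ
open import Data.List as List using (List; []; _∷_; _++_)
open import Data.List.Membership.Propositional using (_∈_)
open import Data.List.Membership.Propositional.Properties
  using (∈-∃++; ∈-++⁺ˡ; ∈-++⁺ʳ; ∈-++⁻; ∈-map⁻; ∈-applyUpTo⁺)
import Data.List.Relation.Unary.All as ListAll
open ListAll using ([]; _∷_)
open import Data.List.Relation.Unary.AllPairs using ([]; _∷_)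
open import Data.List.Relation.Unary.Any using (here; there)
open import Data.List.Relation.Unary.Unique.Propositional using (Unique)
import Data.List.Relation.Unary.Unique.Propositional.Properties as Unique
open import Data.Nat as ℕ using (ℕ; zero; suc; z≤n; s≤s)
open import Data.Nat.Combinatorics using (_C_; nCk+nC[k+1]≡[n+1]C[k+1]; k>n⇒nCk≡0)
open import Data.Nat.Divisibility
  using (_∣_; _∣?_; _∣0; divides; ∣-trans; ∣⇒≤; >⇒∤; 0∣⇒≡0; ∣1⇒≡1; m∣m*n; n∣m*n; ∣n⇒∣m*n; ∣m+n∣m⇒∣n)
import Data.Nat.DivMod as ℕ
open import Data.Nat.GCD using (gcd[m,n]∣m; gcd[m,n]∣n; gcd-greatest)
open import Data.Nat.ListAction using (sum; product)
open import Data.Nat.Primality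
  using (Prime; prime?; euclidsLemma; prime⇒irreducible; prime⇒nonTrivial)
open import Data.Nat.Primality.Factorisation using (factorise; module PrimeFactorisation)
import Data.Nat.Properties as ℕ
open import Data.Product using (∃; _×_; _,_; proj₁; proj₂)
import Data.Rational.Properties as ℚ
import Data.Rational.Unnormalised as ℚᵘ
import Data.Rational.Unnormalised.Properties as ℚᵘ
open import Data.Sum using (_⊎_; inj₁; inj₂)
open import Data.Vec as Vec using (Vec; []; _∷_)
open import Data.Vec.Properties using (map-∘)
open import Data.Vec.Relation.Binary.Pointwise.Inductive as Pointwise using (Pointwise; []; _∷_)
open import Data.Vec.Relation.Unary.All using (All; []; _∷_)
open import Data.Vec.Relation.Unary.All.Properties using (lookup⁺)
open import Data.Vec.Relation.Unary.Linked as Linked using (Linked; []; [-]; _∷_)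
import Data.Vec.Relation.Unary.Linked.Properties as Linked
open import Function using (_∘_; mk⇔)
open import Relation.Binary.PropositionalEquality hiding ([_])
open import Relation.Nullary using (Dec; yes; no; ¬_; does; contradiction)
open import Relation.Nullary.Decidable using (dec-true; dec-false; does-⇔; decidable-stable)
import Defs

-- Replacing a single coordinate has weight ψ(1) = 0 for k ≥ 2, which is why the Euler factors are 1
-- + O(1/p²). Replacing two has weight ψ(2), equal to -1 for k = 2 and to 0 for k ≥ 3; in an error
-- term the distinguished coordinate can pair with each of the r - 1 others, and this is the origin
-- of c and of the two shapes of R. It is tempting to bound e(y/p) by e(y), but the resulting
-- product of the factors 1 + c/p grows without bound as m increases. So the scaled argument is
-- kept, and the recursion is solved by convolution, one unit of c at a time: the truncation min(1,
-- y/d) makes each sum over d converge, with a bound that depends on N alone. The weights satisfy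
-- |ψ(j)| ≤ 2^j for every k, so all constants are built from r only.

module Sieve where

  open import Data.Rational
  open import Data.Rational.Solver using (module +-*-Solver)
  open +-*-Solver using (solve; con; _:=_; _:+_; _:*_; _:-_; :-_)
  open import Algebra.Properties.CommutativeSemiring.Exp
    (CommutativeRing.commutativeSemiring ℚ.+-*-commutativeRing)
    using (_^_; ^-distrib-*; ^-homo-*; ^-assocʳ)
  open Defs using
    ( ℝ; mkℝ; seq; cauchy; IsCauchy; fromℕ; fromℚ; IsFloor; IsLog; IsA; IsR; k≥3; k≡2
    ; gcdᵛ; KWiseCoprime; kWiseCoprime?; ϱ; sumTuples; eulerFactor; eulerProduct )

  -- Rational inequalities

  0≤1 : 0ℚ ≤ 1ℚ
  0≤1 = ℚ.nonNegative⁻¹ 1ℚ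

  0≤+ : ∀ {a b} → 0ℚ ≤ a → 0ℚ ≤ b → 0ℚ ≤ a + b
  0≤+ = ℚ.+-mono-≤

  *-monoˡ : ∀ {a b} c → 0ℚ ≤ c → a ≤ b → c * a ≤ c * b
  *-monoˡ c 0≤c = ℚ.*-monoˡ-≤-nonNeg c {{nonNegative 0≤c}}

  *-monoʳ : ∀ {a b} c → 0ℚ ≤ c → a ≤ b → a * c ≤ b * c
  *-monoʳ c 0≤c = ℚ.*-monoʳ-≤-nonNeg c {{nonNegative 0≤c}}

  0≤* : ∀ {a b} → 0ℚ ≤ a → 0ℚ ≤ b → 0ℚ ≤ a * b
  0≤* {a} {b} 0≤a 0≤b = subst (_≤ a * b) (ℚ.*-zeroʳ a) (*-monoˡ a 0≤a 0≤b)

  *-mono : ∀ {a b c d} → 0ℚ ≤ a → a ≤ b → 0ℚ ≤ c → c ≤ d → a * c ≤ b * d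
  *-mono {b = b} {c} 0≤a a≤b 0≤c c≤d =
    ℚ.≤-trans (*-monoʳ c 0≤c a≤b) (*-monoˡ b (ℚ.≤-trans 0≤a a≤b) c≤d)

  -- Reduces an inequality to a nonnegative slack `d` and an identity that the ring solver can
  -- check; many estimates below have this form.
  ≤-by : ∀ {a b} d → 0ℚ ≤ d → b ≡ a + d → a ≤ b
  ≤-by {a} {b} d 0≤d b≡a+d = begin
    a      ≡⟨ ℚ.+-identityʳ a ⟨
    a + 0ℚ ≤⟨ ℚ.+-monoʳ-≤ a 0≤d ⟩
    a + d  ≡⟨ b≡a+d ⟨
    b      ∎
    where open ℚ.≤-Reasoning

  0≤b-a : ∀ {a b} → a ≤ b → 0ℚ ≤ b - a
  0≤b-a {a} {b} a≤b = subst (_≤ b - a) (ℚ.+-inverseʳ a) (ℚ.+-monoˡ-≤ (- a) a≤b)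

  a≤a+b : ∀ {a b} → 0ℚ ≤ b → a ≤ a + b
  a≤a+b {b = b} 0≤b = ≤-by b 0≤b refl

  a≤b+a : ∀ {a b} → 0ℚ ≤ b → a ≤ b + a
  a≤b+a {a} {b} 0≤b = ≤-by b 0≤b (ℚ.+-comm b a)

  a≤b*a : ∀ {a b} → 0ℚ ≤ a → 1ℚ ≤ b → a ≤ b * a
  a≤b*a {a} {b} 0≤a 1≤b = subst (_≤ b * a) (ℚ.*-identityˡ a) (*-monoʳ a 0≤a 1≤b)

  0≤^ : ∀ {a} n → 0ℚ ≤ a → 0ℚ ≤ a ^ n
  0≤^ zero    0≤a = 0≤1
  0≤^ (suc n) 0≤a = 0≤* 0≤a (0≤^ n 0≤a)

  ^-mono : ∀ {a b} n → 0ℚ ≤ a → a ≤ b → a ^ n ≤ b ^ n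
  ^-mono zero    0≤a a≤b = ℚ.≤-refl
  ^-mono (suc n) 0≤a a≤b = *-mono 0≤a a≤b (0≤^ n 0≤a) (^-mono n 0≤a a≤b)

  1≤^ : ∀ {a} n → 1ℚ ≤ a → 1ℚ ≤ a ^ n
  1≤^ zero    1≤a = ℚ.≤-refl
  1≤^ (suc n) 1≤a = *-mono 0≤1 1≤a 0≤1 (1≤^ n 1≤a)

  ∣+∣≤ : ∀ {a b α β} → ∣ a ∣ ≤ α → ∣ b ∣ ≤ β → ∣ a + b ∣ ≤ α + β
  ∣+∣≤ {a} {b} p q = ℚ.≤-trans (ℚ.∣p+q∣≤∣p∣+∣q∣ a b) (ℚ.+-mono-≤ p q)

  ∣*∣≤ : ∀ {a b α β} → ∣ a ∣ ≤ α → ∣ b ∣ ≤ β → ∣ a * b ∣ ≤ α * β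
  ∣*∣≤ {a} {b} {α} {β} p q = subst (_≤ α * β) (sym (ℚ.∣p*q∣≡∣p∣*∣q∣ a b))
    (*-mono (ℚ.0≤∣p∣ a) p (ℚ.0≤∣p∣ b) q)

  p≤∣p∣ : ∀ p → p ≤ ∣ p ∣
  p≤∣p∣ p with ℚ.∣p∣≡p∨∣p∣≡-p p
  ... | inj₁ eq = ℚ.≤-reflexive (sym eq)
  ... | inj₂ eq = ℚ.≤-trans p≤0 (ℚ.0≤∣p∣ p)
    where
    p≤0 : p ≤ 0ℚ
    p≤0 = subst (_≤ 0ℚ) (solve 1 (λ p → :- (:- p) := p) refl p)
            (ℚ.neg-antimono-≤ (subst (0ℚ ≤_) eq (ℚ.0≤∣p∣ p)))

  ∣∣≤ : ∀ {p b} → p ≤ b → - p ≤ b → ∣ p ∣ ≤ b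
  ∣∣≤ {p} {b} p≤b -p≤b with ℚ.∣p∣≡p∨∣p∣≡-p p
  ... | inj₁ eq = subst (_≤ b) (sym eq) p≤b
  ... | inj₂ eq = subst (_≤ b) (sym eq) -p≤b

  a≤b+∣a-b∣ : ∀ a b → a ≤ b + ∣ a - b ∣
  a≤b+∣a-b∣ a b = begin
    a               ≡⟨ solve 2 (λ a b → a := b :+ (a :- b)) refl a b ⟩
    b + (a - b)     ≤⟨ ℚ.+-monoʳ-≤ b (p≤∣p∣ (a - b)) ⟩
    b + ∣ a - b ∣   ∎
    where open ℚ.≤-Reasoning

  ∣-∣-comm : ∀ a b → ∣ a - b ∣ ≡ ∣ b - a ∣
  ∣-∣-comm a b = trans (sym (ℚ.∣-p∣≡∣p∣ (a - b)))
    (cong ∣_∣ (solve 2 (λ a b → :- (a :- b) := b :- a) refl a b))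

  -- Natural numbers and their reciprocals as rationals

  abstract
    -- Opaque, so that type checking never normalises the fraction and the ring solver meets an
    -- atom; `ι≡/1` is the one way to see through it.
    ι : ℕ → ℚ
    ι n = ℤ.+ n / 1

    ι≡/1 : ∀ n → ι n ≡ ℤ.+ n / 1
    ι≡/1 n = refl

  ι0 : ι 0 ≡ 0ℚ
  ι0 = ι≡/1 0

  ι1 : ι 1 ≡ 1ℚ
  ι1 = ι≡/1 1

  ιᵘ : ∀ n → toℚᵘ (ι n) ℚᵘ.≃ ℚᵘ.mkℚᵘ (ℤ.+ n) 0
  ιᵘ n = subst (λ q → toℚᵘ q ℚᵘ.≃ ℚᵘ.mkℚᵘ (ℤ.+ n) 0) (sym (ι≡/1 n))
    (ℚ.toℚᵘ-fromℚᵘ (ℚᵘ.mkℚᵘ (ℤ.+ n) 0))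

  ι-+ : ∀ m n → ι (m ℕ.+ n) ≡ ι m + ι n
  ι-+ m n = ℚ.toℚᵘ-injective (begin
    toℚᵘ (ι (m ℕ.+ n))                        ≈⟨ ιᵘ (m ℕ.+ n) ⟩
    ℚᵘ.mkℚᵘ (ℤ.+ (m ℕ.+ n)) 0                   ≈⟨ ℚᵘ.*≡* eq ⟩
    ℚᵘ.mkℚᵘ (ℤ.+ m) 0 ℚᵘ.+ ℚᵘ.mkℚᵘ (ℤ.+ n) 0
      ≈⟨ ℚᵘ.+-cong (ιᵘ m) (ιᵘ n) ⟨
    toℚᵘ (ι m) ℚᵘ.+ toℚᵘ (ι n)                ≈⟨ ℚ.toℚᵘ-homo-+ (ι m) (ι n) ⟨
    toℚᵘ (ι m + ι n)                          ∎)
    where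
    open ℚᵘ.≃-Reasoning
    eq : ℤ.+ (m ℕ.+ n) ℤ.* ℤ.+ 1 ≡ (ℤ.+ m ℤ.* ℤ.+ 1 ℤ.+ ℤ.+ n ℤ.* ℤ.+ 1) ℤ.* ℤ.+ 1
    eq = cong (ℤ._* ℤ.+ 1) (sym (cong₂ ℤ._+_ (ℤ.*-identityʳ (ℤ.+ m)) (ℤ.*-identityʳ (ℤ.+ n))))

  ι-suc : ∀ n → ι (suc n) ≡ 1ℚ + ι n
  ι-suc n = trans (ι-+ 1 n) (cong (_+ ι n) ι1)

  ι-* : ∀ m n → ι (m ℕ.* n) ≡ ι m * ι n
  ι-* zero    n = trans ι0 (trans (sym (ℚ.*-zeroˡ (ι n))) (cong (_* ι n) (sym ι0)))
  ι-* (suc m) n = begin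
    ι (n ℕ.+ m ℕ.* n)   ≡⟨ ι-+ n (m ℕ.* n) ⟩
    ι n + ι (m ℕ.* n)   ≡⟨ cong (ι n +_) (ι-* m n) ⟩
    ι n + ι m * ι n     ≡⟨ solve 2 (λ x y → x :+ y :* x := (con 1ℚ :+ y) :* x) refl (ι n) (ι m) ⟩
    (1ℚ + ι m) * ι n    ≡⟨ cong (_* ι n) (ι-suc m) ⟨
    ι (suc m) * ι n     ∎
    where open ≡-Reasoning

  0≤ι : ∀ n → 0ℚ ≤ ι n
  0≤ι zero    = ℚ.≤-reflexive (sym ι0)
  0≤ι (suc n) = subst (0ℚ ≤_) (sym (ι-suc n)) (0≤+ 0≤1 (0≤ι n))

  ι-mono : ∀ {m n} → m ℕ.≤ n → ι m ≤ ι n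
  ι-mono {m} {n} m≤n with ℕ.m≤n⇒∃[o]m+o≡n m≤n
  ... | o , refl = ≤-by (ι o) (0≤ι o) (ι-+ m o)

  1≤ι : ∀ {n} → 1 ℕ.≤ n → 1ℚ ≤ ι n
  1≤ι {n} 1≤n = subst (_≤ ι n) ι1 (ι-mono 1≤n)

  ι-mono-< : ∀ {m n} → m ℕ.< n → ι m < ι n
  ι-mono-< {m} {n} m<n = ℚ.<-≤-trans
    (subst₂ _<_ (ℚ.+-identityˡ (ι m)) (sym (ι-suc m)) (ℚ.+-monoˡ-< (ι m) (ℚ.positive⁻¹ 1ℚ)))
    (ι-mono m<n)

  ι-cancel-≤ : ∀ {m n} → ι m ≤ ι n → m ℕ.≤ n
  ι-cancel-≤ {m} {n} p = ℕ.≮⇒≥ λ n<m → ℚ.<-irrefl refl (ℚ.<-≤-trans (ι-mono-< n<m) p)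

  ι-cancel-< : ∀ {m n} → ι m < ι n → m ℕ.< n
  ι-cancel-< {m} {n} p = ℕ.≰⇒> λ n≤m → ℚ.<-irrefl refl (ℚ.<-≤-trans p (ι-mono n≤m))

  ι-^ : ∀ m n → ι (m ℕ.^ n) ≡ ι m ^ n
  ι-^ m zero    = ι1
  ι-^ m (suc n) = trans (ι-* m (m ℕ.^ n)) (cong (ι m *_) (ι-^ m n))

  -- rcp 0 = 0 is a junk value.
  abstract
    rcp : ℕ → ℚ
    rcp zero    = 0ℚ
    rcp (suc n) = ℤ.+ 1 / suc n

    rcp0 : rcp 0 ≡ 0ℚ
    rcp0 = refl

    rcp-suc≡/ : ∀ n → rcp (suc n) ≡ ℤ.+ 1 / suc n
    rcp-suc≡/ n = refl

  ι*/≡ : ∀ i n .{{_ : ℕ.NonZero n}} → ι n * (i / n) ≡ i / 1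
  ι*/≡ i (suc n) = ℚ.toℚᵘ-injective (begin
    toℚᵘ (ι (suc n) * (i / suc n))              ≈⟨ ℚ.toℚᵘ-homo-* (ι (suc n)) (i / suc n) ⟩
    toℚᵘ (ι (suc n)) ℚᵘ.* toℚᵘ (i / suc n)
      ≈⟨ ℚᵘ.*-cong (ιᵘ (suc n)) (ℚ.toℚᵘ-fromℚᵘ (ℚᵘ.mkℚᵘ i n)) ⟩
    ℚᵘ.mkℚᵘ (ℤ.+ suc n) 0 ℚᵘ.* ℚᵘ.mkℚᵘ i n       ≈⟨ ℚᵘ.*≡* eq ⟩
    ℚᵘ.mkℚᵘ i 0                                 ≈⟨ ℚ.toℚᵘ-fromℚᵘ (ℚᵘ.mkℚᵘ i 0) ⟨
    toℚᵘ (i / 1)                                ∎)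
    where
    open ℚᵘ.≃-Reasoning
    eq : (ℤ.+ suc n ℤ.* i) ℤ.* ℤ.+ 1 ≡ i ℤ.* ℤ.+ (1 ℕ.* suc n)
    eq = trans (ℤ.*-identityʳ _) (trans (ℤ.*-comm (ℤ.+ suc n) i)
           (cong (λ m → i ℤ.* ℤ.+ m) (sym (ℕ.*-identityˡ (suc n)))))

  ι*rcp : ∀ n .{{_ : ℕ.NonZero n}} → ι n * rcp n ≡ 1ℚ
  ι*rcp (suc n) = trans (cong (ι (suc n) *_) (rcp-suc≡/ n)) (ι*/≡ (ℤ.+ 1) (suc n))

  0≤rcp : ∀ n → 0ℚ ≤ rcp n
  0≤rcp zero    = ℚ.≤-reflexive (sym rcp0)
  0≤rcp (suc n) = subst (0ℚ ≤_) (sym (rcp-suc≡/ n)) (ℚ.nonNegative⁻¹ (ℤ.+ 1 / suc n) {{ℚ.normalize-nonNeg 1 (suc n)}})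

  rcp-unique : ∀ n .{{_ : ℕ.NonZero n}} {q} → ι n * q ≡ 1ℚ → q ≡ rcp n
  rcp-unique n {q} eq = begin
    q                   ≡⟨ ℚ.*-identityˡ q ⟨
    1ℚ * q              ≡⟨ cong (_* q) (ι*rcp n) ⟨
    ι n * rcp n * q     ≡⟨ solve 3 (λ a b c → a :* b :* c := b :* (a :* c)) refl (ι n) (rcp n) q ⟩
    rcp n * (ι n * q)   ≡⟨ cong (rcp n *_) eq ⟩
    rcp n * 1ℚ          ≡⟨ ℚ.*-identityʳ (rcp n) ⟩
    rcp n               ∎
    where open ≡-Reasoning

  rcp-* : ∀ m n .{{_ : ℕ.NonZero m}} .{{_ : ℕ.NonZero n}} → rcp (m ℕ.* n) ≡ rcp m * rcp n
  rcp-* m n = sym (rcp-unique (m ℕ.* n) {{ℕ.m*n≢0 m n}} (begin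
    ι (m ℕ.* n) * (rcp m * rcp n)       ≡⟨ cong (_* (rcp m * rcp n)) (ι-* m n) ⟩
    ι m * ι n * (rcp m * rcp n)
      ≡⟨ solve 4 (λ a b c d → a :* b :* (c :* d) := a :* c :* (b :* d)) refl (ι m) (ι n) (rcp m) (rcp n) ⟩
    ι m * rcp m * (ι n * rcp n)         ≡⟨ cong₂ _*_ (ι*rcp m) (ι*rcp n) ⟩
    1ℚ                                  ∎))
    where open ≡-Reasoning

  /≡*rcp : ∀ i n .{{_ : ℕ.NonZero n}} → i / n ≡ (i / 1) * rcp n
  /≡*rcp i n = begin
    i / n                         ≡⟨ ℚ.*-identityˡ (i / n) ⟨
    1ℚ * (i / n)                  ≡⟨ cong (_* (i / n)) (ι*rcp n) ⟨
    ι n * rcp n * (i / n)         ≡⟨ solve 3 (λ a b c → a :* b :* c := a :* c :* b) refl (ι n) (rcp n) (i / n) ⟩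
    ι n * (i / n) * rcp n         ≡⟨ cong (_* rcp n) (ι*/≡ i n) ⟩
    (i / 1) * rcp n               ∎
    where open ≡-Reasoning

  rcp-suc : ∀ n → rcp (suc n) - rcp (suc (suc n)) ≡ rcp (suc n) * rcp (suc (suc n))
  rcp-suc n = begin
    a - b                                   ≡⟨ cong₂ _-_ (sym (ℚ.*-identityʳ a)) (sym (ℚ.*-identityˡ b)) ⟩
    a * 1ℚ - 1ℚ * b                         ≡⟨ cong₂ (λ u v → a * u - v * b) (ι*rcp (suc (suc n))) (ι*rcp (suc n)) ⟨
    a * (ι (suc (suc n)) * b) - ι (suc n) * a * b
      ≡⟨ cong (λ t → a * (t * b) - ι (suc n) * a * b) (ι-suc (suc n)) ⟩
    a * ((1ℚ + ι (suc n)) * b) - ι (suc n) * a * b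
      ≡⟨ solve 3 (λ a b x → a :* ((con 1ℚ :+ x) :* b) :- x :* a :* b := a :* b) refl a b (ι (suc n)) ⟩
    a * b                                   ∎
    where
    open ≡-Reasoning
    a b : ℚ
    a = rcp (suc n)
    b = rcp (suc (suc n))

  rcp-suc-≤ : ∀ n → rcp (suc (suc n)) ≤ rcp (suc n)
  rcp-suc-≤ n = ≤-by _ (0≤* (0≤rcp (suc n)) (0≤rcp (suc (suc n))))
    (trans (solve 2 (λ a b → a := b :+ (a :- b)) refl (rcp (suc n)) (rcp (suc (suc n))))
           (cong (rcp (suc (suc n)) +_) (rcp-suc n)))

  -- Dominates an inverse square by a telescoping difference; the tails of Σ 1/n² and of the Euler
  -- product are both bounded through it.
  rcp²≤ : ∀ n → rcp (suc (suc n)) * rcp (suc (suc n)) ≤ rcp (suc n) - rcp (suc (suc n))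
  rcp²≤ n = subst (rcp (suc (suc n)) * rcp (suc (suc n)) ≤_) (sym (rcp-suc n))
    (*-monoʳ _ (0≤rcp (suc (suc n))) (rcp-suc-≤ n))

  rcp≤1 : ∀ n → rcp n ≤ 1ℚ
  rcp≤1 zero          = subst (_≤ 1ℚ) (sym rcp0) 0≤1
  rcp≤1 (suc zero)    = ℚ.≤-reflexive (rcp-suc≡/ 0)
  rcp≤1 (suc (suc n)) = ℚ.≤-trans (rcp-suc-≤ n) (rcp≤1 (suc n))

  -- Sums over subsets of coordinates

  Σ< : ℕ → (ℕ → ℚ) → ℚ
  Σ< zero    f = 0ℚ
  Σ< (suc n) f = f 0 + Σ< n (f ∘ suc)

  Σ<-cong : ∀ n {f g} → (∀ j → f j ≡ g j) → Σ< n f ≡ Σ< n g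
  Σ<-cong zero    f≗g = refl
  Σ<-cong (suc n) f≗g = cong₂ _+_ (f≗g 0) (Σ<-cong n (f≗g ∘ suc))

  Σ<-+ : ∀ n f g → Σ< n (λ j → f j + g j) ≡ Σ< n f + Σ< n g
  Σ<-+ zero    f g = refl
  Σ<-+ (suc n) f g = trans (cong (f 0 + g 0 +_) (Σ<-+ n (f ∘ suc) (g ∘ suc)))
    (solve 4 (λ a b c d → a :+ b :+ (c :+ d) := a :+ c :+ (b :+ d)) refl
      (f 0) (g 0) (Σ< n (f ∘ suc)) (Σ< n (g ∘ suc)))

  Σ<-neg : ∀ n f → Σ< n (-_ ∘ f) ≡ - Σ< n f
  Σ<-neg zero    f = refl
  Σ<-neg (suc n) f = trans (cong (- f 0 +_) (Σ<-neg n (f ∘ suc)))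
    (sym (ℚ.neg-distrib-+ (f 0) (Σ< n (f ∘ suc))))

  Σ<-snoc : ∀ n f → Σ< (suc n) f ≡ Σ< n f + f n
  Σ<-snoc zero    f = ℚ.+-comm (f 0) 0ℚ
  Σ<-snoc (suc n) f = trans (cong (f 0 +_) (Σ<-snoc n (f ∘ suc)))
    (sym (ℚ.+-assoc (f 0) (Σ< n (f ∘ suc)) (f (suc n))))

  Σ<-drop : ∀ k n f → (∀ j → j ℕ.< k → f j ≡ 0ℚ) → Σ< n f ≡ Σ< (n ℕ.∸ k) (λ j → f (k ℕ.+ j))
  Σ<-drop zero    n       f f≡0 = refl
  Σ<-drop (suc k) zero    f f≡0 = refl
  Σ<-drop (suc k) (suc n) f f≡0 = trans
    (cong₂ _+_ (f≡0 0 (s≤s z≤n)) (Σ<-drop k n (f ∘ suc) (λ j j<k → f≡0 (suc j) (s≤s j<k))))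
    (ℚ.+-identityˡ _)

  foldr≡Σ< : ∀ (f : ℕ → ℚ) g n →
    List.foldr _+_ 0ℚ (List.map f (List.applyUpTo g n)) ≡ Σ< n (f ∘ g)
  foldr≡Σ< f g zero    = refl
  foldr≡Σ< f g (suc n) = cong (f (g 0) +_) (foldr≡Σ< f (g ∘ suc) n)

  -- The sum of w |s| Φ(x with the entries in s replaced by their images under σ)
  -- over all sets s of positions.
  subsetSum : ∀ {X : Set} {n} → (X → X) → (ℕ → ℚ) → (Vec X n → ℚ) → Vec X n → ℚ
  subsetSum σ w Φ []       = w 0 * Φ []
  subsetSum σ w Φ (x ∷ xs) =
    subsetSum σ w (λ zs → Φ (x ∷ zs)) xs + subsetSum σ (w ∘ suc) (λ zs → Φ (σ x ∷ zs)) xs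

  module _ {X : Set} (σ : X → X) where

    subsetSum-+ : ∀ {n} w (Φ Γ : Vec X n → ℚ) xs →
      subsetSum σ w (λ zs → Φ zs + Γ zs) xs ≡ subsetSum σ w Φ xs + subsetSum σ w Γ xs
    subsetSum-+ w Φ Γ []       = ℚ.*-distribˡ-+ (w 0) (Φ []) (Γ [])
    subsetSum-+ w Φ Γ (x ∷ xs) = trans
      (cong₂ _+_ (subsetSum-+ w (λ zs → Φ (x ∷ zs)) (λ zs → Γ (x ∷ zs)) xs)
                 (subsetSum-+ (w ∘ suc) (λ zs → Φ (σ x ∷ zs)) (λ zs → Γ (σ x ∷ zs)) xs))
      (solve 4 (λ a b c d → a :+ b :+ (c :+ d) := a :+ c :+ (b :+ d)) refl
        (subsetSum σ w (λ zs → Φ (x ∷ zs)) xs) (subsetSum σ w (λ zs → Γ (x ∷ zs)) xs)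
        (subsetSum σ (w ∘ suc) (λ zs → Φ (σ x ∷ zs)) xs) (subsetSum σ (w ∘ suc) (λ zs → Γ (σ x ∷ zs)) xs))

    subsetSum-* : ∀ {n} w c (Φ : Vec X n → ℚ) xs →
      subsetSum σ w (λ zs → c * Φ zs) xs ≡ c * subsetSum σ w Φ xs
    subsetSum-* w c Φ []       =
      solve 3 (λ w c x → w :* (c :* x) := c :* (w :* x)) refl (w 0) c (Φ [])
    subsetSum-* w c Φ (x ∷ xs) = trans
      (cong₂ _+_ (subsetSum-* w c (λ zs → Φ (x ∷ zs)) xs)
                 (subsetSum-* (w ∘ suc) c (λ zs → Φ (σ x ∷ zs)) xs))
      (sym (ℚ.*-distribˡ-+ c (subsetSum σ w (λ zs → Φ (x ∷ zs)) xs)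
                             (subsetSum σ (w ∘ suc) (λ zs → Φ (σ x ∷ zs)) xs)))

    subsetSum-0 : ∀ {n} w (xs : Vec X n) → subsetSum σ w (λ _ → 0ℚ) xs ≡ 0ℚ
    subsetSum-0 w []       = ℚ.*-zeroʳ (w 0)
    subsetSum-0 w (x ∷ xs) = cong₂ _+_ (subsetSum-0 w xs) (subsetSum-0 (w ∘ suc) xs)

  -- Triangle inequality over the subsets: the count moves its arguments by `σ` and the main term by
  -- `τ`, and a relation preserved by the pair carries the error bound from one prime to the next,
  -- with |w| as weights.
  subsetSum-approx : ∀ {X Y : Set} (σ : X → X) (τ : Y → Y) (_~_ : X → Y → Set) →
    (∀ {x y} → x ~ y → σ x ~ τ y) →
    ∀ {n} w (Φ : Vec X n → ℚ) (Γ E : Vec Y n → ℚ) →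
    (∀ {xs ys} → Pointwise _~_ xs ys → ∣ Φ xs - Γ ys ∣ ≤ E ys) →
    ∀ {xs ys} → Pointwise _~_ xs ys →
    ∣ subsetSum σ w Φ xs - subsetSum τ w Γ ys ∣ ≤ subsetSum τ (∣_∣ ∘ w) E ys
  subsetSum-approx σ τ _~_ στ w Φ Γ E approx [] =
    subst (λ t → ∣ t ∣ ≤ ∣ w 0 ∣ * E [])
      (solve 3 (λ w a b → w :* (a :- b) := w :* a :- w :* b) refl (w 0) (Φ []) (Γ []))
      (∣*∣≤ {w 0} ℚ.≤-refl (approx []))
  subsetSum-approx σ τ _~_ στ w Φ Γ E approx {x ∷ xs} {y ∷ ys} (x~y ∷ xs~ys) =
    subst (λ t → ∣ t ∣ ≤ subsetSum τ (∣_∣ ∘ w) E (y ∷ ys))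
      (solve 4 (λ a b c d → (a :- b) :+ (c :- d) := a :+ c :- (b :+ d)) refl
        (subsetSum σ w (λ zs → Φ (x ∷ zs)) xs) (subsetSum τ w (λ zs → Γ (y ∷ zs)) ys)
        (subsetSum σ (w ∘ suc) (λ zs → Φ (σ x ∷ zs)) xs) (subsetSum τ (w ∘ suc) (λ zs → Γ (τ y ∷ zs)) ys))
      (∣+∣≤ (subsetSum-approx σ τ _~_ στ w _ _ (λ zs → E (y ∷ zs)) (λ p → approx (x~y ∷ p)) xs~ys)
            (subsetSum-approx σ τ _~_ στ (w ∘ suc) _ _ (λ zs → E (τ y ∷ zs)) (λ p → approx (στ x~y ∷ p)) xs~ys))

  ∏ : ∀ {n} → Vec ℚ n → ℚ
  ∏ []       = 1ℚ
  ∏ (y ∷ ys) = y * ∏ ys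

  -- The sum over j of e(y_j) ∏_{i≠j} y_i.
  leaveOneOut : ∀ {n} → (ℚ → ℚ) → Vec ℚ n → ℚ
  leaveOneOut e []       = 0ℚ
  leaveOneOut e (y ∷ ys) = e y * ∏ ys + y * leaveOneOut e ys

  -- This is Σ_j C(n, j) w_j a^j, unfolded by Pascal's rule so that it follows the recursion of
  -- `subsetSum`.
  binomial : ℚ → (ℕ → ℚ) → ℕ → ℚ
  binomial a w zero    = w 0
  binomial a w (suc n) = binomial a w n + a * binomial a (w ∘ suc) n

  subsetSum-∏ : ∀ a {n} w (ys : Vec ℚ n) → subsetSum (a *_) w ∏ ys ≡ binomial a w n * ∏ ys
  subsetSum-∏ a w []             = refl
  subsetSum-∏ a {suc n} w (y ∷ ys) = begin
    subsetSum (a *_) w (λ zs → y * ∏ zs) ys + subsetSum (a *_) (w ∘ suc) (λ zs → a * y * ∏ zs) ys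
      ≡⟨ cong₂ _+_ (subsetSum-* (a *_) w y ∏ ys) (subsetSum-* (a *_) (w ∘ suc) (a * y) ∏ ys) ⟩
    y * subsetSum (a *_) w ∏ ys + a * y * subsetSum (a *_) (w ∘ suc) ∏ ys
      ≡⟨ cong₂ (λ s t → y * s + a * y * t) (subsetSum-∏ a w ys) (subsetSum-∏ a (w ∘ suc) ys) ⟩
    y * (binomial a w n * ∏ ys) + a * y * (binomial a (w ∘ suc) n * ∏ ys)
      ≡⟨ solve 5 (λ y a s t p → y :* (s :* p) :+ a :* y :* (t :* p) := (s :+ a :* t) :* (y :* p)) refl
           y a (binomial a w n) (binomial a (w ∘ suc) n) (∏ ys) ⟩
    (binomial a w n + a * binomial a (w ∘ suc) n) * (y * ∏ ys) ∎
    where open ≡-Reasoning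

  -- The new envelope of one coordinate. Either it is not replaced, or it is, which shifts the
  -- weights by one; the other n coordinates contribute a binomial sum in both cases.
  spread : ℚ → (ℕ → ℚ) → ℕ → (ℚ → ℚ) → ℚ → ℚ
  spread a w n e y = e y * binomial a w n + e (a * y) * binomial a (w ∘ suc) n

  -- Once the distinguished coordinate is fixed, the others form a product, on which the sum over
  -- subsets acts by a scalar.
  subsetSum-leaveOneOut : ∀ a {n} w e (ys : Vec ℚ n) →
    subsetSum (a *_) w (leaveOneOut e) ys ≡ leaveOneOut (spread a w (ℕ.pred n) e) ys
  subsetSum-leaveOneOut a w e []       = ℚ.*-zeroʳ (w 0)
  subsetSum-leaveOneOut a w e (y ∷ []) =
    solve 6 (λ w v x x′ y a → w :* (x :* con 1ℚ :+ y :* con 0ℚ) :+ v :* (x′ :* con 1ℚ :+ a :* y :* con 0ℚ)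
                           := (x :* w :+ x′ :* v) :* con 1ℚ :+ y :* con 0ℚ) refl
      (w 0) (w 1) (e y) (e (a * y)) y a
  subsetSum-leaveOneOut a {suc (suc n)} w e (y ∷ ys@(_ ∷ _)) = begin
    S w (λ zs → e y * ∏ zs + y * leaveOneOut e zs) ys
      + S (w ∘ suc) (λ zs → e (a * y) * ∏ zs + a * y * leaveOneOut e zs) ys
      ≡⟨ cong₂ _+_ (split w (e y) y (subsetSum-leaveOneOut a w e ys))
                     (split (w ∘ suc) (e (a * y)) (a * y) (subsetSum-leaveOneOut a (w ∘ suc) e ys)) ⟩
    (e y * (β₀ * ∏ ys) + y * leaveOneOut (spread a w n e) ys)
      + (e (a * y) * (β₁ * ∏ ys) + a * y * leaveOneOut (spread a (w ∘ suc) n e) ys)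
      ≡⟨ solve 9 (λ x x′ b c p y a l m →
           (x :* (b :* p) :+ y :* l) :+ (x′ :* (c :* p) :+ a :* y :* m)
           := (x :* b :+ x′ :* c) :* p :+ y :* (l :+ a :* m)) refl
           (e y) (e (a * y)) β₀ β₁ (∏ ys) y a
           (leaveOneOut (spread a w n e) ys) (leaveOneOut (spread a (w ∘ suc) n e) ys) ⟩
    spread a w (suc n) e y * ∏ ys
      + y * (leaveOneOut (spread a w n e) ys + a * leaveOneOut (spread a (w ∘ suc) n e) ys)
      ≡⟨ cong (λ t → spread a w (suc n) e y * ∏ ys + y * t) (pascal ys) ⟩
    spread a w (suc n) e y * ∏ ys + y * leaveOneOut (spread a w (suc n) e) ys ∎
    where
    open ≡-Reasoning
    S : ∀ {m} → (ℕ → ℚ) → (Vec ℚ m → ℚ) → Vec ℚ m → ℚ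
    S = subsetSum (a *_)
    β₀ β₁ : ℚ
    β₀ = binomial a w (suc n)
    β₁ = binomial a (w ∘ suc) (suc n)
    split : ∀ v c d → S v (leaveOneOut e) ys ≡ leaveOneOut (spread a v n e) ys →
            S v (λ zs → c * ∏ zs + d * leaveOneOut e zs) ys
                      ≡ c * (binomial a v (suc n) * ∏ ys) + d * leaveOneOut (spread a v n e) ys
    split v c d ih = trans (subsetSum-+ (a *_) v (λ zs → c * ∏ zs) (λ zs → d * leaveOneOut e zs) ys)
      (cong₂ _+_ (trans (subsetSum-* (a *_) v c ∏ ys) (cong (c *_) (subsetSum-∏ a v ys)))
                 (trans (subsetSum-* (a *_) v d (leaveOneOut e) ys)
                        (cong (d *_) ih)))
    -- When the distinguished coordinate lies in the tail, the first coordinate is one more of the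
    -- others: its two choices combine by Pascal's rule and raise n to n + 1 in every envelope.
    pascal : ∀ {m} (zs : Vec ℚ m) →
      leaveOneOut (spread a w n e) zs + a * leaveOneOut (spread a (w ∘ suc) n e) zs
      ≡ leaveOneOut (spread a w (suc n) e) zs
    pascal []       = solve 1 (λ a → con 0ℚ :+ a :* con 0ℚ := con 0ℚ) refl a
    pascal (z ∷ zs) = trans
      (solve 10 (λ x x′ b c d p z a l m →
           ((x :* b :+ x′ :* c) :* p :+ z :* l) :+ a :* ((x :* c :+ x′ :* d) :* p :+ z :* m)
           := (x :* (b :+ a :* c) :+ x′ :* (c :+ a :* d)) :* p :+ z :* (l :+ a :* m)) refl
           (e z) (e (a * z)) (binomial a w n) (binomial a (w ∘ suc) n) (binomial a (w ∘ suc ∘ suc) n)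
           (∏ zs) z a (leaveOneOut (spread a w n e) zs) (leaveOneOut (spread a (w ∘ suc) n e) zs))
      (cong (λ t → spread a w (suc n) e z * ∏ zs + z * t) (pascal zs))

  -- χ w t = Σ_j C(t, j) w_j, which inverts w_j = (Δ^j f)(0).
  χ : (ℕ → ℚ) → ℕ → ℚ
  χ w zero    = w 0
  χ w (suc t) = χ w t + χ (w ∘ suc) t

  χ-minus : ∀ w v t → χ (λ j → w j - v j) t ≡ χ w t - χ v t
  χ-minus w v zero    = refl
  χ-minus w v (suc t) = trans (cong₂ _+_ (χ-minus w v t) (χ-minus (w ∘ suc) (v ∘ suc) t))
    (solve 4 (λ a b c d → (a :- b) :+ (c :- d) := a :+ c :- (b :+ d)) refl
      (χ w t) (χ v t) (χ (w ∘ suc) t) (χ (v ∘ suc) t))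

  below : ℕ → ℕ → ℚ
  below zero    t       = 0ℚ
  below (suc k) zero    = 1ℚ
  below (suc k) (suc t) = below k t

  -- The j-th forward difference of below k at 0.
  ψ : ℕ → ℕ → ℚ
  ψ zero    j       = 0ℚ
  ψ (suc k) zero    = 1ℚ
  ψ (suc k) (suc j) = ψ k j - ψ (suc k) j

  χ-0 : ∀ t → χ (λ _ → 0ℚ) t ≡ 0ℚ
  χ-0 zero    = refl
  χ-0 (suc t) = cong₂ _+_ (χ-0 t) (χ-0 t)

  -- Newton's forward difference formula. Shifting t by one lowers k by one in `below`, which is why
  -- `ψ` recurses on both indices.
  χ-ψ : ∀ k t → χ (ψ k) t ≡ below k t
  χ-ψ zero    t       = χ-0 t
  χ-ψ (suc k) zero    = refl
  χ-ψ (suc k) (suc t) = begin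
    χ (ψ (suc k)) t + χ (λ j → ψ k j - ψ (suc k) j) t
      ≡⟨ cong (χ (ψ (suc k)) t +_) (χ-minus (ψ k) (ψ (suc k)) t) ⟩
    χ (ψ (suc k)) t + (χ (ψ k) t - χ (ψ (suc k)) t)
      ≡⟨ solve 2 (λ a b → a :+ (b :- a) := b) refl (χ (ψ (suc k)) t) (χ (ψ k) t) ⟩
    χ (ψ k) t  ≡⟨ χ-ψ k t ⟩
    below k t  ∎
    where open ≡-Reasoning

  -- Bounds for the weights and their binomial sums

  2ℚ 3ℚ : ℚ
  2ℚ = 1ℚ + 1ℚ
  3ℚ = 1ℚ + 2ℚ

  -- Uniform in k; this is what keeps k out of the implied constant.
  ∣ψ∣≤2^ : ∀ k j → ∣ ψ k j ∣ ≤ 1ℚ * 2ℚ ^ j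
  ∣ψ∣≤2^ zero    j       = 0≤* 0≤1 (0≤^ j (ℚ.nonNegative⁻¹ 2ℚ))
  ∣ψ∣≤2^ (suc k) zero    = ℚ.≤-refl
  ∣ψ∣≤2^ (suc k) (suc j) = begin
    ∣ ψ k j - ψ (suc k) j ∣        ≤⟨ ℚ.∣p-q∣≤∣p∣+∣q∣ (ψ k j) (ψ (suc k) j) ⟩
    ∣ ψ k j ∣ + ∣ ψ (suc k) j ∣    ≤⟨ ℚ.+-mono-≤ (∣ψ∣≤2^ k j) (∣ψ∣≤2^ (suc k) j) ⟩
    1ℚ * 2ℚ ^ j + 1ℚ * 2ℚ ^ j
      ≡⟨ solve 1 (λ t → con 1ℚ :* t :+ con 1ℚ :* t := con 1ℚ :* (con 2ℚ :* t)) refl (2ℚ ^ j) ⟩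
    1ℚ * (2ℚ * 2ℚ ^ j)             ∎
    where open ℚ.≤-Reasoning

  -- The leading constant is left free because shifting the weights doubles it.
  Growth : ℚ → (ℕ → ℚ) → Set
  Growth Q w = ∀ j → ∣ w j ∣ ≤ Q * 2ℚ ^ j

  growth-suc : ∀ Q w → Growth Q w → Growth (Q * 2ℚ) (w ∘ suc)
  growth-suc Q w g j = subst (∣ w (suc j) ∣ ≤_) (sym (ℚ.*-assoc Q 2ℚ (2ℚ ^ j))) (g (suc j))

  growth-0≤ : ∀ Q w → Growth Q w → 0ℚ ≤ Q
  growth-0≤ Q w g = ℚ.≤-trans (ℚ.0≤∣p∣ (w 0)) (subst (∣ w 0 ∣ ≤_) (ℚ.*-identityʳ Q) (g 0))

  module _ {a : ℚ} (0≤a : 0ℚ ≤ a) (a≤1 : a ≤ 1ℚ) where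

    private
      ∣a∣≤ : ∣ a ∣ ≤ a
      ∣a∣≤ = ℚ.≤-reflexive (ℚ.0≤p⇒∣p∣≡p 0≤a)

    -- The source of all powers of 3: Σ_j C(n, j) 2^j = 3^n, and a ≤ 1.
    binomial-bound₀ : ∀ n Q w → Growth Q w → ∣ binomial a w n ∣ ≤ Q * 3ℚ ^ n
    binomial-bound₀ zero    Q w g = g 0
    binomial-bound₀ (suc n) Q w g = begin
      ∣ binomial a w n + a * binomial a (w ∘ suc) n ∣
        ≤⟨ ∣+∣≤ (binomial-bound₀ n Q w g)
             (∣*∣≤ {a} (ℚ.≤-trans ∣a∣≤ a≤1) (binomial-bound₀ n (Q * 2ℚ) (w ∘ suc) (growth-suc Q w g))) ⟩
      Q * 3ℚ ^ n + 1ℚ * (Q * 2ℚ * 3ℚ ^ n)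
        ≡⟨ solve 2 (λ q t → q :* t :+ con 1ℚ :* (q :* con 2ℚ :* t) := q :* (con 3ℚ :* t)) refl Q (3ℚ ^ n) ⟩
      Q * (3ℚ * 3ℚ ^ n) ∎
      where open ℚ.≤-Reasoning

    private
      diff₀ : ∀ Q w d → 0ℚ ≤ d → Growth Q w → ∀ x → x ≡ 0ℚ → ∣ x ∣ ≤ d * (Q * 3ℚ ^ 0)
      diff₀ Q w d 0≤d g .0ℚ refl = 0≤* 0≤d (0≤* (growth-0≤ Q w g) 0≤1)

    binomial-bound₁ : ∀ n Q w → Growth Q w → ∣ binomial a w n - w 0 ∣ ≤ a * (Q * 3ℚ ^ n)
    binomial-bound₁ zero    Q w g = diff₀ Q w a 0≤a g _ (ℚ.+-inverseʳ (w 0))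
    binomial-bound₁ (suc n) Q w g = begin
      ∣ β + a * β′ - w 0 ∣
        ≡⟨ cong ∣_∣ (solve 3 (λ b c w → b :+ c :- w := b :- w :+ c) refl β (a * β′) (w 0)) ⟩
      ∣ (β - w 0) + a * β′ ∣
        ≤⟨ ∣+∣≤ (binomial-bound₁ n Q w g) (∣*∣≤ {a} ∣a∣≤ (binomial-bound₀ n (Q * 2ℚ) (w ∘ suc) (growth-suc Q w g))) ⟩
      a * (Q * 3ℚ ^ n) + a * (Q * 2ℚ * 3ℚ ^ n)
        ≡⟨ solve 3 (λ a q t → a :* (q :* t) :+ a :* (q :* con 2ℚ :* t) := a :* (q :* (con 3ℚ :* t))) refl
             a Q (3ℚ ^ n) ⟩
      a * (Q * (3ℚ * 3ℚ ^ n)) ∎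
      where
      open ℚ.≤-Reasoning
      β β′ : ℚ
      β = binomial a w n
      β′ = binomial a (w ∘ suc) n

    -- Taylor expansion to first order in a. It is applied to weights starting with 1, 0, where only
    -- 1 + O(a²) survives, and to their shift, where the linear coefficient is n w_2.
    binomial-bound₂ : ∀ n Q w → Growth Q w →
      ∣ binomial a w n - (w 0 + ι n * (a * w 1)) ∣ ≤ a * a * (Q * 3ℚ ^ n)
    binomial-bound₂ zero    Q w g = diff₀ Q w (a * a) (0≤* 0≤a 0≤a) g _
      (trans (cong (λ t → w 0 - (w 0 + t * (a * w 1))) ι0)
        (solve 2 (λ w c → w :- (w :+ con 0ℚ :* c) := con 0ℚ) refl (w 0) (a * w 1)))
    binomial-bound₂ (suc n) Q w g = begin
      ∣ β + a * β′ - (w 0 + ι (suc n) * (a * w 1)) ∣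
        ≡⟨ cong (λ t → ∣ β + a * β′ - (w 0 + t * (a * w 1)) ∣) (ι-suc n) ⟩
      ∣ β + a * β′ - (w 0 + (1ℚ + ι n) * (a * w 1)) ∣
        ≡⟨ cong ∣_∣ (solve 6 (λ b a c w v n → b :+ a :* c :- (w :+ (con 1ℚ :+ n) :* (a :* v))
                            := (b :- (w :+ n :* (a :* v))) :+ a :* (c :- v)) refl β a β′ (w 0) (w 1) (ι n)) ⟩
      ∣ (β - (w 0 + ι n * (a * w 1))) + a * (β′ - w 1) ∣
        ≤⟨ ∣+∣≤ (binomial-bound₂ n Q w g) (∣*∣≤ {a} ∣a∣≤ (binomial-bound₁ n (Q * 2ℚ) (w ∘ suc) (growth-suc Q w g))) ⟩
      a * a * (Q * 3ℚ ^ n) + a * (a * (Q * 2ℚ * 3ℚ ^ n))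
        ≡⟨ solve 3 (λ a q t → a :* a :* (q :* t) :+ a :* (a :* (q :* con 2ℚ :* t)) := a :* a :* (q :* (con 3ℚ :* t))) refl
             a Q (3ℚ ^ n) ⟩
      a * a * (Q * (3ℚ * 3ℚ ^ n)) ∎
      where
      open ℚ.≤-Reasoning
      β β′ : ℚ
      β = binomial a w n
      β′ = binomial a (w ∘ suc) n

  -- The Euler factor as a weighted binomial sum

  choose : ℕ → (ℕ → ℚ) → ℕ → ℚ
  choose n f j = ι (n C j) * f j

  Σ<-choose-suc : ∀ n f → Σ< (2 ℕ.+ n) (choose (suc n) f)
                        ≡ Σ< (suc n) (choose n f) + Σ< (suc n) (choose n (f ∘ suc))
  Σ<-choose-suc n f = begin
    choose (suc n) f 0 + Σ< (suc n) (choose (suc n) f ∘ suc)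
      ≡⟨ cong (f₀ +_) (trans (Σ<-cong (suc n) pascal) (Σ<-+ (suc n) (choose n (f ∘ suc)) (choose n f ∘ suc))) ⟩
    f₀ + (Σ< (suc n) (choose n (f ∘ suc)) + Σ< (suc n) (choose n f ∘ suc))
      ≡⟨ solve 3 (λ a b c → a :+ (b :+ c) := a :+ c :+ b) refl
           f₀ (Σ< (suc n) (choose n (f ∘ suc))) (Σ< (suc n) (choose n f ∘ suc)) ⟩
    Σ< (2 ℕ.+ n) (choose n f) + Σ< (suc n) (choose n (f ∘ suc))
      ≡⟨ cong (_+ Σ< (suc n) (choose n (f ∘ suc))) (Σ<-snoc (suc n) (choose n f)) ⟩
    (Σ< (suc n) (choose n f) + choose n f (suc n)) + Σ< (suc n) (choose n (f ∘ suc))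
      ≡⟨ cong (λ t → (Σ< (suc n) (choose n f) + t) + Σ< (suc n) (choose n (f ∘ suc))) last≡0 ⟩
    (Σ< (suc n) (choose n f) + 0ℚ) + Σ< (suc n) (choose n (f ∘ suc))
      ≡⟨ cong (_+ Σ< (suc n) (choose n (f ∘ suc))) (ℚ.+-identityʳ (Σ< (suc n) (choose n f))) ⟩
    Σ< (suc n) (choose n f) + Σ< (suc n) (choose n (f ∘ suc)) ∎
    where
    open ≡-Reasoning
    f₀ : ℚ
    f₀ = choose (suc n) f 0
    pascal : ∀ j → choose (suc n) f (suc j) ≡ choose n (f ∘ suc) j + choose n f (suc j)
    pascal j = begin
      ι (suc n C suc j) * f (suc j)
        ≡⟨ cong (λ c → ι c * f (suc j)) (sym (nCk+nC[k+1]≡[n+1]C[k+1] n j)) ⟩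
      ι (n C j ℕ.+ n C suc j) * f (suc j)
        ≡⟨ cong (_* f (suc j)) (ι-+ (n C j) (n C suc j)) ⟩
      (ι (n C j) + ι (n C suc j)) * f (suc j)
        ≡⟨ ℚ.*-distribʳ-+ (f (suc j)) (ι (n C j)) (ι (n C suc j)) ⟩
      ι (n C j) * f (suc j) + ι (n C suc j) * f (suc j) ∎
    last≡0 : choose n f (suc n) ≡ 0ℚ
    last≡0 = trans (cong (λ c → ι c * f (suc n)) (k>n⇒nCk≡0 (ℕ.n<1+n n)))
      (trans (cong (_* f (suc n)) ι0) (ℚ.*-zeroˡ (f (suc n))))

  binomial≡Σ< : ∀ a w n → binomial a w n ≡ Σ< (suc n) (choose n (λ j → w j * a ^ j))
  binomial≡Σ< a w zero    =
    trans (solve 1 (λ w → w := con 1ℚ :* (w :* con 1ℚ) :+ con 0ℚ) refl (w 0))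
          (cong (λ t → t * (w 0 * 1ℚ) + 0ℚ) (sym ι1))
  binomial≡Σ< a w (suc n) = begin
    binomial a w n + a * binomial a (w ∘ suc) n
      ≡⟨ cong₂ (λ s t → s + a * t) (binomial≡Σ< a w n) (binomial≡Σ< a (w ∘ suc) n) ⟩
    Σ< (suc n) (choose n (λ j → w j * a ^ j)) + a * Σ< (suc n) (choose n (λ j → w (suc j) * a ^ j))
      ≡⟨ cong (Σ< (suc n) (choose n (λ j → w j * a ^ j)) +_) (scale (suc n) _ _ λ j →
           solve 4 (λ a c w t → a :* (c :* (w :* t)) := c :* (w :* (a :* t))) refl a (ι (n C j)) (w (suc j)) (a ^ j)) ⟩
    Σ< (suc n) (choose n (λ j → w j * a ^ j)) + Σ< (suc n) (choose n (λ j → w (suc j) * a ^ suc j))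
      ≡⟨ Σ<-choose-suc n (λ j → w j * a ^ j) ⟨
    Σ< (2 ℕ.+ n) (choose (suc n) (λ j → w j * a ^ j)) ∎
    where
    open ≡-Reasoning
    scale : ∀ m f g → (∀ j → a * f j ≡ g j) → a * Σ< m f ≡ Σ< m g
    scale zero    f g eq = ℚ.*-zeroʳ a
    scale (suc m) f g eq = trans (ℚ.*-distribˡ-+ a (f 0) (Σ< m (f ∘ suc)))
      (cong₂ _+_ (eq 0) (scale m (f ∘ suc) (g ∘ suc) (eq ∘ suc)))

  ψ-1 : ∀ j → ψ 1 j ≡ (- 1ℚ) ^ j
  ψ-1 zero    = refl
  ψ-1 (suc j) = trans (cong (λ t → 0ℚ - t) (ψ-1 j))
    (solve 1 (λ t → con 0ℚ :- t := con (- 1ℚ) :* t) refl ((- 1ℚ) ^ j))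

  -- These are, up to sign, the coefficients (-1)^(j-k) C(j - 1, k - 1) of the theorem, with k and j
  -- both shifted by one.
  ψ-closed : ∀ k j → ψ (suc k) (suc j) ≡ - ((- 1ℚ) ^ (j ℕ.∸ k) * ι (j C k))
  ψ-closed zero    j       = begin
    0ℚ - ψ 1 j                ≡⟨ cong (λ t → 0ℚ - t) (ψ-1 j) ⟩
    0ℚ - (- 1ℚ) ^ j           ≡⟨ solve 1 (λ t → con 0ℚ :- t := :- (t :* con 1ℚ)) refl ((- 1ℚ) ^ j) ⟩
    - ((- 1ℚ) ^ j * 1ℚ)       ≡⟨ cong (λ t → - ((- 1ℚ) ^ j * t)) ι1 ⟨
    - ((- 1ℚ) ^ j * ι 1)      ∎
    where open ≡-Reasoning
  ψ-closed (suc k) zero    = cong (λ t → - (1ℚ * t)) (sym ι0)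
  ψ-closed (suc k) (suc j) = begin
    ψ (suc k) (suc j) - ψ (suc (suc k)) (suc j)
      ≡⟨ cong₂ _-_ (ψ-closed k j) (ψ-closed (suc k) j) ⟩
    - (s * ι (j C k)) - - (s′ * ι (j C suc k))
      ≡⟨ solve 4 (λ s s′ x y → :- (s :* x) :- (:- (s′ :* y)) := (s′ :+ s) :* y :- (s :* (x :+ y)))
           refl s s′ (ι (j C k)) (ι (j C suc k)) ⟩
    (s′ + s) * ι (j C suc k) - (s * (ι (j C k) + ι (j C suc k)))
      ≡⟨ cong₂ (λ u v → u - s * v) (cancel (j ℕ.≤? k)) (sym (ι-+ (j C k) (j C suc k))) ⟩
    0ℚ - s * ι (j C k ℕ.+ j C suc k)
      ≡⟨ ℚ.+-identityˡ _ ⟩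
    - (s * ι (j C k ℕ.+ j C suc k))
      ≡⟨ cong (λ c → - (s * ι c)) (nCk+nC[k+1]≡[n+1]C[k+1] j k) ⟩
    - (s * ι (suc j C suc k)) ∎
    where
    open ≡-Reasoning
    s s′ : ℚ
    s = (- 1ℚ) ^ (j ℕ.∸ k)
    s′ = (- 1ℚ) ^ (j ℕ.∸ suc k)
    -- For j > k the two signs are opposite. For j ≤ k truncated subtraction makes both of them 1,
    -- but then C(j, k + 1) = 0.
    cancel : _ → (s′ + s) * ι (j C suc k) ≡ 0ℚ
    cancel (yes j≤k) = trans (cong (λ c → (s′ + s) * ι c) (k>n⇒nCk≡0 (s≤s j≤k)))
      (trans (cong ((s′ + s) *_) ι0) (ℚ.*-zeroʳ (s′ + s)))
    cancel (no j≰k) = trans (cong (λ e → (s′ + (- 1ℚ) ^ e) * ι (j C suc k)) j∸k≡)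
      (solve 2 (λ t c → (t :+ con (- 1ℚ) :* t) :* c := con 0ℚ) refl s′ (ι (j C suc k)))
      where
      j∸k≡ : j ℕ.∸ k ≡ suc (j ℕ.∸ suc k)
      j∸k≡ = ℕ.+-∸-assoc 1 (ℕ.≰⇒> j≰k)

  fromℤ : ℤ.ℤ → ℚ
  fromℤ i = i / 1

  fromℤ-* : ∀ i j → fromℤ (i ℤ.* j) ≡ fromℤ i * fromℤ j
  fromℤ-* i j = ℚ.toℚᵘ-injective (begin
    toℚᵘ (fromℤ (i ℤ.* j))                  ≈⟨ ℚ.toℚᵘ-fromℚᵘ (ℚᵘ.mkℚᵘ (i ℤ.* j) 0) ⟩
    ℚᵘ.mkℚᵘ (i ℤ.* j) 0                 ≈⟨ ℚᵘ.*-cong (ℚ.toℚᵘ-fromℚᵘ (ℚᵘ.mkℚᵘ i 0)) (ℚ.toℚᵘ-fromℚᵘ (ℚᵘ.mkℚᵘ j 0)) ⟨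
    toℚᵘ (fromℤ i) ℚᵘ.* toℚᵘ (fromℤ j)          ≈⟨ ℚ.toℚᵘ-homo-* (fromℤ i) (fromℤ j) ⟨
    toℚᵘ (fromℤ i * fromℤ j)                    ∎)
    where open ℚᵘ.≃-Reasoning

  fromℤ-sign : ∀ n → fromℤ (ℤ.-1ℤ ℤ.^ n) ≡ (- 1ℚ) ^ n
  fromℤ-sign zero    = refl
  fromℤ-sign (suc n) = trans (fromℤ-* ℤ.-1ℤ (ℤ.-1ℤ ℤ.^ n)) (cong ((- 1ℚ) *_) (fromℤ-sign n))

  rcp-^ : ∀ p .{{_ : ℕ.NonZero p}} j → rcp (p ℕ.^ j) ≡ rcp p ^ j
  rcp-^ p zero    = rcp-suc≡/ 0
  rcp-^ p (suc j) = trans (rcp-* p (p ℕ.^ j)) (cong (rcp p *_) (rcp-^ p j))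
    where instance _ = ℕ.m^n≢0 p j

  -- The weight at 0 gives the leading 1, the weights at 1, ..., k vanish because C(j, k) = 0 for j
  -- < k, and the rest are the terms of the stated sum. This ties the recursion of the sieve to the
  -- product in the theorem.
  eulerFactor≡binomial : ∀ r k p .{{_ : ℕ.NonZero p}} →
    eulerFactor r (suc k) p ≡ binomial (rcp p) (ψ (suc k)) r
  eulerFactor≡binomial r k p = sym (begin
    binomial a (ψ (suc k)) r
      ≡⟨ binomial≡Σ< a (ψ (suc k)) r ⟩
    choose r f 0 + Σ< r (choose r f ∘ suc)
      ≡⟨ cong₂ _+_ (cong (_* (1ℚ * 1ℚ)) ι1) (Σ<-drop k r (choose r f ∘ suc) vanish) ⟩
    1ℚ + Σ< (r ℕ.∸ k) (λ i → choose r f (suc (k ℕ.+ i)))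
      ≡⟨ cong (1ℚ +_) (trans (Σ<-cong (r ℕ.∸ k) closed) (Σ<-neg (r ℕ.∸ k) g)) ⟩
    1ℚ - Σ< (r ℕ.∸ k) g
      ≡⟨ cong (λ t → 1ℚ - t) (trans (foldr≡Σ< _ (suc k ℕ.+_) (r ℕ.∸ k)) (Σ<-cong (r ℕ.∸ k) (λ i → term (k ℕ.+ i)))) ⟨
    eulerFactor r (suc k) p ∎)
    where
    open ≡-Reasoning
    a : ℚ
    a = rcp p
    f g : ℕ → ℚ
    f j = ψ (suc k) j * a ^ j
    g i = (- 1ℚ) ^ (k ℕ.+ i ℕ.∸ k) * (ι (r C suc (k ℕ.+ i)) * ι ((k ℕ.+ i) C k)) * a ^ suc (k ℕ.+ i)
    closed : ∀ i → choose r f (suc (k ℕ.+ i)) ≡ - g i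
    closed i = trans (cong (λ t → ι (r C suc (k ℕ.+ i)) * (t * a ^ suc (k ℕ.+ i))) (ψ-closed k (k ℕ.+ i)))
      (solve 4 (λ s x y t → x :* (:- (s :* y) :* t) := :- (s :* (x :* y) :* t)) refl
        ((- 1ℚ) ^ (k ℕ.+ i ℕ.∸ k)) (ι (r C suc (k ℕ.+ i))) (ι ((k ℕ.+ i) C k)) (a ^ suc (k ℕ.+ i)))
    vanish : ∀ j → j ℕ.< k → choose r f (suc j) ≡ 0ℚ
    vanish j j<k = begin
      ι (r C suc j) * (ψ (suc k) (suc j) * a ^ suc j)
        ≡⟨ cong (λ t → ι (r C suc j) * (t * a ^ suc j)) (ψ-closed k j) ⟩
      ι (r C suc j) * (- ((- 1ℚ) ^ (j ℕ.∸ k) * ι (j C k)) * a ^ suc j)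
        ≡⟨ cong (λ c → ι (r C suc j) * (- ((- 1ℚ) ^ (j ℕ.∸ k) * c) * a ^ suc j))
             (trans (cong ι (k>n⇒nCk≡0 j<k)) ι0) ⟩
      ι (r C suc j) * (- ((- 1ℚ) ^ (j ℕ.∸ k) * 0ℚ) * a ^ suc j)
        ≡⟨ solve 3 (λ x s t → x :* (:- (s :* con 0ℚ) :* t) := con 0ℚ) refl
             (ι (r C suc j)) ((- 1ℚ) ^ (j ℕ.∸ k)) (a ^ suc j) ⟩
      0ℚ ∎
    term : ∀ j → (((ℤ.-1ℤ ℤ.^ (j ℕ.∸ k)) ℤ.* ℤ.+ ((r C suc j) ℕ.* (j C k))) / (p ℕ.^ suc j)) {{ℕ.m^n≢0 p (suc j)}}
               ≡ (- 1ℚ) ^ (j ℕ.∸ k) * (ι (r C suc j) * ι (j C k)) * a ^ suc j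
    term j = begin
      ((i ℤ.* ℤ.+ m) / (p ℕ.^ suc j)) {{ℕ.m^n≢0 p (suc j)}}
        ≡⟨ /≡*rcp (i ℤ.* ℤ.+ m) (p ℕ.^ suc j) {{ℕ.m^n≢0 p (suc j)}} ⟩
      fromℤ (i ℤ.* ℤ.+ m) * rcp (p ℕ.^ suc j)
        ≡⟨ cong₂ _*_ (trans (fromℤ-* i (ℤ.+ m)) (cong₂ _*_ (fromℤ-sign (j ℕ.∸ k))
             (trans (sym (ι≡/1 m)) (ι-* (r C suc j) (j C k))))) (rcp-^ p (suc j)) ⟩
      (- 1ℚ) ^ (j ℕ.∸ k) * (ι (r C suc j) * ι (j C k)) * a ^ suc j ∎
      where
      i : ℤ.ℤ
      i = ℤ.-1ℤ ℤ.^ (j ℕ.∸ k)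
      m : ℕ
      m = (r C suc j) ℕ.* (j C k)

  -- Sieving one prime at a time

  Σ<-const : ∀ n c → Σ< n (λ _ → c) ≡ ι n * c
  Σ<-const zero    c = sym (trans (cong (_* c) ι0) (ℚ.*-zeroˡ c))
  Σ<-const (suc n) c = trans (cong (c +_) (Σ<-const n c))
    (trans (solve 2 (λ c n → c :+ n :* c := (con 1ℚ :+ n) :* c) refl c (ι n))
           (cong (_* c) (sym (ι-suc n))))

  Σ<-multiples : ∀ p .{{_ : ℕ.NonZero p}} m (h : ℕ → ℚ) →
    Σ< m (λ i → if does (p ∣? suc i) then h (suc i) else 0ℚ) ≡ Σ< (m ℕ./ p) (λ i → h (p ℕ.* suc i))
  Σ<-multiples p@(suc p-1) m h =
    trans (cong (λ t → Σ< t f) (ℕ.m≡m%n+[m/n]*n m p)) (upTo (m ℕ./ p) (m ℕ.% p) (ℕ.m%n<n m p))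
    where
    f : ℕ → ℚ
    f i = if does (p ∣? suc i) then h (suc i) else 0ℚ
    -- Here s counts the terms after the last multiple of p. Terms are removed from the top, and a
    -- multiple of p is met exactly when s = 0.
    upTo : ∀ q s → s ℕ.< p → Σ< (s ℕ.+ q ℕ.* p) f ≡ Σ< q (λ i → h (p ℕ.* suc i))
    upTo zero    zero    s<p = refl
    upTo (suc q) zero    s<p = begin
      Σ< (suc (p-1 ℕ.+ q ℕ.* p)) f
        ≡⟨ Σ<-snoc (p-1 ℕ.+ q ℕ.* p) f ⟩
      Σ< (p-1 ℕ.+ q ℕ.* p) f + f (p-1 ℕ.+ q ℕ.* p)
        ≡⟨ cong₂ _+_ (upTo q p-1 ℕ.≤-refl) (cong (λ b → if b then h (suc q ℕ.* p) else 0ℚ)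
             (dec-true (p ∣? (suc q ℕ.* p)) (divides (suc q) refl))) ⟩
      Σ< q (λ i → h (p ℕ.* suc i)) + h (suc q ℕ.* p)
        ≡⟨ cong (λ t → Σ< q (λ i → h (p ℕ.* suc i)) + h t) (ℕ.*-comm (suc q) p) ⟩
      Σ< q (λ i → h (p ℕ.* suc i)) + h (p ℕ.* suc q)
        ≡⟨ Σ<-snoc q (λ i → h (p ℕ.* suc i)) ⟨
      Σ< (suc q) (λ i → h (p ℕ.* suc i)) ∎
      where open ≡-Reasoning
    upTo q       (suc s) s<p = begin
      Σ< (suc (s ℕ.+ q ℕ.* p)) f
        ≡⟨ Σ<-snoc (s ℕ.+ q ℕ.* p) f ⟩
      Σ< (s ℕ.+ q ℕ.* p) f + f (s ℕ.+ q ℕ.* p)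
        ≡⟨ cong₂ _+_ (upTo q s (ℕ.<-trans (ℕ.n<1+n s) s<p)) (cong (λ b → if b then h (suc (s ℕ.+ q ℕ.* p)) else 0ℚ)
             (dec-false (p ∣? suc (s ℕ.+ q ℕ.* p)) p∤)) ⟩
      Σ< q (λ i → h (p ℕ.* suc i)) + 0ℚ
        ≡⟨ ℚ.+-identityʳ _ ⟩
      Σ< q (λ i → h (p ℕ.* suc i)) ∎
      where
      open ≡-Reasoning
      p∤ : ¬ p ∣ suc s ℕ.+ q ℕ.* p
      p∤ p∣ = >⇒∤ s<p (∣m+n∣m⇒∣n (subst (p ∣_) (ℕ.+-comm (suc s) (q ℕ.* p)) p∣) (n∣m*n q))

  boxSum : ∀ {r} → Vec ℕ r → (Vec ℕ r → ℚ) → ℚ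
  boxSum []       g = g []
  boxSum (m ∷ ms) g = Σ< m (λ i → boxSum ms (λ ns → g (suc i ∷ ns)))

  boxSum-cong : ∀ {r} (ms : Vec ℕ r) {f g} → (∀ ns → f ns ≡ g ns) → boxSum ms f ≡ boxSum ms g
  boxSum-cong []       eq = eq []
  boxSum-cong (m ∷ ms) eq = Σ<-cong m (λ i → boxSum-cong ms (λ ns → eq (suc i ∷ ns)))

  boxSum-+ : ∀ {r} (ms : Vec ℕ r) f g → boxSum ms (λ ns → f ns + g ns) ≡ boxSum ms f + boxSum ms g
  boxSum-+ []       f g = refl
  boxSum-+ (m ∷ ms) f g = trans
    (Σ<-cong m (λ i → boxSum-+ ms (λ ns → f (suc i ∷ ns)) (λ ns → g (suc i ∷ ns))))
    (Σ<-+ m (λ i → boxSum ms (λ ns → f (suc i ∷ ns))) (λ i → boxSum ms (λ ns → g (suc i ∷ ns))))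

  Σ<-subsetSum : ∀ {X : Set} (σ : X → X) {n} w m (Φ : ℕ → Vec X n → ℚ) xs →
    Σ< m (λ i → subsetSum σ w (Φ i) xs) ≡ subsetSum σ w (λ zs → Σ< m (λ i → Φ i zs)) xs
  Σ<-subsetSum σ w zero    Φ xs = sym (subsetSum-0 σ w xs)
  Σ<-subsetSum σ w (suc m) Φ xs = trans
    (cong (subsetSum σ w (Φ 0) xs +_) (Σ<-subsetSum σ w m (Φ ∘ suc) xs))
    (sym (subsetSum-+ σ w (Φ 0) (λ zs → Σ< m (λ i → Φ (suc i) zs)) xs))

  -- Counts the entries divisible by p, not the exponent of p in them.
  multiplicity : ∀ {r} → ℕ → Vec ℕ r → ℕ
  multiplicity p []       = 0
  multiplicity p (n ∷ ns) = if does (p ∣? n) then suc (multiplicity p ns) else multiplicity p ns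

  -- Permits replacing entries divisible by p by their quotients: the conditions at primes below p
  -- do not see a factor p.
  ScaleInvariant : ℕ → ∀ {r} → (Vec ℕ r → ℚ) → Set
  ScaleInvariant p g = ∀ {ns ms} → Pointwise (λ n m → n ≡ m ⊎ n ≡ p ℕ.* m) ns ms → g ns ≡ g ms

  -- C(t, j) counts the sets of j positions among the t positions divisible by p, so `χ w t` is the
  -- sum of w |s| over such sets s. After exchanging the sums, the entries in s run over the
  -- multiples of p, and dividing them by p leaves the range up to m / p.
  boxSum-sieve : ∀ p .{{_ : ℕ.NonZero p}} {r} w (g : Vec ℕ r → ℚ) → ScaleInvariant p g → ∀ ms →
    boxSum ms (λ ns → g ns * χ w (multiplicity p ns)) ≡ subsetSum (ℕ._/ p) w (λ zs → boxSum zs g) ms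
  boxSum-sieve p w g inv []       = ℚ.*-comm (g []) (w 0)
  boxSum-sieve p w g inv (m ∷ ms) = begin
    Σ< m (λ i → boxSum ms (λ ns → g (suc i ∷ ns) * χ w (multiplicity p (suc i ∷ ns))))
      ≡⟨ Σ<-cong m split ⟩
    Σ< m (λ i → B w (suc i) + (if does (p ∣? suc i) then B (w ∘ suc) (suc i) else 0ℚ))
      ≡⟨ Σ<-+ m (B w ∘ suc) (λ i → if does (p ∣? suc i) then B (w ∘ suc) (suc i) else 0ℚ) ⟩
    Σ< m (B w ∘ suc) + Σ< m (λ i → if does (p ∣? suc i) then B (w ∘ suc) (suc i) else 0ℚ)
      ≡⟨ cong (Σ< m (B w ∘ suc) +_) (trans (Σ<-multiples p m (B (w ∘ suc))) (Σ<-cong (m ℕ./ p) unscale)) ⟩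
    Σ< m (B w ∘ suc) + Σ< (m ℕ./ p) (B (w ∘ suc) ∘ suc)
      ≡⟨ cong₂ _+_ (collect w m) (collect (w ∘ suc) (m ℕ./ p)) ⟩
    subsetSum (ℕ._/ p) w (λ zs → boxSum (m ∷ zs) g) ms
      + subsetSum (ℕ._/ p) (w ∘ suc) (λ zs → boxSum (m ℕ./ p ∷ zs) g) ms ∎
    where
    open ≡-Reasoning
    B : (ℕ → ℚ) → ℕ → ℚ
    B v n = boxSum ms (λ ns → g (n ∷ ns) * χ v (multiplicity p ns))
    split : ∀ i → boxSum ms (λ ns → g (suc i ∷ ns) * χ w (multiplicity p (suc i ∷ ns)))
                ≡ B w (suc i) + (if does (p ∣? suc i) then B (w ∘ suc) (suc i) else 0ℚ)
    split i with does (p ∣? suc i)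
    ... | false = sym (ℚ.+-identityʳ (B w (suc i)))
    ... | true  = trans (boxSum-cong ms (λ ns → ℚ.*-distribˡ-+ (g (suc i ∷ ns))
                           (χ w (multiplicity p ns)) (χ (w ∘ suc) (multiplicity p ns))))
                        (boxSum-+ ms (λ ns → g (suc i ∷ ns) * χ w (multiplicity p ns))
                                     (λ ns → g (suc i ∷ ns) * χ (w ∘ suc) (multiplicity p ns)))
    unscale : ∀ i → B (w ∘ suc) (p ℕ.* suc i) ≡ B (w ∘ suc) (suc i)
    unscale i = boxSum-cong ms λ ns → cong (_* χ (w ∘ suc) (multiplicity p ns))
      (inv (inj₂ refl ∷ Pointwise.refl (inj₁ refl)))
    collect : ∀ v n → Σ< n (B v ∘ suc) ≡ subsetSum (ℕ._/ p) v (λ zs → boxSum (n ∷ zs) g) ms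
    collect v n = trans
      (Σ<-cong n λ i → boxSum-sieve p v (λ ns → g (suc i ∷ ns)) (λ q → inv (inj₁ refl ∷ q)) ms)
      (Σ<-subsetSum (ℕ._/ p) v n (λ i zs → boxSum zs (λ ns → g (suc i ∷ ns))) ms)

  if-prime : ∀ {A : Set} {x y : A} m → Prime m → (if does (prime? m) then x else y) ≡ x
  if-prime {x = x} {y} m p = cong (λ b → if b then x else y) (dec-true (prime? m) p)

  if-nonPrime : ∀ {A : Set} {x y : A} m → ¬ Prime m → (if does (prime? m) then x else y) ≡ y
  if-nonPrime {x = x} {y} m ¬p = cong (λ b → if b then x else y) (dec-false (prime? m) ¬p)

  sieved : ∀ {r} → ℕ → ℕ → Vec ℕ r → ℚ
  sieved k zero    ns = 1ℚ
  sieved k (suc m) ns =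
    if does (prime? (suc m))
    then sieved k m ns * below k (multiplicity (suc m) ns)
    else sieved k m ns

  multiplicity-invariant : ∀ {p q} → Prime p → Prime q → q ≢ p → ∀ {r} {ns ms : Vec ℕ r} →
    Pointwise (λ n m → n ≡ m ⊎ n ≡ p ℕ.* m) ns ms → multiplicity q ns ≡ multiplicity q ms
  multiplicity-invariant pp pq q≢p [] = refl
  multiplicity-invariant {q = q} pp pq q≢p {ns = n ∷ _} (inj₁ refl ∷ rs) =
    cong (λ t → if does (q ∣? n) then suc t else t) (multiplicity-invariant pp pq q≢p rs)
  multiplicity-invariant {p} {q} pp pq q≢p {ms = m ∷ _} (inj₂ refl ∷ rs) =
    cong₂ (λ b t → if b then suc t else t) same (multiplicity-invariant pp pq q≢p rs)
    where
    q∣m : q ∣ p ℕ.* m → q ∣ m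
    q∣m q∣pm with euclidsLemma p m pq q∣pm
    ... | inj₂ q∣m = q∣m
    ... | inj₁ q∣p with prime⇒irreducible pp q∣p
    ...   | inj₁ q≡1 = contradiction q≡1 (ℕ.nonTrivial⇒≢1 {{prime⇒nonTrivial pq}})
    ...   | inj₂ q≡p = contradiction q≡p q≢p
    same : does (q ∣? (p ℕ.* m)) ≡ does (q ∣? m)
    same = does-⇔ (mk⇔ q∣m (∣n⇒∣m*n p)) (q ∣? (p ℕ.* m)) (q ∣? m)

  sieved-invariant : ∀ {p} → Prime p → ∀ {r} k m → m ℕ.< p → ScaleInvariant p (sieved {r} k m)
  sieved-invariant pp k zero    m<p rs = refl
  sieved-invariant pp k (suc m) m<p rs with prime? (suc m)
  ... | no _   = sieved-invariant pp k m (ℕ.<-trans (ℕ.n<1+n m) m<p) rs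
  ... | yes pq = cong₂ (λ s t → s * below k t) (sieved-invariant pp k m (ℕ.<-trans (ℕ.n<1+n m) m<p) rs)
                   (multiplicity-invariant pp pq (ℕ.<⇒≢ m<p) rs)

  sievedCount : ∀ {r} → ℕ → ℕ → Vec ℕ r → ℚ
  sievedCount k m ms = boxSum ms (sieved k m)

  sievedCount-prime : ∀ {r} k m → Prime (suc m) → (ms : Vec ℕ r) →
    sievedCount k (suc m) ms ≡ subsetSum (ℕ._/ suc m) (ψ k) (sievedCount k m) ms
  sievedCount-prime k m pp ms = trans
    (boxSum-cong ms (λ ns → trans (if-prime (suc m) pp)
      (cong (sieved k m ns *_) (sym (χ-ψ k (multiplicity (suc m) ns))))))
    (boxSum-sieve (suc m) (ψ k) (sieved k m) (sieved-invariant pp k m ℕ.≤-refl) ms)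

  sievedCount-nonPrime : ∀ {r} k m → ¬ Prime (suc m) → (ms : Vec ℕ r) →
    sievedCount k (suc m) ms ≡ sievedCount k m ms
  sievedCount-nonPrime k m ¬pp ms = boxSum-cong ms (λ ns → if-nonPrime (suc m) ¬pp)

  sievedCount-0 : ∀ {r} k (ms : Vec ℕ r) → sievedCount k 0 ms ≡ ∏ (Vec.map ι ms)
  sievedCount-0 k []       = refl
  sievedCount-0 k (m ∷ ms) = trans (Σ<-cong m (λ _ → sievedCount-0 k ms)) (Σ<-const m (∏ (Vec.map ι ms)))

  ι-sum : ∀ (f : ℕ → ℕ) g n → ι (sum (List.map f (List.applyUpTo g n))) ≡ Σ< n (ι ∘ f ∘ g)
  ι-sum f g zero    = ι0
  ι-sum f g (suc n) = trans (ι-+ (f (g 0)) (sum (List.map f (List.applyUpTo (g ∘ suc) n))))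
    (cong (ι (f (g 0)) +_) (ι-sum f (g ∘ suc) n))

  -- Comparing the sieve with the Euler product

  -- Weak on both sides, so that N and N + 1 both approximate N + 1.
  Floor : ℕ → ℚ → Set
  Floor m y = ι m ≤ y × y ≤ ι (suc m)

  floor-0≤ : ∀ {m y} → Floor m y → 0ℚ ≤ y
  floor-0≤ {m} (m≤y , _) = ℚ.≤-trans (0≤ι m) m≤y

  -- Nested floors: the integer bound is divided with truncation and the rational bound exactly, and
  -- the relation survives because m < (m / p + 1) p.
  floor-/ : ∀ p .{{_ : ℕ.NonZero p}} {m y} → Floor m y → Floor (m ℕ./ p) (rcp p * y)
  floor-/ p {m} {y} (m≤y , y≤1+m) = lower , upper
    where
    open ℚ.≤-Reasoning
    unscale : ∀ n → ι n ≡ rcp p * ι (n ℕ.* p)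
    unscale n = sym (trans (cong (rcp p *_) (ι-* n p))
      (trans (solve 3 (λ a n p → a :* (n :* p) := p :* a :* n) refl (rcp p) (ι n) (ι p))
        (trans (cong (_* ι n) (ι*rcp p)) (ℚ.*-identityˡ (ι n)))))
    lower : ι (m ℕ./ p) ≤ rcp p * y
    lower = begin
      ι (m ℕ./ p)                     ≡⟨ unscale (m ℕ./ p) ⟩
      rcp p * ι ((m ℕ./ p) ℕ.* p)     ≤⟨ *-monoˡ (rcp p) (0≤rcp p) (ι-mono (ℕ.m/n*n≤m m p)) ⟩
      rcp p * ι m                     ≤⟨ *-monoˡ (rcp p) (0≤rcp p) m≤y ⟩
      rcp p * y                       ∎
    upper : rcp p * y ≤ ι (suc (m ℕ./ p))
    upper = begin
      rcp p * y                       ≤⟨ *-monoˡ (rcp p) (0≤rcp p) y≤1+m ⟩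
      rcp p * ι (suc m)               ≤⟨ *-monoˡ (rcp p) (0≤rcp p) (ι-mono 1+m≤) ⟩
      rcp p * ι (suc (m ℕ./ p) ℕ.* p) ≡⟨ unscale (suc (m ℕ./ p)) ⟨
      ι (suc (m ℕ./ p))               ∎
      where
      1+m≤ : m ℕ.< suc (m ℕ./ p) ℕ.* p
      1+m≤ = subst (ℕ._< suc (m ℕ./ p) ℕ.* p) (sym (ℕ.m≡m%n+[m/n]*n m p))
               (ℕ.+-monoˡ-< ((m ℕ./ p) ℕ.* p) (ℕ.m%n<n m p))

  floors-0≤ : ∀ {n} {ms : Vec ℕ n} {ys : Vec ℚ n} → Pointwise Floor ms ys → All (0ℚ ≤_) ys
  floors-0≤ []       = []
  floors-0≤ (f ∷ fs) = floor-0≤ f ∷ floors-0≤ fs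

  0≤∏ : ∀ {n} {ys : Vec ℚ n} → All (0ℚ ≤_) ys → 0ℚ ≤ ∏ ys
  0≤∏ []       = 0≤1
  0≤∏ (p ∷ ps) = 0≤* p (0≤∏ ps)

  leaveOneOut-mono : ∀ {n e e′} {ys : Vec ℚ n} → All (0ℚ ≤_) ys →
    (∀ {y} → 0ℚ ≤ y → e y ≤ e′ y) → leaveOneOut e ys ≤ leaveOneOut e′ ys
  leaveOneOut-mono []       e≤e′ = ℚ.≤-refl
  leaveOneOut-mono {ys = y ∷ ys} (p ∷ ps) e≤e′ = ℚ.+-mono-≤
    (*-monoʳ (∏ ys) (0≤∏ ps) (e≤e′ p)) (*-monoˡ y p (leaveOneOut-mono ps e≤e′))

  ∏-replicate : ∀ y n → ∏ (Vec.replicate n y) ≡ y ^ n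
  ∏-replicate y zero    = refl
  ∏-replicate y (suc n) = cong (y *_) (∏-replicate y n)

  leaveOneOut-replicate : ∀ e y n →
    leaveOneOut e (Vec.replicate (suc n) y) ≡ ι (suc n) * (y ^ n * e y)
  leaveOneOut-replicate e y zero    = trans
    (solve 2 (λ e y → e :* con 1ℚ :+ y :* con 0ℚ := con 1ℚ :* (con 1ℚ :* e)) refl (e y) y)
    (cong (_* (1ℚ * e y)) (sym ι1))
  leaveOneOut-replicate e y (suc n) = begin
    e y * ∏ (Vec.replicate (suc n) y) + y * leaveOneOut e (Vec.replicate (suc n) y)
      ≡⟨ cong₂ (λ s t → e y * s + y * t) (∏-replicate y (suc n)) (leaveOneOut-replicate e y n) ⟩
    e y * (y * y ^ n) + y * (ι (suc n) * (y ^ n * e y))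
      ≡⟨ solve 4 (λ e y t n → e :* (y :* t) :+ y :* (n :* (t :* e)) := (con 1ℚ :+ n) :* ((y :* t) :* e)) refl
           (e y) y (y ^ n) (ι (suc n)) ⟩
    (1ℚ + ι (suc n)) * (y ^ suc n * e y)
      ≡⟨ cong (_* (y ^ suc n * e y)) (ι-suc (suc n)) ⟨
    ι (suc (suc n)) * (y ^ suc n * e y) ∎
    where open ≡-Reasoning

  -- The rounding error of an entry is at most 1 by the floor bounds, and at most y because 0 ≤ m ≤
  -- y. The second bound is what later makes the sums over d converge.
  ∏-floor : ∀ {n} {ms : Vec ℕ n} {ys : Vec ℚ n} → Pointwise Floor ms ys →
    ∣ ∏ (Vec.map ι ms) - ∏ ys ∣ ≤ leaveOneOut (1ℚ ⊓_) ys
  ∏-floor []       = ℚ.≤-refl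
  ∏-floor {ms = m ∷ ms} {y ∷ ys} (f@(m≤y , y≤1+m) ∷ fs) = begin
    ∣ ι m * P - y * Q ∣
      ≡⟨ cong ∣_∣ (solve 4 (λ m y p q → m :* p :- y :* q := (m :- y) :* q :+ m :* (p :- q)) refl (ι m) y P Q) ⟩
    ∣ (ι m - y) * Q + ι m * (P - Q) ∣
      ≤⟨ ∣+∣≤ (∣*∣≤ {ι m - y} ∣m-y∣≤ (ℚ.≤-reflexive (ℚ.0≤p⇒∣p∣≡p (0≤∏ (floors-0≤ fs)))))
              (∣*∣≤ {ι m} (subst (_≤ y) (sym (ℚ.0≤p⇒∣p∣≡p (0≤ι m))) m≤y) (∏-floor fs)) ⟩
    (1ℚ ⊓ y) * Q + y * leaveOneOut (1ℚ ⊓_) ys ∎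
    where
    open ℚ.≤-Reasoning
    P Q : ℚ
    P = ∏ (Vec.map ι ms)
    Q = ∏ ys
    ∣m-y∣≤ : ∣ ι m - y ∣ ≤ 1ℚ ⊓ y
    ∣m-y∣≤ = subst (_≤ 1ℚ ⊓ y) (trans (sym (ℚ.0≤p⇒∣p∣≡p (0≤b-a m≤y))) (∣-∣-comm y (ι m)))
      (ℚ.⊓-glb
        (≤-by (ι (suc m) - y) (0≤b-a y≤1+m)
          (trans (solve 2 (λ m y → con 1ℚ := y :- m :+ ((con 1ℚ :+ m) :- y)) refl (ι m) y)
                 (cong (λ t → y - ι m + (t - y)) (sym (ι-suc m)))))
        (≤-by (ι m) (0≤ι m) (solve 2 (λ m y → y := y :- m :+ m) refl (ι m) y)))

  envelopeStep : ℚ → ℚ → ℚ → (ℚ → ℚ) → ℚ → ℚ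
  envelopeStep K c a e y = (1ℚ + K * (a * a)) * e y + c * a * e (a * y)

  envelope : ℚ → ℚ → ℕ → ℚ → ℚ
  envelope K c zero    = 1ℚ ⊓_
  envelope K c (suc m) =
    if does (prime? (suc m)) then envelopeStep K c (rcp (suc m)) (envelope K c m) else envelope K c m

  envelope-prime : ∀ K c m y → Prime (suc m) →
    envelope K c (suc m) y ≡ envelopeStep K c (rcp (suc m)) (envelope K c m) y
  envelope-prime K c m y p = cong (λ (e : ℚ → ℚ) → e y) (if-prime (suc m) p)

  envelope-nonPrime : ∀ K c m y → ¬ Prime (suc m) → envelope K c (suc m) y ≡ envelope K c m y
  envelope-nonPrime K c m y ¬p = cong (λ (e : ℚ → ℚ) → e y) (if-nonPrime (suc m) ¬p)

  module _ {K c : ℚ} (0≤K : 0ℚ ≤ K) (0≤c : 0ℚ ≤ c) where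

    0≤1+Ka² : ∀ a → 0ℚ ≤ a → 0ℚ ≤ 1ℚ + K * (a * a)
    0≤1+Ka² a 0≤a = 0≤+ 0≤1 (0≤* 0≤K (0≤* 0≤a 0≤a))

    envelope-0≤ : ∀ m {y} → 0ℚ ≤ y → 0ℚ ≤ envelope K c m y
    envelope-0≤ zero    0≤y = ℚ.⊓-glb 0≤1 0≤y
    envelope-0≤ (suc m) 0≤y with does (prime? (suc m))
    ... | true  = 0≤+ (0≤* (0≤1+Ka² a (0≤rcp (suc m))) (envelope-0≤ m 0≤y))
                      (0≤* (0≤* 0≤c (0≤rcp (suc m))) (envelope-0≤ m (0≤* (0≤rcp (suc m)) 0≤y)))
      where
      a : ℚ
      a = rcp (suc m)
    ... | false = envelope-0≤ m 0≤y

    envelope-mono : ∀ m {y z} → y ≤ z → envelope K c m y ≤ envelope K c m z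
    envelope-mono zero    y≤z = ℚ.⊓-monoʳ-≤ 1ℚ y≤z
    envelope-mono (suc m) y≤z with does (prime? (suc m))
    ... | true  = ℚ.+-mono-≤
      (*-monoˡ _ (0≤1+Ka² (rcp (suc m)) (0≤rcp (suc m))) (envelope-mono m y≤z))
      (*-monoˡ _ (0≤* 0≤c (0≤rcp (suc m))) (envelope-mono m (*-monoˡ _ (0≤rcp (suc m)) y≤z)))
    ... | false = envelope-mono m y≤z

  module _ (n k : ℕ) {c : ℚ} (0≤c : 0ℚ ≤ c) (∣ψ₂∣≤ : ι n * ∣ ψ (2 ℕ.+ k) 2 ∣ ≤ c) where

    private
      r : ℕ
      r = suc n
      w : ℕ → ℚ
      w = ∣_∣ ∘ ψ (2 ℕ.+ k)
      T K : ℚ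
      T = 3ℚ ^ n
      K = 3ℚ ^ r
      0≤T : 0ℚ ≤ T
      0≤T = 0≤^ n (ℚ.nonNegative⁻¹ 3ℚ)
      0≤K : 0ℚ ≤ K
      0≤K = 0≤^ r (ℚ.nonNegative⁻¹ 3ℚ)
      growth : Growth 1ℚ w
      growth j = subst (_≤ 1ℚ * 2ℚ ^ j) (sym (ℚ.∣∣p∣∣≡∣p∣ (ψ (2 ℕ.+ k) j))) (∣ψ∣≤2^ (2 ℕ.+ k) j)

    -- If the coordinate is not replaced, the weights start with 1, 0 and give 1 + O(a²). If it is,
    -- one of the n others must be replaced too, which gives a n |ψ(2)| + O(a²). The errors a² T and
    -- 2 a² T add up to 3 T a² after e(a y) ≤ e(y), and 3 T is `K`.
    spread≤envelopeStep : ∀ {a} → 0ℚ ≤ a → a ≤ 1ℚ → ∀ {e} →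
      (∀ {y} → 0ℚ ≤ y → 0ℚ ≤ e y) → (∀ {y z} → y ≤ z → e y ≤ e z) →
      ∀ {y} → 0ℚ ≤ y → spread a w n e y ≤ envelopeStep K c a e y
    spread≤envelopeStep {a} 0≤a a≤1 {e} 0≤e e-mono {y} 0≤y = begin
      e y * binomial a w n + e (a * y) * binomial a (w ∘ suc) n
        ≤⟨ ℚ.+-mono-≤ (*-monoˡ (e y) (0≤e 0≤y) β≤) (*-monoˡ (e (a * y)) (0≤e (0≤* 0≤a 0≤y)) β′≤) ⟩
      e y * (1ℚ + a * a * T) + e (a * y) * (a * c + a * a * (2ℚ * T))
        ≡⟨ solve 5 (λ x x′ a c t → x :* (con 1ℚ :+ a :* a :* t) :+ x′ :* (a :* c :+ a :* a :* (con 2ℚ :* t))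
             := x :* (con 1ℚ :+ a :* a :* t) :+ c :* a :* x′ :+ a :* a :* (con 2ℚ :* t) :* x′) refl
             (e y) (e (a * y)) a c T ⟩
      e y * (1ℚ + a * a * T) + c * a * e (a * y) + a * a * (2ℚ * T) * e (a * y)
        ≤⟨ ℚ.+-monoʳ-≤ (e y * (1ℚ + a * a * T) + c * a * e (a * y))
             (*-monoˡ _ (0≤* (0≤* 0≤a 0≤a) (0≤* (ℚ.nonNegative⁻¹ 2ℚ) 0≤T)) (e-mono ay≤y)) ⟩
      e y * (1ℚ + a * a * T) + c * a * e (a * y) + a * a * (2ℚ * T) * e y
        ≡⟨ solve 5 (λ x x′ a c t → x :* (con 1ℚ :+ a :* a :* t) :+ c :* a :* x′ :+ a :* a :* (con 2ℚ :* t) :* x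
             := (con 1ℚ :+ con 3ℚ :* t :* (a :* a)) :* x :+ c :* a :* x′) refl
             (e y) (e (a * y)) a c T ⟩
      (1ℚ + K * (a * a)) * e y + c * a * e (a * y) ∎
      where
      open ℚ.≤-Reasoning
      ay≤y : a * y ≤ y
      ay≤y = subst (a * y ≤_) (ℚ.*-identityˡ y) (*-monoʳ y 0≤y a≤1)
      β≤ : binomial a w n ≤ 1ℚ + a * a * T
      β≤ = begin
        binomial a w n
          ≤⟨ a≤b+∣a-b∣ _ (1ℚ + ι n * (a * 0ℚ)) ⟩
        1ℚ + ι n * (a * 0ℚ) + ∣ binomial a w n - (1ℚ + ι n * (a * 0ℚ)) ∣
          ≤⟨ ℚ.+-monoʳ-≤ (1ℚ + ι n * (a * 0ℚ)) (binomial-bound₂ 0≤a a≤1 n 1ℚ w growth) ⟩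
        1ℚ + ι n * (a * 0ℚ) + a * a * (1ℚ * T)
          ≡⟨ solve 3 (λ n a t → con 1ℚ :+ n :* (a :* con 0ℚ) :+ a :* a :* (con 1ℚ :* t) := con 1ℚ :+ a :* a :* t)
               refl (ι n) a T ⟩
        1ℚ + a * a * T ∎
      β′≤ : binomial a (w ∘ suc) n ≤ a * c + a * a * (2ℚ * T)
      β′≤ = begin
        binomial a (w ∘ suc) n
          ≤⟨ a≤b+∣a-b∣ _ (0ℚ + ι n * (a * w 2)) ⟩
        0ℚ + ι n * (a * w 2) + ∣ binomial a (w ∘ suc) n - (0ℚ + ι n * (a * w 2)) ∣
          ≤⟨ ℚ.+-monoʳ-≤ (0ℚ + ι n * (a * w 2)) (binomial-bound₂ 0≤a a≤1 n (1ℚ * 2ℚ) (w ∘ suc) (growth-suc 1ℚ w growth)) ⟩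
        0ℚ + ι n * (a * w 2) + a * a * (1ℚ * 2ℚ * T)
          ≡⟨ solve 4 (λ n a w t → con 0ℚ :+ n :* (a :* w) :+ a :* a :* (con 1ℚ :* con 2ℚ :* t)
                      := a :* (n :* w) :+ a :* a :* (con 2ℚ :* t)) refl (ι n) a (w 2) T ⟩
        a * (ι n * w 2) + a * a * (2ℚ * T)
          ≤⟨ ℚ.+-monoˡ-≤ _ (*-monoˡ a 0≤a ∣ψ₂∣≤) ⟩
        a * c + a * a * (2ℚ * T) ∎

    sievedCount-approx : ∀ m {ms : Vec ℕ r} {ys : Vec ℚ r} → Pointwise Floor ms ys →
      ∣ sievedCount (2 ℕ.+ k) m ms - eulerProduct r (2 ℕ.+ k) m * ∏ ys ∣ ≤ leaveOneOut (envelope K c m) ys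
    sievedCount-approx zero {ms} {ys} fs =
      subst (_≤ leaveOneOut (1ℚ ⊓_) ys)
        (cong ∣_∣ (cong₂ _-_ (sym (sievedCount-0 (2 ℕ.+ k) ms)) (sym (ℚ.*-identityˡ (∏ ys)))))
        (∏-floor fs)
    sievedCount-approx (suc m) {ms} {ys} fs = step (prime? (suc m))
      where
      open ℚ.≤-Reasoning
      a P : ℚ
      a = rcp (suc m)
      P = eulerProduct r (2 ℕ.+ k) m
      -- The Euler factor is the scalar by which the sum over subsets acts on a product, so the main
      -- term obeys the recursion of the count.
      main : P * eulerFactor r (2 ℕ.+ k) (suc m) * ∏ ys ≡ subsetSum (a *_) (ψ (2 ℕ.+ k)) (λ zs → P * ∏ zs) ys
      main = trans (cong (λ t → P * t * ∏ ys) (eulerFactor≡binomial r (suc k) (suc m)))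
        (trans (ℚ.*-assoc P (binomial a (ψ (2 ℕ.+ k)) r) (∏ ys))
          (sym (trans (subsetSum-* (a *_) (ψ (2 ℕ.+ k)) P ∏ ys) (cong (P *_) (subsetSum-∏ a (ψ (2 ℕ.+ k)) ys)))))
      step : Dec (Prime (suc m)) →
        ∣ sievedCount (2 ℕ.+ k) (suc m) ms - eulerProduct r (2 ℕ.+ k) (suc m) * ∏ ys ∣
        ≤ leaveOneOut (envelope K c (suc m)) ys
      step (no ¬p) = begin
        ∣ sievedCount (2 ℕ.+ k) (suc m) ms - eulerProduct r (2 ℕ.+ k) (suc m) * ∏ ys ∣
          ≡⟨ cong₂ (λ s t → ∣ s - t * ∏ ys ∣) (sievedCount-nonPrime (2 ℕ.+ k) m ¬p ms) (if-nonPrime (suc m) ¬p) ⟩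
        ∣ sievedCount (2 ℕ.+ k) m ms - P * ∏ ys ∣
          ≤⟨ sievedCount-approx m fs ⟩
        leaveOneOut (envelope K c m) ys
          ≡⟨ cong (λ e → leaveOneOut e ys) (if-nonPrime (suc m) ¬p) ⟨
        leaveOneOut (envelope K c (suc m)) ys ∎
      step (yes p) = begin
        ∣ sievedCount (2 ℕ.+ k) (suc m) ms - eulerProduct r (2 ℕ.+ k) (suc m) * ∏ ys ∣
          ≡⟨ cong₂ (λ s t → ∣ s - t ∣) (sievedCount-prime (2 ℕ.+ k) m p ms)
               (trans (cong (_* ∏ ys) (if-prime (suc m) p)) main) ⟩
        ∣ subsetSum (ℕ._/ suc m) (ψ (2 ℕ.+ k)) (sievedCount (2 ℕ.+ k) m) ms
          - subsetSum (a *_) (ψ (2 ℕ.+ k)) (λ zs → P * ∏ zs) ys ∣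
          ≤⟨ subsetSum-approx (ℕ._/ suc m) (a *_) Floor (λ {x} {y} → floor-/ (suc m) {x} {y}) (ψ (2 ℕ.+ k)) _ _
               (leaveOneOut (envelope K c m)) (sievedCount-approx m) fs ⟩
        subsetSum (a *_) w (leaveOneOut (envelope K c m)) ys
          ≡⟨ subsetSum-leaveOneOut a w (envelope K c m) ys ⟩
        leaveOneOut (spread a w n (envelope K c m)) ys
          ≤⟨ leaveOneOut-mono (floors-0≤ fs)
               (spread≤envelopeStep (0≤rcp (suc m)) (rcp≤1 (suc m)) (envelope-0≤ 0≤K 0≤c m) (envelope-mono 0≤K 0≤c m)) ⟩
        leaveOneOut (envelopeStep K c a (envelope K c m)) ys
          ≡⟨ cong (λ e → leaveOneOut e ys) (if-prime (suc m) p) ⟨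
        leaveOneOut (envelope K c (suc m)) ys ∎

  -- Bounding the envelope

  0≤2 : 0ℚ ≤ 2ℚ
  0≤2 = ℚ.nonNegative⁻¹ 2ℚ

  bernoulli : ∀ b → 0ℚ ≤ b → ∀ n → 1ℚ + ι n * b ≤ (1ℚ + b) ^ n
  bernoulli b 0≤b zero    = ℚ.≤-reflexive
    (trans (cong (λ t → 1ℚ + t * b) ι0) (solve 1 (λ b → con 1ℚ :+ con 0ℚ :* b := con 1ℚ) refl b))
  bernoulli b 0≤b (suc n) = begin
    1ℚ + ι (suc n) * b          ≡⟨ cong (λ t → 1ℚ + t * b) (ι-suc n) ⟩
    1ℚ + (1ℚ + ι n) * b         ≤⟨ ≤-by (b * (ι n * b)) (0≤* 0≤b (0≤* (0≤ι n) 0≤b))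
                                     (solve 2 (λ b n → (con 1ℚ :+ b) :* (con 1ℚ :+ n :* b)
                                       := con 1ℚ :+ (con 1ℚ :+ n) :* b :+ b :* (n :* b)) refl b (ι n)) ⟩
    (1ℚ + b) * (1ℚ + ι n * b)   ≤⟨ *-monoˡ (1ℚ + b) (0≤+ 0≤1 0≤b) (bernoulli b 0≤b n) ⟩
    (1ℚ + b) * (1ℚ + b) ^ n     ∎
    where open ℚ.≤-Reasoning

  -- An upper bound for ∏ (1 + 1/n²) over 2 ≤ n ≤ m.
  squareBound : ℕ → ℚ
  squareBound m = 2ℚ * (1ℚ - rcp (suc m))

  -- From a - a′ = a a′ follows a - a′ = a² (1 - a′), so the two sides differ by exactly 2 a² (a -
  -- a′).
  squareBound-step : ∀ m → let a = rcp (suc m) in (1ℚ + a * a) * (2ℚ * (1ℚ - a)) ≤ squareBound (suc m)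
  squareBound-step m = ≤-by (2ℚ * (a * a * (a - a′))) (0≤* 0≤2 (0≤* (0≤* 0≤a 0≤a) (0≤b-a (rcp-suc-≤ m))))
    (begin
      2ℚ * (1ℚ - a′)
        ≡⟨ solve 2 (λ a a′ → con 2ℚ :* (con 1ℚ :- a′) := con 2ℚ :* (con 1ℚ :- a) :+ con 2ℚ :* (a :- a′)) refl a a′ ⟩
      2ℚ * (1ℚ - a) + 2ℚ * (a - a′)
        ≡⟨ cong (λ t → 2ℚ * (1ℚ - a) + 2ℚ * t) a-a′≡ ⟩
      2ℚ * (1ℚ - a) + 2ℚ * (a * a - a * a * a′)
        ≡⟨ solve 2 (λ a a′ → con 2ℚ :* (con 1ℚ :- a) :+ con 2ℚ :* (a :* a :- a :* a :* a′)
             := (con 1ℚ :+ a :* a) :* (con 2ℚ :* (con 1ℚ :- a)) :+ con 2ℚ :* (a :* a :* (a :- a′))) refl a a′ ⟩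
      (1ℚ + a * a) * (2ℚ * (1ℚ - a)) + 2ℚ * (a * a * (a - a′)) ∎)
    where
    open ≡-Reasoning
    a a′ : ℚ
    a = rcp (suc m)
    a′ = rcp (suc (suc m))
    0≤a : 0ℚ ≤ a
    0≤a = 0≤rcp (suc m)
    a-a′≡ : a - a′ ≡ a * a - a * a * a′
    a-a′≡ = trans (rcp-suc m) (trans
      (solve 2 (λ a a′ → a :* a′ := a :* a :- a :* (a :- a′)) refl a a′)
      (trans (cong (λ t → a * a - a * t) (rcp-suc m))
             (cong (λ t → a * a - t) (sym (ℚ.*-assoc a a a′)))))

  0≤squareBound : ∀ m → 0ℚ ≤ squareBound m
  0≤squareBound m = 0≤* 0≤2 (0≤b-a (rcp≤1 (suc m)))

  squareBound-mono : ∀ m → squareBound m ≤ squareBound (suc m)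
  squareBound-mono m = *-monoˡ 2ℚ 0≤2 (ℚ.+-monoʳ-≤ 1ℚ (ℚ.neg-antimono-≤ (rcp-suc-≤ m)))

  squareBound≤2 : ∀ m → squareBound m ≤ 2ℚ
  squareBound≤2 m = ≤-by (2ℚ * rcp (suc m)) (0≤* 0≤2 (0≤rcp (suc m)))
    (solve 1 (λ a → con 2ℚ := con 2ℚ :* (con 1ℚ :- a) :+ con 2ℚ :* a) refl (rcp (suc m)))

  module _ (κ : ℕ) where

    powerBound : ℕ → ℚ
    powerBound m = squareBound m ^ κ

    0≤powerBound : ∀ m → 0ℚ ≤ powerBound m
    0≤powerBound m = 0≤^ κ (0≤squareBound m)

    powerBound-mono : ∀ m → powerBound m ≤ powerBound (suc m)
    powerBound-mono m = ^-mono κ (0≤squareBound m) (squareBound-mono m)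

    powerBound≤ : ∀ m → powerBound m ≤ 2ℚ ^ κ
    powerBound≤ m = ^-mono κ (0≤squareBound m) (squareBound≤2 m)

    powerBound-1 : 1ℚ ≤ powerBound 1
    powerBound-1 = 1≤^ κ (subst (λ t → 1ℚ ≤ 2ℚ * (1ℚ - t)) (sym (rcp-suc≡/ 1)) ℚ.≤-refl)

    -- Bernoulli's inequality replaces 1 + κ a² by (1 + a²)^κ, so that only the product of the
    -- factors 1 + 1/n² has to be bounded. For this κ is a natural number.
    powerBound-step : ∀ m → let a = rcp (suc m) in
      (1ℚ + ι κ * (a * a)) * powerBound m ≤ powerBound (suc m)
    powerBound-step m = begin
      (1ℚ + ι κ * (a * a)) * squareBound m ^ κ
        ≤⟨ *-monoʳ _ (0≤powerBound m) (bernoulli (a * a) 0≤a² κ) ⟩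
      (1ℚ + a * a) ^ κ * squareBound m ^ κ
        ≡⟨ ^-distrib-* (1ℚ + a * a) (squareBound m) κ ⟨
      ((1ℚ + a * a) * squareBound m) ^ κ
        ≤⟨ ^-mono κ (0≤* (0≤+ 0≤1 0≤a²) (0≤squareBound m)) (squareBound-step m) ⟩
      squareBound (suc m) ^ κ ∎
      where
      open ℚ.≤-Reasoning
      a : ℚ
      a = rcp (suc m)
      0≤a² : 0ℚ ≤ a * a
      0≤a² = 0≤* (0≤rcp (suc m)) (0≤rcp (suc m))

    -- The term with c is multiplied by 1 + κ a² as well, which only enlarges it; the factors 1 +
    -- κ/p² can then be pulled out, leaving the envelope with K = 0. The bound starts at 1, since
    -- `squareBound 0` is 0 and 1 is not prime.
    envelope-split : ∀ {c} → 0ℚ ≤ c → ∀ m {y} → 0ℚ ≤ y →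
      envelope (ι κ) c (suc m) y ≤ powerBound (suc m) * envelope 0ℚ c (suc m) y
    envelope-split {c} 0≤c zero    {y} 0≤y = a≤b*a (ℚ.⊓-glb 0≤1 0≤y) powerBound-1
    envelope-split {c} 0≤c (suc m) {y} 0≤y = step (prime? (2 ℕ.+ m))
      where
      open ℚ.≤-Reasoning
      e e₀ : ℚ → ℚ
      e = envelope (ι κ) c (suc m)
      e₀ = envelope 0ℚ c (suc m)
      0≤e₀ : ∀ {z} → 0ℚ ≤ z → 0ℚ ≤ e₀ z
      0≤e₀ = envelope-0≤ ℚ.≤-refl 0≤c (suc m)
      a T T′ : ℚ
      a = rcp (2 ℕ.+ m)
      T = powerBound (suc m)
      T′ = powerBound (2 ℕ.+ m)
      0≤a : 0ℚ ≤ a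
      0≤a = 0≤rcp (2 ℕ.+ m)
      0≤ay : 0ℚ ≤ a * y
      0≤ay = 0≤* 0≤a 0≤y
      step : Dec (Prime (2 ℕ.+ m)) →
        envelope (ι κ) c (2 ℕ.+ m) y ≤ T′ * envelope 0ℚ c (2 ℕ.+ m) y
      step (no ¬p) = begin
        envelope (ι κ) c (2 ℕ.+ m) y      ≡⟨ envelope-nonPrime (ι κ) c (suc m) y ¬p ⟩
        e y                               ≤⟨ envelope-split 0≤c m 0≤y ⟩
        T * e₀ y                          ≤⟨ *-monoʳ (e₀ y) (0≤e₀ 0≤y) (powerBound-mono (suc m)) ⟩
        T′ * e₀ y                         ≡⟨ cong (T′ *_) (envelope-nonPrime 0ℚ c (suc m) y ¬p) ⟨
        T′ * envelope 0ℚ c (2 ℕ.+ m) y    ∎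
      step (yes p) = begin
        envelope (ι κ) c (2 ℕ.+ m) y      ≡⟨ envelope-prime (ι κ) c (suc m) y p ⟩
        k * e y + c * a * e (a * y)
          ≤⟨ ℚ.+-mono-≤ (*-monoˡ k 0≤k (envelope-split 0≤c m 0≤y))
               (ℚ.≤-trans (*-monoˡ (c * a) (0≤* 0≤c 0≤a) (envelope-split 0≤c m 0≤ay))
                          (a≤b*a (0≤* (0≤* 0≤c 0≤a) (0≤* (0≤powerBound (suc m)) (0≤e₀ 0≤ay))) 1≤k)) ⟩
        k * (T * e₀ y) + k * (c * a * (T * e₀ (a * y)))
          ≡⟨ solve 6 (λ k t x x′ c a → k :* (t :* x) :+ k :* (c :* a :* (t :* x′))
               := k :* t :* ((con 1ℚ :+ con 0ℚ :* (a :* a)) :* x :+ c :* a :* x′)) refl k T (e₀ y) (e₀ (a * y)) c a ⟩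
        k * T * envelopeStep 0ℚ c a e₀ y
          ≤⟨ *-monoʳ _ (0≤+ (0≤* (0≤1+Ka² ℚ.≤-refl 0≤c a 0≤a) (0≤e₀ 0≤y)) (0≤* (0≤* 0≤c 0≤a) (0≤e₀ 0≤ay)))
                       (powerBound-step (suc m)) ⟩
        T′ * envelopeStep 0ℚ c a e₀ y     ≡⟨ cong (T′ *_) (envelope-prime 0ℚ c (suc m) y p) ⟨
        T′ * envelope 0ℚ c (2 ℕ.+ m) y    ∎
        where
        k : ℚ
        k = 1ℚ + ι κ * (a * a)
        1≤k : 1ℚ ≤ k
        1≤k = a≤a+b (0≤* (0≤ι κ) (0≤* 0≤a 0≤a))
        0≤k : 0ℚ ≤ k
        0≤k = ℚ.≤-trans 0≤1 1≤k

  -- The squarefree positive integers with all prime factors at most m.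
  smooth : ℕ → List ℕ
  smooth zero    = 1 ∷ []
  smooth (suc m) = if does (prime? (suc m)) then smooth m ++ List.map (suc m ℕ.*_) (smooth m) else smooth m

  smooth-∤ : ∀ {q} → Prime q → ∀ m → m ℕ.< q → ∀ {d} → d ∈ smooth m → ¬ q ∣ d
  smooth-∤ pq zero    m<q (here refl) q∣1 = ℕ.nonTrivial⇒≢1 {{prime⇒nonTrivial pq}} (∣1⇒≡1 q∣1)
  smooth-∤ pq (suc m) m<q d∈ q∣d with prime? (suc m)
  ... | no _  = smooth-∤ pq m (ℕ.<-trans (ℕ.n<1+n m) m<q) d∈ q∣d
  ... | yes p with ∈-++⁻ (smooth m) d∈
  ...   | inj₁ d∈ = smooth-∤ pq m (ℕ.<-trans (ℕ.n<1+n m) m<q) d∈ q∣d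
  ...   | inj₂ d∈ with ∈-map⁻ (suc m ℕ.*_) d∈
  ...     | d′ , d′∈ , refl with euclidsLemma (suc m) d′ pq q∣d
  ...       | inj₂ q∣d′ = smooth-∤ pq m (ℕ.<-trans (ℕ.n<1+n m) m<q) d′∈ q∣d′
  ...       | inj₁ q∣p with prime⇒irreducible p q∣p
  ...         | inj₁ q≡1 = ℕ.nonTrivial⇒≢1 {{prime⇒nonTrivial pq}} q≡1
  ...         | inj₂ q≡p = ℕ.<⇒≢ m<q (sym q≡p)

  -- The prime p divides none of the earlier elements, so the multiples p d do not repeat them.
  smooth-unique : ∀ m → Unique (smooth m)
  smooth-unique zero    = [] ∷ []
  smooth-unique (suc m) with prime? (suc m)
  ... | no _  = smooth-unique m
  ... | yes p = Unique.++⁺ (smooth-unique m) (Unique.map⁺ (ℕ.*-cancelˡ-≡ _ _ (suc m)) (smooth-unique m)) disjoint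
    where
    disjoint : ∀ {d} → ¬ (d ∈ smooth m × d ∈ List.map (suc m ℕ.*_) (smooth m))
    disjoint (d∈ , pd∈) with ∈-map⁻ (suc m ℕ.*_) pd∈
    ... | d′ , _ , refl = smooth-∤ p m ℕ.≤-refl d∈ (m∣m*n d′)

  smooth-0< : ∀ m {d} → d ∈ smooth m → 0 ℕ.< d
  smooth-0< zero    (here refl) = s≤s z≤n
  smooth-0< (suc m) d∈ with does (prime? (suc m))
  ... | false = smooth-0< m d∈
  ... | true with ∈-++⁻ (smooth m) d∈
  ...   | inj₁ d∈ = smooth-0< m d∈
  ...   | inj₂ d∈ with ∈-map⁻ (suc m ℕ.*_) d∈
  ...     | d′ , d′∈ , refl = ℕ.≤-trans (smooth-0< m d′∈) (ℕ.m≤m+n d′ (m ℕ.* d′))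

  listSum : List ℕ → (ℕ → ℚ) → ℚ
  listSum []       h = 0ℚ
  listSum (d ∷ ds) h = h d + listSum ds h

  listSum-++ : ∀ as bs h → listSum (as ++ bs) h ≡ listSum as h + listSum bs h
  listSum-++ []       bs h = sym (ℚ.+-identityˡ (listSum bs h))
  listSum-++ (a ∷ as) bs h = trans (cong (h a +_) (listSum-++ as bs h))
    (sym (ℚ.+-assoc (h a) (listSum as h) (listSum bs h)))

  listSum-map : ∀ f ds h → listSum (List.map f ds) h ≡ listSum ds (h ∘ f)
  listSum-map f []       h = refl
  listSum-map f (d ∷ ds) h = cong (h (f d) +_) (listSum-map f ds h)

  listSum-mono : ∀ ds {g h} → (∀ d → g d ≤ h d) → listSum ds g ≤ listSum ds h
  listSum-mono []       g≤h = ℚ.≤-refl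
  listSum-mono (d ∷ ds) g≤h = ℚ.+-mono-≤ (g≤h d) (listSum-mono ds g≤h)

  listSum-+ : ∀ ds g h → listSum ds (λ d → g d + h d) ≡ listSum ds g + listSum ds h
  listSum-+ []       g h = refl
  listSum-+ (d ∷ ds) g h = trans (cong (g d + h d +_) (listSum-+ ds g h))
    (solve 4 (λ a b c d → a :+ b :+ (c :+ d) := a :+ c :+ (b :+ d)) refl (g d) (h d) (listSum ds g) (listSum ds h))

  listSum-* : ∀ ds c h → listSum ds (λ d → c * h d) ≡ c * listSum ds h
  listSum-* []       c h = sym (ℚ.*-zeroʳ c)
  listSum-* (d ∷ ds) c h = trans (cong (c * h d +_) (listSum-* ds c h)) (sym (ℚ.*-distribˡ-+ c (h d) (listSum ds h)))

  listSum-0≤ : ∀ ds {h} → (∀ d → 0ℚ ≤ h d) → 0ℚ ≤ listSum ds h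
  listSum-0≤ []       0≤h = ℚ.≤-refl
  listSum-0≤ (d ∷ ds) 0≤h = 0≤+ (0≤h d) (listSum-0≤ ds 0≤h)

  -- Each element of `xs` is cut out of `ys` at one occurrence; distinctness keeps the remaining
  -- elements of `xs` inside what is left.
  listSum-⊆ : ∀ {xs ys} h → (∀ d → 0ℚ ≤ h d) → Unique xs → (∀ {d} → d ∈ xs → d ∈ ys) →
              listSum xs h ≤ listSum ys h
  listSum-⊆ {[]}     {ys} h 0≤h []         xs⊆ys = listSum-0≤ ys 0≤h
  listSum-⊆ {x ∷ xs} {ys} h 0≤h (x∉ ∷ u) xs⊆ys with ∈-∃++ (xs⊆ys (here refl))
  ... | as , bs , refl = begin
    h x + listSum xs h                    ≤⟨ ℚ.+-monoʳ-≤ (h x) (listSum-⊆ h 0≤h u xs⊆) ⟩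
    h x + listSum (as ++ bs) h            ≡⟨ cong (h x +_) (listSum-++ as bs h) ⟩
    h x + (listSum as h + listSum bs h)
      ≡⟨ solve 3 (λ x a b → x :+ (a :+ b) := a :+ (x :+ b)) refl (h x) (listSum as h) (listSum bs h) ⟩
    listSum as h + (h x + listSum bs h)   ≡⟨ listSum-++ as (x ∷ bs) h ⟨
    listSum (as ++ x ∷ bs) h              ∎
    where
    open ℚ.≤-Reasoning
    xs⊆ : ∀ {d} → d ∈ xs → d ∈ as ++ bs
    xs⊆ {d} d∈ with ∈-++⁻ as (xs⊆ys (there d∈))
    ... | inj₁ d∈as           = ∈-++⁺ˡ d∈as
    ... | inj₂ (here d≡x)     = contradiction (sym d≡x) (ListAll.lookup x∉ d∈)
    ... | inj₂ (there d∈bs)   = ∈-++⁺ʳ as d∈bs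

  listSum-applyUpTo : ∀ n f h → listSum (List.applyUpTo f n) h ≡ Σ< n (h ∘ f)
  listSum-applyUpTo zero    f h = refl
  listSum-applyUpTo (suc n) f h = cong (h (f 0) +_) (listSum-applyUpTo n (f ∘ suc) h)

  ∈⇒≤sum : ∀ {d ds} → d ∈ ds → d ℕ.≤ sum ds
  ∈⇒≤sum {ds = _ ∷ ds} (here refl) = ℕ.m≤m+n _ (sum ds)
  ∈⇒≤sum {ds = e ∷ _}  (there d∈)  = ℕ.≤-trans (∈⇒≤sum d∈) (ℕ.m≤n+m _ e)

  -- Passes from squarefree d to all positive d up to some D. Any upper bound of the list serves as
  -- D, and the sum of its elements is one; the later estimate does not depend on D.
  listSum-smooth : ∀ m h → (∀ d → 0ℚ ≤ h d) → ∃ λ D → listSum (smooth m) h ≤ Σ< D (h ∘ suc)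
  listSum-smooth m h 0≤h = sum (smooth m) , subst (listSum (smooth m) h ≤_)
    (listSum-applyUpTo (sum (smooth m)) suc h)
    (listSum-⊆ h 0≤h (smooth-unique m) inRange)
    where
    inRange : ∀ {d} → d ∈ smooth m → d ∈ List.applyUpTo suc (sum (smooth m))
    inRange {zero}  d∈ = contradiction (smooth-0< m d∈) λ ()
    inRange {suc d} d∈ = ∈-applyUpTo⁺ suc (∈⇒≤sum d∈)

  -- Multiplicativity persists at the junk value, so the termwise comparison of sums over lists
  -- holds at every d.
  rcp-*-total : ∀ m n → rcp (m ℕ.* n) ≡ rcp m * rcp n
  rcp-*-total zero    n       = trans rcp0 (trans (sym (ℚ.*-zeroˡ (rcp n))) (cong (_* rcp n) (sym rcp0)))
  rcp-*-total (suc m) zero    = trans (cong rcp (ℕ.*-zeroʳ m)) (trans rcp0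
    (trans (sym (ℚ.*-zeroʳ (rcp (suc m)))) (cong (rcp (suc m) *_) (sym rcp0))))
  rcp-*-total (suc m) (suc n) = rcp-* (suc m) (suc n)

  -- The Dirichlet convolution step: raising the slope by one costs one more
  -- sum over squarefree d.
  envelope-convolve : ∀ {c} → 0ℚ ≤ c → ∀ m {y} → 0ℚ ≤ y →
    envelope 0ℚ (1ℚ + c) m y ≤ listSum (smooth m) (λ d → rcp d * envelope 0ℚ c m (rcp d * y))
  envelope-convolve {c} 0≤c zero    {y} 0≤y = ℚ.≤-reflexive
    (trans (solve 1 (λ x → x := con 1ℚ :* x :+ con 0ℚ) refl (1ℚ ⊓ y))
      (trans (cong (λ z → 1ℚ * (1ℚ ⊓ z) + 0ℚ) (sym (ℚ.*-identityˡ y)))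
             (cong (λ t → t * (1ℚ ⊓ (t * y)) + 0ℚ) (sym (rcp-suc≡/ 0)))))
  envelope-convolve {c} 0≤c (suc m) {y} 0≤y = step (prime? (suc m))
    where
    open ℚ.≤-Reasoning
    e : ℚ → ℚ
    e = envelope 0ℚ c m
    a : ℚ
    a = rcp (suc m)
    0≤a : 0ℚ ≤ a
    0≤a = 0≤rcp (suc m)
    U : List ℕ
    U = smooth m
    f : ℚ → ℕ → ℚ
    f z d = rcp d * e (rcp d * z)
    total : List ℕ → (ℚ → ℚ) → ℚ
    total V h = listSum V (λ d → rcp d * h (rcp d * y))
    g : ℕ → ℚ
    g d = rcp d * envelopeStep 0ℚ c a e (rcp d * y)
    -- The step at d supplies c of the slope 1 + c, and the new element p d supplies the remaining
    -- 1. The slope term of p d itself is the slack.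
    termwise : ∀ d → f y d + (1ℚ + c) * a * f (a * y) d ≤ g d + g (suc m ℕ.* d)
    termwise d = ≤-by (a * ρ * (c * a * e (a * (a * ρ * y))))
      (0≤* (0≤* 0≤a 0≤ρ) (0≤* (0≤* 0≤c 0≤a)
        (envelope-0≤ ℚ.≤-refl 0≤c m (0≤* 0≤a (0≤* (0≤* 0≤a 0≤ρ) 0≤y)))))
      (begin-equality
        g d + rcp (suc m ℕ.* d) * envelopeStep 0ℚ c a e (rcp (suc m ℕ.* d) * y)
          ≡⟨ cong (λ t → g d + t * envelopeStep 0ℚ c a e (t * y)) (rcp-*-total (suc m) d) ⟩
        ρ * ((1ℚ + 0ℚ * (a * a)) * e (ρ * y) + c * a * e (a * (ρ * y)))
          + a * ρ * ((1ℚ + 0ℚ * (a * a)) * e (a * ρ * y) + c * a * e (a * (a * ρ * y)))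
          ≡⟨ cong₂ (λ u v → ρ * ((1ℚ + 0ℚ * (a * a)) * e (ρ * y) + c * a * e u)
               + a * ρ * ((1ℚ + 0ℚ * (a * a)) * e v + c * a * e (a * (a * ρ * y))))
               (solve 3 (λ a r y → a :* (r :* y) := r :* (a :* y)) refl a ρ y)
               (solve 3 (λ a r y → a :* r :* y := r :* (a :* y)) refl a ρ y) ⟩
        ρ * ((1ℚ + 0ℚ * (a * a)) * e (ρ * y) + c * a * e (ρ * (a * y)))
          + a * ρ * ((1ℚ + 0ℚ * (a * a)) * e (ρ * (a * y)) + c * a * e (a * (a * ρ * y)))
          ≡⟨ solve 6 (λ r a c x x′ x″ →
               r :* ((con 1ℚ :+ con 0ℚ :* (a :* a)) :* x :+ c :* a :* x′)
                 :+ a :* r :* ((con 1ℚ :+ con 0ℚ :* (a :* a)) :* x′ :+ c :* a :* x″)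
               := r :* x :+ (con 1ℚ :+ c) :* a :* (r :* x′) :+ a :* r :* (c :* a :* x″)) refl
               ρ a c (e (ρ * y)) (e (ρ * (a * y))) (e (a * (a * ρ * y))) ⟩
        f y d + (1ℚ + c) * a * f (a * y) d + a * ρ * (c * a * e (a * (a * ρ * y))) ∎)
      where
      ρ : ℚ
      ρ = rcp d
      0≤ρ : 0ℚ ≤ ρ
      0≤ρ = 0≤rcp d
    step : Dec (Prime (suc m)) → envelope 0ℚ (1ℚ + c) (suc m) y
         ≤ listSum (smooth (suc m)) (λ d → rcp d * envelope 0ℚ c (suc m) (rcp d * y))
    step (no ¬p) = begin
      envelope 0ℚ (1ℚ + c) (suc m) y   ≡⟨ envelope-nonPrime 0ℚ (1ℚ + c) m y ¬p ⟩
      envelope 0ℚ (1ℚ + c) m y         ≤⟨ envelope-convolve 0≤c m 0≤y ⟩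
      listSum U (f y)
        ≡⟨ cong₂ total (if-nonPrime (suc m) ¬p) (if-nonPrime (suc m) ¬p) ⟨
      listSum (smooth (suc m)) (λ d → rcp d * envelope 0ℚ c (suc m) (rcp d * y)) ∎
    step (yes p) = begin
      envelope 0ℚ (1ℚ + c) (suc m) y   ≡⟨ envelope-prime 0ℚ (1ℚ + c) m y p ⟩
      (1ℚ + 0ℚ * (a * a)) * envelope 0ℚ (1ℚ + c) m y + (1ℚ + c) * a * envelope 0ℚ (1ℚ + c) m (a * y)
        ≡⟨ cong (_+ (1ℚ + c) * a * envelope 0ℚ (1ℚ + c) m (a * y))
             (solve 2 (λ a x → (con 1ℚ :+ con 0ℚ :* (a :* a)) :* x := x) refl a (envelope 0ℚ (1ℚ + c) m y)) ⟩
      envelope 0ℚ (1ℚ + c) m y + (1ℚ + c) * a * envelope 0ℚ (1ℚ + c) m (a * y)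
        ≤⟨ ℚ.+-mono-≤ (envelope-convolve 0≤c m 0≤y)
             (*-monoˡ ((1ℚ + c) * a) (0≤* (0≤+ 0≤1 0≤c) 0≤a) (envelope-convolve 0≤c m (0≤* 0≤a 0≤y))) ⟩
      listSum U (f y) + (1ℚ + c) * a * listSum U (f (a * y))
        ≡⟨ cong (listSum U (f y) +_) (listSum-* U ((1ℚ + c) * a) (f (a * y))) ⟨
      listSum U (f y) + listSum U (λ d → (1ℚ + c) * a * f (a * y) d)
        ≡⟨ listSum-+ U (f y) (λ d → (1ℚ + c) * a * f (a * y) d) ⟨
      listSum U (λ d → f y d + (1ℚ + c) * a * f (a * y) d)
        ≤⟨ listSum-mono U termwise ⟩
      listSum U (λ d → g d + g (suc m ℕ.* d))
        ≡⟨ listSum-+ U g (g ∘ (suc m ℕ.*_)) ⟩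
      listSum U g + listSum U (g ∘ (suc m ℕ.*_))
        ≡⟨ cong (listSum U g +_) (listSum-map (suc m ℕ.*_) U g) ⟨
      listSum U g + listSum (List.map (suc m ℕ.*_) U) g
        ≡⟨ listSum-++ U (List.map (suc m ℕ.*_) U) g ⟨
      listSum (U ++ List.map (suc m ℕ.*_) U) g
        ≡⟨ cong₂ total (if-prime (suc m) p) (if-prime (suc m) p) ⟨
      listSum (smooth (suc m)) (λ d → rcp d * envelope 0ℚ c (suc m) (rcp d * y)) ∎

  -- The truncated sum over d

  Σ<-mono : ∀ n {f g} → (∀ j → f j ≤ g j) → Σ< n f ≤ Σ< n g
  Σ<-mono zero    f≤g = ℚ.≤-refl
  Σ<-mono (suc n) f≤g = ℚ.+-mono-≤ (f≤g 0) (Σ<-mono n (f≤g ∘ suc))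

  Σ<-0≤ : ∀ n {f} → (∀ j → 0ℚ ≤ f j) → 0ℚ ≤ Σ< n f
  Σ<-0≤ zero    0≤f = ℚ.≤-refl
  Σ<-0≤ (suc n) 0≤f = 0≤+ (0≤f 0) (Σ<-0≤ n (0≤f ∘ suc))

  Σ<-* : ∀ n c f → Σ< n (λ j → c * f j) ≡ c * Σ< n f
  Σ<-* zero    c f = sym (ℚ.*-zeroʳ c)
  Σ<-* (suc n) c f = trans (cong (c * f 0 +_) (Σ<-* n c (f ∘ suc))) (sym (ℚ.*-distribˡ-+ c (f 0) (Σ< n (f ∘ suc))))

  Σ<-split : ∀ m n f → Σ< (m ℕ.+ n) f ≡ Σ< m f + Σ< n (λ j → f (m ℕ.+ j))
  Σ<-split zero    n f = sym (ℚ.+-identityˡ (Σ< n f))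
  Σ<-split (suc m) n f = trans (cong (f 0 +_) (Σ<-split m n (f ∘ suc)))
    (sym (ℚ.+-assoc (f 0) (Σ< m (f ∘ suc)) (Σ< n (λ j → f (suc m ℕ.+ j)))))

  Σ<-telescope : ∀ n (f : ℕ → ℚ) → Σ< n (λ j → f j - f (suc j)) ≡ f 0 - f n
  Σ<-telescope zero    f = sym (ℚ.+-inverseʳ (f 0))
  Σ<-telescope (suc n) f = trans (cong (f 0 - f 1 +_) (Σ<-telescope n (f ∘ suc)))
    (solve 3 (λ a b c → a :- b :+ (b :- c) := a :- c) refl (f 0) (f 1) (f (suc n)))

  Σ<-rcp² : ∀ m n → Σ< n (λ j → rcp (2 ℕ.+ m ℕ.+ j) * rcp (2 ℕ.+ m ℕ.+ j)) ≤ rcp (suc m)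
  Σ<-rcp² m n = begin
    Σ< n (λ j → rcp (2 ℕ.+ m ℕ.+ j) * rcp (2 ℕ.+ m ℕ.+ j))
      ≤⟨ Σ<-mono n (λ j → rcp²≤ (m ℕ.+ j)) ⟩
    Σ< n (λ j → rcp (suc (m ℕ.+ j)) - rcp (2 ℕ.+ m ℕ.+ j))
      ≡⟨ Σ<-cong n (λ j → cong (λ i → rcp (suc (m ℕ.+ j)) - rcp (suc i)) (sym (ℕ.+-suc m j))) ⟩
    Σ< n (λ j → rcp (suc (m ℕ.+ j)) - rcp (suc (m ℕ.+ suc j)))
      ≡⟨ Σ<-telescope n (λ j → rcp (suc (m ℕ.+ j))) ⟩
    rcp (suc (m ℕ.+ 0)) - rcp (suc (m ℕ.+ n))
      ≤⟨ ≤-by (rcp (suc (m ℕ.+ n))) (0≤rcp (suc (m ℕ.+ n)))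
           (solve 2 (λ a b → a := a :- b :+ b) refl (rcp (suc (m ℕ.+ 0))) (rcp (suc (m ℕ.+ n)))) ⟩
    rcp (suc (m ℕ.+ 0))   ≡⟨ cong (rcp ∘ suc) (ℕ.+-identityʳ m) ⟩
    rcp (suc m)           ∎
    where open ℚ.≤-Reasoning

  harmonic : ℕ → ℚ
  harmonic n = Σ< n (rcp ∘ suc)

  -- The summand 2 serves two cases below: Σ 1/d² ≤ 2 when y ≤ 1, and a tail of size at most 1 when
  -- y ≥ 1.
  logBound : ℕ → ℚ
  logBound n = 2ℚ + harmonic n

  0≤logBound : ∀ n → 0ℚ ≤ logBound n
  0≤logBound n = 0≤+ 0≤2 (Σ<-0≤ n (λ j → 0≤rcp (suc j)))

  -- For y ≤ 1 the sum is at most y Σ 1/d². For y ≥ 1 the terms with d ≤ N are at most 1/d, and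
  -- those with d > N at most N/d², with sum at most 1. The factor min(1, y) reappears on the right,
  -- so the bound can be iterated.
  Σ<-truncated : ∀ N D {y} → 0ℚ ≤ y → y ≤ ι N →
    Σ< D (λ j → rcp (suc j) * (1ℚ ⊓ (rcp (suc j) * y))) ≤ logBound N * (1ℚ ⊓ y)
  Σ<-truncated N D {y} 0≤y y≤N = cases (ℚ.≤-total y 1ℚ)
    where
    open ℚ.≤-Reasoning
    0≤term : ∀ j → 0ℚ ≤ rcp (suc j) * (1ℚ ⊓ (rcp (suc j) * y))
    0≤term j = 0≤* (0≤rcp (suc j)) (ℚ.⊓-glb 0≤1 (0≤* (0≤rcp (suc j)) 0≤y))
    term≤y : ∀ {z} → y ≤ z → ∀ j → rcp (suc j) * (1ℚ ⊓ (rcp (suc j) * y)) ≤ z * (rcp (suc j) * rcp (suc j))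
    term≤y {z} y≤z j = begin
      rcp (suc j) * (1ℚ ⊓ (rcp (suc j) * y))
        ≤⟨ *-monoˡ _ (0≤rcp (suc j)) (ℚ.p⊓q≤q 1ℚ (rcp (suc j) * y)) ⟩
      rcp (suc j) * (rcp (suc j) * y)
        ≤⟨ *-monoˡ _ (0≤rcp (suc j)) (*-monoˡ _ (0≤rcp (suc j)) y≤z) ⟩
      rcp (suc j) * (rcp (suc j) * z)
        ≡⟨ solve 2 (λ a z → a :* (a :* z) := z :* (a :* a)) refl (rcp (suc j)) z ⟩
      z * (rcp (suc j) * rcp (suc j)) ∎
    squares : ∀ D → Σ< D (λ j → rcp (suc j) * rcp (suc j)) ≤ 2ℚ
    squares zero    = 0≤2
    squares (suc D) = ℚ.+-mono-≤ (*-mono (0≤rcp 1) (rcp≤1 1) (0≤rcp 1) (rcp≤1 1))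
                                 (ℚ.≤-trans (Σ<-rcp² 0 D) (rcp≤1 1))
    cases : _ → Σ< D (λ j → rcp (suc j) * (1ℚ ⊓ (rcp (suc j) * y))) ≤ logBound N * (1ℚ ⊓ y)
    cases (inj₁ y≤1) = begin
      Σ< D (λ j → rcp (suc j) * (1ℚ ⊓ (rcp (suc j) * y)))
        ≤⟨ Σ<-mono D (term≤y ℚ.≤-refl) ⟩
      Σ< D (λ j → y * (rcp (suc j) * rcp (suc j)))
        ≡⟨ Σ<-* D y (λ j → rcp (suc j) * rcp (suc j)) ⟩
      y * Σ< D (λ j → rcp (suc j) * rcp (suc j))
        ≤⟨ *-monoˡ y 0≤y (squares D) ⟩
      y * 2ℚ
        ≤⟨ *-monoˡ y 0≤y (a≤a+b (Σ<-0≤ N (λ j → 0≤rcp (suc j)))) ⟩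
      y * logBound N
        ≡⟨ ℚ.*-comm y (logBound N) ⟩
      logBound N * y
        ≡⟨ cong (logBound N *_) (ℚ.p≥q⇒p⊓q≡q y≤1) ⟨
      logBound N * (1ℚ ⊓ y) ∎
    cases (inj₂ 1≤y) = begin
      Σ< D h
        -- Extends the range by N terms, so that it can be cut at N however D compares with N.
        ≤⟨ a≤b+a (Σ<-0≤ N 0≤term′) ⟩
      Σ< N (λ j → h (D ℕ.+ j)) + Σ< D h
        ≡⟨ trans (ℚ.+-comm _ (Σ< D h)) (sym (Σ<-split D N h)) ⟩
      Σ< (D ℕ.+ N) h
        ≡⟨ cong (λ t → Σ< t h) (ℕ.+-comm D N) ⟩
      Σ< (N ℕ.+ D) h
        ≡⟨ Σ<-split N D h ⟩
      Σ< N h + Σ< D (λ j → h (N ℕ.+ j))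
        ≤⟨ ℚ.+-mono-≤ (Σ<-mono N head) (tail N y≤N (ι-cancel-≤ (ℚ.≤-trans (ℚ.≤-reflexive ι1) (ℚ.≤-trans 1≤y y≤N)))) ⟩
      harmonic N + 1ℚ
        ≤⟨ ≤-by 1ℚ 0≤1 (solve 1 (λ h → con 2ℚ :+ h := h :+ con 1ℚ :+ con 1ℚ) refl (harmonic N)) ⟩
      logBound N
        ≡⟨ ℚ.*-identityʳ (logBound N) ⟨
      logBound N * 1ℚ
        ≡⟨ cong (logBound N *_) (ℚ.p≤q⇒p⊓q≡p 1≤y) ⟨
      logBound N * (1ℚ ⊓ y) ∎
      where
      h : ℕ → ℚ
      h j = rcp (suc j) * (1ℚ ⊓ (rcp (suc j) * y))
      0≤term′ : ∀ j → 0ℚ ≤ h (D ℕ.+ j)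
      0≤term′ j = 0≤term (D ℕ.+ j)
      head : ∀ j → h j ≤ rcp (suc j)
      head j = subst (h j ≤_) (ℚ.*-identityʳ (rcp (suc j)))
        (*-monoˡ _ (0≤rcp (suc j)) (ℚ.p⊓q≤p 1ℚ (rcp (suc j) * y)))
      tail : ∀ N → y ≤ ι N → 1 ℕ.≤ N → Σ< D (λ j → h (N ℕ.+ j)) ≤ 1ℚ
      tail (suc N) y≤N _ = begin
        Σ< D (λ j → h (suc N ℕ.+ j))
          ≤⟨ Σ<-mono D (λ j → term≤y y≤N (suc N ℕ.+ j)) ⟩
        Σ< D (λ j → ι (suc N) * (rcp (2 ℕ.+ N ℕ.+ j) * rcp (2 ℕ.+ N ℕ.+ j)))
          ≡⟨ Σ<-* D (ι (suc N)) (λ j → rcp (2 ℕ.+ N ℕ.+ j) * rcp (2 ℕ.+ N ℕ.+ j)) ⟩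
        ι (suc N) * Σ< D (λ j → rcp (2 ℕ.+ N ℕ.+ j) * rcp (2 ℕ.+ N ℕ.+ j))
          ≤⟨ *-monoˡ _ (0≤ι (suc N)) (Σ<-rcp² N D) ⟩
        ι (suc N) * rcp (suc N)
          ≡⟨ ι*rcp (suc N) ⟩
        1ℚ ∎

  -- Induction on the slope: each unit costs one convolution and hence one factor `logBound N`,
  -- while at slope 0 the step at a prime changes nothing. The same N serves throughout because y/d
  -- ≤ y.
  envelope-bound : ∀ N s m {y} → 0ℚ ≤ y → y ≤ ι N →
    envelope 0ℚ (ι s) m y ≤ logBound N ^ s * (1ℚ ⊓ y)
  envelope-bound N zero    zero    {y} 0≤y y≤N = ℚ.≤-reflexive (sym (ℚ.*-identityˡ (1ℚ ⊓ y)))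
  envelope-bound N zero    (suc m) {y} 0≤y y≤N with does (prime? (suc m))
  ... | false = envelope-bound N zero m 0≤y y≤N
  ... | true  = ℚ.≤-trans (ℚ.≤-reflexive
    (trans (cong (λ t → (1ℚ + 0ℚ * (a * a)) * e y + t * a * e (a * y)) ι0)
           (solve 3 (λ a x x′ → (con 1ℚ :+ con 0ℚ :* (a :* a)) :* x :+ con 0ℚ :* a :* x′ := x) refl a (e y) (e (a * y)))))
    (envelope-bound N zero m 0≤y y≤N)
    where
    a : ℚ
    a = rcp (suc m)
    e : ℚ → ℚ
    e = envelope 0ℚ (ι 0) m
  envelope-bound N (suc s) m {y} 0≤y y≤N = begin
    envelope 0ℚ (ι (suc s)) m y
      ≡⟨ cong (λ c → envelope 0ℚ c m y) (ι-suc s) ⟩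
    envelope 0ℚ (1ℚ + ι s) m y
      ≤⟨ envelope-convolve (0≤ι s) m 0≤y ⟩
    listSum (smooth m) f
      ≤⟨ proj₂ enough ⟩
    Σ< D (f ∘ suc)
      ≤⟨ Σ<-mono D bound ⟩
    Σ< D (λ j → L ^ s * (rcp (suc j) * (1ℚ ⊓ (rcp (suc j) * y))))
      ≡⟨ Σ<-* D (L ^ s) (λ j → rcp (suc j) * (1ℚ ⊓ (rcp (suc j) * y))) ⟩
    L ^ s * Σ< D (λ j → rcp (suc j) * (1ℚ ⊓ (rcp (suc j) * y)))
      ≤⟨ *-monoˡ _ (0≤^ s (0≤logBound N)) (Σ<-truncated N D 0≤y y≤N) ⟩
    L ^ s * (L * (1ℚ ⊓ y))
      ≡⟨ solve 3 (λ p l x → p :* (l :* x) := l :* p :* x) refl (L ^ s) L (1ℚ ⊓ y) ⟩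
    L * L ^ s * (1ℚ ⊓ y) ∎
    where
    open ℚ.≤-Reasoning
    L : ℚ
    L = logBound N
    f : ℕ → ℚ
    f d = rcp d * envelope 0ℚ (ι s) m (rcp d * y)
    0≤ρy : ∀ d → 0ℚ ≤ rcp d * y
    0≤ρy d = 0≤* (0≤rcp d) 0≤y
    enough : ∃ λ D → listSum (smooth m) f ≤ Σ< D (f ∘ suc)
    enough = listSum-smooth m f (λ d → 0≤* (0≤rcp d) (envelope-0≤ ℚ.≤-refl (0≤ι s) m (0≤ρy d)))
    D : ℕ
    D = proj₁ enough
    bound : ∀ j → f (suc j) ≤ L ^ s * (rcp (suc j) * (1ℚ ⊓ (rcp (suc j) * y)))
    bound j = begin
      ρ * envelope 0ℚ (ι s) m (ρ * y)
        ≤⟨ *-monoˡ ρ (0≤rcp (suc j)) (envelope-bound N s m (0≤ρy (suc j)) (ℚ.≤-trans ρy≤y y≤N)) ⟩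
      ρ * (L ^ s * (1ℚ ⊓ (ρ * y)))
        ≡⟨ solve 3 (λ r p x → r :* (p :* x) := p :* (r :* x)) refl ρ (L ^ s) (1ℚ ⊓ (ρ * y)) ⟩
      L ^ s * (ρ * (1ℚ ⊓ (ρ * y))) ∎
      where
      ρ : ℚ
      ρ = rcp (suc j)
      ρy≤y : ρ * y ≤ y
      ρy≤y = subst (ρ * y ≤_) (ℚ.*-identityˡ y) (*-monoʳ y 0≤y (rcp≤1 (suc j)))

  -- k-wise coprimality as a sieve condition

  lookup-suc : ∀ {r k} n (ns : Vec ℕ r) (is : Vec (Fin r) k) →
    Vec.map (Vec.lookup (n ∷ ns)) (Vec.map Fin.suc is) ≡ Vec.map (Vec.lookup ns) is
  lookup-suc n ns is = sym (map-∘ (Vec.lookup (n ∷ ns)) Fin.suc is)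

  -- Together with `multiplicity≥`: p divides the gcd of some k entries exactly when it divides at
  -- least k of the entries.
  divisiblePositions : ∀ p {r} (ns : Vec ℕ r) k → k ℕ.≤ multiplicity p ns →
    ∃ λ (is : Vec (Fin r) k) → Linked Fin._<_ is × p ∣ gcdᵛ (Vec.map (Vec.lookup ns) is)
  divisiblePositions p ns       zero    _ = [] , [] , p ∣0
  divisiblePositions p (n ∷ ns) (suc k) k≤ with p ∣? n
  ... | no _ with divisiblePositions p ns (suc k) k≤
  ...   | is , linked , p∣ = Vec.map Fin.suc is , Linked.map⁺ (Linked.map s≤s linked)
                           , subst (λ v → p ∣ gcdᵛ v) (sym (lookup-suc n ns is)) p∣
  divisiblePositions p (n ∷ ns) (suc k) (s≤s k≤) | yes p∣n with divisiblePositions p ns k k≤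
  ... | is , linked , p∣ = Fin.zero ∷ Vec.map Fin.suc is , zero∷ linked
                         , gcd-greatest p∣n (subst (λ v → p ∣ gcdᵛ v) (sym (lookup-suc n ns is)) p∣)
    where
    zero∷ : ∀ {k} {is : Vec (Fin _) k} → Linked Fin._<_ is → Linked Fin._<_ (Fin.zero ∷ Vec.map Fin.suc is)
    zero∷ []               = [-]
    zero∷ l@[-]            = s≤s z≤n ∷ Linked.map⁺ (Linked.map s≤s l)
    zero∷ {is = _ ∷ _} l@(_ ∷ _) = s≤s z≤n ∷ Linked.map⁺ (Linked.map s≤s l)

  -- Every index after the first exceeds another one, hence is a successor and survives removal of
  -- the first coordinate.
  increasing-pred : ∀ {r k} {i : Fin (suc r)} {is : Vec (Fin (suc r)) k} → Linked Fin._<_ (i ∷ is) →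
    ∃ λ js → is ≡ Vec.map Fin.suc js × Linked Fin._<_ js
  increasing-pred {is = []}             [-]      = [] , refl , []
  increasing-pred {is = Fin.suc j ∷ is} (_ ∷ ls) with increasing-pred ls
  ... | js , refl , _ = j ∷ js , refl , Linked.map ℕ.s≤s⁻¹ (Linked.map⁻ {xs = j ∷ js} ls)

  multiplicity≥ : ∀ p {r k} (ns : Vec ℕ r) (is : Vec (Fin r) k) → Linked Fin._<_ is →
    p ∣ gcdᵛ (Vec.map (Vec.lookup ns) is) → k ℕ.≤ multiplicity p ns
  multiplicity≥ p ns       []             linked p∣ = z≤n
  multiplicity≥ p (n ∷ ns) (Fin.zero ∷ is) linked p∣ with increasing-pred linked
  ... | js , refl , linked′ rewrite dec-true (p ∣? n) (∣-trans p∣ (gcd[m,n]∣m n _)) =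
    s≤s (multiplicity≥ p ns js linked′
      (subst (λ v → p ∣ gcdᵛ v) (lookup-suc n ns js) (∣-trans p∣ (gcd[m,n]∣n n _))))
  multiplicity≥ p (n ∷ ns) (Fin.suc i ∷ is) linked p∣ with increasing-pred linked
  ... | js , refl , _ = ℕ.≤-trans
    (multiplicity≥ p ns (i ∷ js) (Linked.map ℕ.s≤s⁻¹ (Linked.map⁻ {xs = i ∷ js} linked))
      (subst (λ v → p ∣ gcdᵛ v) (lookup-suc n ns (i ∷ js)) p∣))
    skip
    where
    skip : multiplicity p ns ℕ.≤ multiplicity p (n ∷ ns)
    skip with does (p ∣? n)
    ... | true  = ℕ.n≤1+n _
    ... | false = ℕ.≤-refl

  primeDivisor : ∀ n .{{_ : ℕ.NonZero n}} → n ≢ 1 → ∃ λ p → Prime p × p ∣ n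
  primeDivisor n n≢1 = go factors isFactorisation factorsPrime
    where
    open PrimeFactorisation (factorise n)
    go : ∀ ps → n ≡ product ps → ListAll.All Prime ps → ∃ λ p → Prime p × p ∣ n
    go []       n≡1 _        = contradiction n≡1 n≢1
    go (p ∷ ps) n≡  (pp ∷ _) = p , pp , subst (p ∣_) (sym n≡) (m∣m*n (product ps))

  InRange : ℕ → ℕ → Set
  InRange N n = 1 ℕ.≤ n × n ℕ.≤ N

  below≡1 : ∀ {k t} → t ℕ.< k → below k t ≡ 1ℚ
  below≡1 {suc k} {zero}  _         = refl
  below≡1 {suc k} {suc t} (s≤s t<k) = below≡1 t<k

  below≡0 : ∀ {k t} → k ℕ.≤ t → below k t ≡ 0ℚ
  below≡0 {zero}          _         = refl
  below≡0 {suc k} {suc t} (s≤s k≤t) = below≡0 k≤t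

  sieved-cases : ∀ {r} k M (ns : Vec ℕ r) →
    ((∀ {p} → Prime p → p ℕ.≤ M → multiplicity p ns ℕ.< k) × sieved k M ns ≡ 1ℚ)
    ⊎ (∃ λ p → Prime p × k ℕ.≤ multiplicity p ns) × sieved k M ns ≡ 0ℚ
  sieved-cases k zero    ns = inj₁ ((λ { pp z≤n → contradiction (prime⇒nonTrivial pp) λ () }) , refl)
  sieved-cases k (suc m) ns with sieved-cases k m ns
  sieved-cases k (suc m) ns | ih with prime? (suc m)
  ... | no ¬p with ih
  ...   | inj₂ bad           = inj₂ bad
  ...   | inj₁ (good , eq)   = inj₁ (good′ , eq)
    where
    good′ : ∀ {p} → Prime p → p ℕ.≤ suc m → multiplicity p ns ℕ.< k
    good′ pp p≤ with ℕ.m≤n⇒m<n∨m≡n p≤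
    ... | inj₁ p<   = good pp (ℕ.s≤s⁻¹ p<)
    ... | inj₂ refl = contradiction pp ¬p
  sieved-cases k (suc m) ns | inj₂ (bad , eq)  | yes pp =
    inj₂ (bad , trans (cong (_* below k (multiplicity (suc m) ns)) eq) (ℚ.*-zeroˡ (below k (multiplicity (suc m) ns))))
  sieved-cases k (suc m) ns | inj₁ (good , eq) | yes pp with multiplicity (suc m) ns ℕ.<? k
  ... | no ≮  = inj₂ ((suc m , pp , ℕ.≮⇒≥ ≮) ,
    trans (cong (sieved k m ns *_) (below≡0 (ℕ.≮⇒≥ ≮))) (ℚ.*-zeroʳ (sieved k m ns)))
  ... | yes < = inj₁ (good′ , trans (cong₂ _*_ eq (below≡1 <)) refl)
    where
    good′ : ∀ {p} → Prime p → p ℕ.≤ suc m → multiplicity p ns ℕ.< k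
    good′ pp p≤ with ℕ.m≤n⇒m<n∨m≡n p≤
    ... | inj₁ p<   = good pp (ℕ.s≤s⁻¹ p<)
    ... | inj₂ refl = <

  -- A gcd other than 1 has a prime divisor, which divides an entry and is thus at most N ≤ M; so
  -- the primes up to M decide coprimality. Writing `suc k` guarantees a first selected entry, which
  -- also shows that the gcd is nonzero.
  sieved≡ϱ : ∀ {r k N M} → N ℕ.≤ M → (ns : Vec ℕ r) → All (InRange N) ns →
    sieved (suc k) M ns ≡ ι (ϱ (suc k) ns)
  sieved≡ϱ {r} {k} {N} {M} N≤M ns range with sieved-cases (suc k) M ns
  ... | inj₂ ((p , pp , k≤) , eq) = trans eq (trans (sym ι0)
    (cong (λ b → ι (if b then 1 else 0)) (sym (dec-false (kWiseCoprime? (suc k) ns) notCoprime))))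
    where
    notCoprime : ¬ KWiseCoprime (suc k) ns
    notCoprime coprime with divisiblePositions p ns (suc k) k≤
    ... | is , linked , p∣ = contradiction
      (ℕ.≤-trans (ℕ.nonTrivial⇒n>1 p {{prime⇒nonTrivial pp}}) (∣⇒≤ (subst (p ∣_) (coprime is linked) p∣)))
      (ℕ.<-irrefl refl)
  ... | inj₁ (good , eq) = trans eq (trans (sym ι1)
    (cong (λ b → ι (if b then 1 else 0)) (sym (dec-true (kWiseCoprime? (suc k) ns) coprime))))
    where
    coprime : KWiseCoprime (suc k) ns
    coprime is@(i ∷ is′) linked = decidable-stable (g ℕ.≟ 1) λ g≢1 →
      let p , pp , p∣g = primeDivisor g {{ℕ.≢-nonZero g≢0}} g≢1
      in ℕ.<⇒≱ (good pp (p≤M p∣g)) (multiplicity≥ p ns is linked p∣g)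
      where
      n g : ℕ
      n = Vec.lookup ns i
      g = gcdᵛ (Vec.map (Vec.lookup ns) is)
      inRange : InRange N n
      inRange = lookup⁺ range i
      instance
        n≢0 : ℕ.NonZero n
        n≢0 = ℕ.>-nonZero (proj₁ inRange)
      g∣n : g ∣ n
      g∣n = gcd[m,n]∣m n _
      g≢0 : g ≢ 0
      g≢0 g≡0 with subst (_∣ n) g≡0 g∣n
      ... | 0∣n = ℕ.≢-nonZero⁻¹ n (0∣⇒≡0 0∣n)
      p≤M : ∀ {p} → p ∣ g → p ℕ.≤ M
      p≤M p∣g = ℕ.≤-trans (∣⇒≤ (∣-trans p∣g g∣n)) (ℕ.≤-trans (proj₂ inRange) N≤M)

  boxSum-cong-range : ∀ r N {f g : Vec ℕ r → ℚ} → (∀ ns → All (InRange N) ns → f ns ≡ g ns) →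
    boxSum (Vec.replicate r N) f ≡ boxSum (Vec.replicate r N) g
  boxSum-cong-range zero    N eq = eq [] []
  boxSum-cong-range (suc r) N eq = Σ<-cong-< N λ i i<N →
    boxSum-cong-range r N (λ ns range → eq (suc i ∷ ns) ((s≤s z≤n , i<N) ∷ range))
    where
    Σ<-cong-< : ∀ n {f g} → (∀ j → j ℕ.< n → f j ≡ g j) → Σ< n f ≡ Σ< n g
    Σ<-cong-< zero    f≗g = refl
    Σ<-cong-< (suc n) f≗g = cong₂ _+_ (f≗g 0 (s≤s z≤n)) (Σ<-cong-< n (λ j j<n → f≗g (suc j) (s≤s j<n)))

  ι-sumTuples : ∀ r N (f : Vec ℕ r → ℕ) → ι (sumTuples r N f) ≡ boxSum (Vec.replicate r N) (ι ∘ f)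
  ι-sumTuples zero    N f = refl
  ι-sumTuples (suc r) N f = trans (ι-sum (λ n → sumTuples r N (λ ns → f (n ∷ ns))) suc N)
    (Σ<-cong N (λ i → ι-sumTuples r N (λ ns → f (suc i ∷ ns))))

  sumTuples≡sievedCount : ∀ r k {N M} → N ℕ.≤ M →
    ι (sumTuples r N (ϱ (suc k))) ≡ sievedCount (suc k) M (Vec.replicate r N)
  sumTuples≡sievedCount r k {N} N≤M = trans (ι-sumTuples r N (ϱ (suc k)))
    (sym (boxSum-cong-range r N (sieved≡ϱ N≤M)))

  -- The logarithm

  seq-^ : ∀ x n m → seq (x Defs.^ n) m ≡ seq x m ^ n
  seq-^ x zero    m = refl
  seq-^ x (suc n) m = cong (seq x m *_) (seq-^ x n m)

  archimedean : ∀ q → ∃ λ n → q ≤ ι n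
  archimedean q@(mkℚ (ℤ.+ n) d _) = n , (begin
    q                       ≡⟨ ℚ.↥p/↧p≡p q ⟨
    ℤ.+ n / suc d           ≡⟨ /≡*rcp (ℤ.+ n) (suc d) ⟩
    ℤ.+ n / 1 * rcp (suc d) ≡⟨ cong (_* rcp (suc d)) (ι≡/1 n) ⟨
    ι n * rcp (suc d)       ≤⟨ *-monoˡ (ι n) (0≤ι n) (rcp≤1 (suc d)) ⟩
    ι n * 1ℚ                ≡⟨ ℚ.*-identityʳ (ι n) ⟩
    ι n                     ∎)
    where open ℚ.≤-Reasoning
  archimedean q@(mkℚ ℤ.-[1+ n ] d _) = 0 , ℚ.≤-trans (ℚ.<⇒≤ (ℚ.negative⁻¹ q)) (ℚ.≤-reflexive (sym ι0))

  -- (1 + 1/2m)^m ≤ 2, by induction on the exponent in (1 + a)^j ≤ 1 + 2ja.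
  halfExponential≤2 : ∀ m .{{_ : ℕ.NonZero m}} → (1ℚ + rcp (m ℕ.+ m)) ^ m ≤ 2ℚ
  halfExponential≤2 m@(suc _) = subst ((1ℚ + a) ^ m ≤_) (cong (1ℚ +_) 2ma≡1) (bound m ℕ.≤-refl)
    where
    open ℚ.≤-Reasoning
    a : ℚ
    a = rcp (m ℕ.+ m)
    0≤a : 0ℚ ≤ a
    0≤a = 0≤rcp (m ℕ.+ m)
    2ma≡1 : 2ℚ * (ι m * a) ≡ 1ℚ
    2ma≡1 = trans (solve 2 (λ m a → con 2ℚ :* (m :* a) := (m :+ m) :* a) refl (ι m) a)
      (trans (cong (_* a) (sym (ι-+ m m))) (ι*rcp (m ℕ.+ m)))
    bound : ∀ j → j ℕ.≤ m → (1ℚ + a) ^ j ≤ 1ℚ + 2ℚ * (ι j * a)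
    bound zero    _   = a≤a+b (0≤* 0≤2 (0≤* (0≤ι 0) 0≤a))
    bound (suc j) j<m = begin
      (1ℚ + a) * (1ℚ + a) ^ j
        ≤⟨ *-monoˡ (1ℚ + a) (0≤+ 0≤1 0≤a) (bound j (ℕ.<⇒≤ j<m)) ⟩
      (1ℚ + a) * (1ℚ + 2ℚ * (ι j * a))
        ≡⟨ solve 2 (λ a j → (con 1ℚ :+ a) :* (con 1ℚ :+ con 2ℚ :* (j :* a))
             := con 1ℚ :+ con 2ℚ :* (j :* a) :+ a :+ con 2ℚ :* (j :* a) :* a) refl a (ι j) ⟩
      1ℚ + 2ℚ * (ι j * a) + a + 2ℚ * (ι j * a) * a
        ≤⟨ ℚ.+-monoʳ-≤ (1ℚ + 2ℚ * (ι j * a) + a) (*-monoʳ a 0≤a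
             (*-monoˡ 2ℚ 0≤2 (*-monoʳ a 0≤a (ι-mono (ℕ.<⇒≤ j<m))))) ⟩
      1ℚ + 2ℚ * (ι j * a) + a + 2ℚ * (ι m * a) * a
        ≡⟨ cong (λ t → 1ℚ + 2ℚ * (ι j * a) + a + t * a) 2ma≡1 ⟩
      1ℚ + 2ℚ * (ι j * a) + a + 1ℚ * a
        ≡⟨ solve 2 (λ a j → con 1ℚ :+ con 2ℚ :* (j :* a) :+ a :+ con 1ℚ :* a
             := con 1ℚ :+ con 2ℚ :* ((con 1ℚ :+ j) :* a)) refl a (ι j) ⟩
      1ℚ + 2ℚ * ((1ℚ + ι j) * a)
        ≡⟨ cong (λ t → 1ℚ + 2ℚ * (t * a)) (ι-suc j) ⟨
      1ℚ + 2ℚ * (ι (suc j) * a) ∎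

  4ℚ : ℚ
  4ℚ = 2ℚ * 2ℚ

  -- A finite form of e^q ≤ 4^h. With n = 2mh the base is at most 1 + 1/(2m), and
  -- `halfExponential≤2` is used 2h times. A nonnegative base is what allows q to be replaced by h
  -- inside the power.
  exponential≤4^ : ∀ m h .{{_ : ℕ.NonZero m}} .{{_ : ℕ.NonZero h}} {q} →
    let n = (m ℕ.+ m) ℕ.* h in 0ℚ ≤ 1ℚ + rcp n * q → q ≤ ι h → (1ℚ + rcp n * q) ^ n ≤ 4ℚ ^ h
  exponential≤4^ m@(suc _) h {q} 0≤ q≤h = begin
    (1ℚ + rcp n * q) ^ n
      ≤⟨ ^-mono n 0≤ (ℚ.+-monoʳ-≤ 1ℚ (*-monoˡ (rcp n) (0≤rcp n) q≤h)) ⟩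
    (1ℚ + rcp n * ι h) ^ n
      ≡⟨ cong (λ t → (1ℚ + t) ^ n) cancel ⟩
    (1ℚ + rcp (m ℕ.+ m)) ^ n
      ≡⟨ ^-assocʳ b (m ℕ.+ m) h ⟨
    (b ^ (m ℕ.+ m)) ^ h
      ≡⟨ cong (_^ h) (^-homo-* b m m) ⟩
    (b ^ m * b ^ m) ^ h
      ≤⟨ ^-mono h (0≤* 0≤bᵐ 0≤bᵐ) (*-mono 0≤bᵐ (halfExponential≤2 m) 0≤bᵐ (halfExponential≤2 m)) ⟩
    4ℚ ^ h ∎
    where
    open ℚ.≤-Reasoning
    n : ℕ
    n = (m ℕ.+ m) ℕ.* h
    b : ℚ
    b = 1ℚ + rcp (m ℕ.+ m)
    0≤bᵐ : 0ℚ ≤ b ^ m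
    0≤bᵐ = 0≤^ m (0≤+ 0≤1 (0≤rcp (m ℕ.+ m)))
    cancel : rcp n * ι h ≡ rcp (m ℕ.+ m)
    cancel = trans (cong (_* ι h) (rcp-* (m ℕ.+ m) h))
      (trans (solve 3 (λ a b c → a :* b :* c := a :* (c :* b)) refl (rcp (m ℕ.+ m)) (rcp h) (ι h))
        (trans (cong (rcp (m ℕ.+ m) *_) (ι*rcp h)) (ℚ.*-identityʳ (rcp (m ℕ.+ m)))))

  ¼ : ℚ
  ¼ = ½ * ½

  0<¼ : 0ℚ < ¼
  0<¼ = ℚ.positive⁻¹ ¼

  -- By contradiction: if some late term has ℓ_n + ε < h + 1, the Cauchy property gives ℓ_j ≤ h + 1
  -- for all large j, so the finite exponential, and with it x, stays near or below 4^(h+1), which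
  -- is smaller than N.
  log-lower : ∀ {x ℓ N} → IsLog x ℓ → fromℕ N Defs.≤ x → ∀ h → 4 ℕ.^ suc h ℕ.< N →
    ∀ ε → 0ℚ < ε → ∃ λ M → ∀ n → M ℕ.≤ n → ι (suc h) ≤ seq ℓ n + ε
  log-lower {x} {ℓ} {N} isLog N≤x h 4^h<N ε ε>0 =
    M₁ , λ n M₁≤n → ℚ.≮⇒≥ (λ ℓₙ+ε<h → ℕ.<⇒≱ 4^h<N (N≤4^h n M₁≤n ℓₙ+ε<h))
    where
    open ℚ.≤-Reasoning
    M₁ : ℕ
    M₁ = proj₁ (cauchy ℓ ε ε>0)
    N≤4^h : ∀ n → M₁ ℕ.≤ n → seq ℓ n + ε < ι (suc h) → N ℕ.≤ 4 ℕ.^ suc h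
    N≤4^h n M₁≤n ℓₙ+ε<h = ℕ.s≤s⁻¹ (ι-cancel-< (begin-strict
      ι N                             ≤⟨ subst (_≤ seq x j + ¼) (sym (ι≡/1 N)) (proj₂ N≤ j M₄≤j) ⟩
      seq x j + ¼                     ≤⟨ ℚ.+-monoˡ-≤ ¼ (a≤b+∣a-b∣ (seq x j) P) ⟩
      P + ∣ seq x j - P ∣ + ¼         ≡⟨ cong (λ t → P + t + ¼) (∣-∣-comm (seq x j) P) ⟩
      P + ∣ P - seq x j ∣ + ¼         ≤⟨ ℚ.+-monoˡ-≤ ¼ (ℚ.+-mono-≤ P≤4^h
                                           (subst (λ t → ∣ t - seq x j ∣ ≤ ¼ + ¼) P≡ (proj₂ near′ j M₃≤j))) ⟩
      4ℚ ^ suc h + (¼ + ¼) + ¼        ≡⟨ ℚ.+-assoc (4ℚ ^ suc h) (¼ + ¼) ¼ ⟩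
      4ℚ ^ suc h + (¼ + ¼ + ¼)        <⟨ ℚ.+-monoʳ-< (4ℚ ^ suc h) ¾<1 ⟩
      4ℚ ^ suc h + 1ℚ                 ≡⟨ ℚ.+-comm (4ℚ ^ suc h) 1ℚ ⟩
      1ℚ + 4ℚ ^ suc h                 ≡⟨ cong (1ℚ +_) (trans (ι-^ 4 (suc h)) (cong (_^ suc h) (ι≡/1 4))) ⟨
      1ℚ + ι (4 ℕ.^ suc h)            ≡⟨ ι-suc (4 ℕ.^ suc h) ⟨
      ι (suc (4 ℕ.^ suc h))           ∎))
      where
      -- N ≤ x costs ¼ and the limit defining the logarithm costs ¼ twice; a total below 1
      -- disappears when integers are compared.
      ¾<1 : ¼ + ¼ + ¼ < 1ℚ
      ¾<1 = subst (¼ + ¼ + ¼ <_) refl (ℚ.+-monoʳ-< (¼ + ¼ + ¼) 0<¼)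
      -- An upper bound for -ℓ_j, which keeps the base 1 + ℓ_j / (i + 1) nonnegative once B ≤ i + 1.
      B : ℕ
      B = proj₁ (archimedean (ε - seq ℓ n))
      -- suc i = 2 m (h + 1), the exponent at which exponential≤4^ applies.
      m i : ℕ
      m = suc (proj₁ (isLog ¼ 0<¼) ℕ.⊔ B)
      i = h ℕ.+ (ℕ.pred m ℕ.+ m) ℕ.* suc h
      m≤1+i : m ℕ.≤ suc i
      m≤1+i = ℕ.≤-trans (ℕ.m≤m+n m m) (ℕ.m≤m*n (m ℕ.+ m) (suc h))
      near′ : ∃ λ M → ∀ j → M ℕ.≤ j → _ ≤ ¼ + ¼
      near′ = proj₂ (isLog ¼ 0<¼) i (ℕ.≤-trans (ℕ.m≤m⊔n _ B) (ℕ.s≤s⁻¹ m≤1+i)) ¼ 0<¼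
      N≤ : ∃ λ M → ∀ j → M ℕ.≤ j → ℤ.+ N / 1 ≤ seq x j + ¼
      N≤ = N≤x ¼ 0<¼
      j : ℕ
      j = M₁ ℕ.⊔ (proj₁ near′ ℕ.⊔ proj₁ N≤)
      M₁≤j : M₁ ℕ.≤ j
      M₁≤j = ℕ.m≤m⊔n M₁ _
      M₃≤j : proj₁ near′ ℕ.≤ j
      M₃≤j = ℕ.≤-trans (ℕ.m≤m⊔n (proj₁ near′) (proj₁ N≤)) (ℕ.m≤n⊔m M₁ _)
      M₄≤j : proj₁ N≤ ℕ.≤ j
      M₄≤j = ℕ.≤-trans (ℕ.m≤n⊔m (proj₁ near′) (proj₁ N≤)) (ℕ.m≤n⊔m M₁ _)
      P : ℚ
      P = (1ℚ + rcp (suc i) * seq ℓ j) ^ suc i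
      P≡ : seq ((fromℕ 1 Defs.+ Defs.fromℚ (ℤ.+ 1 / suc i) Defs.* ℓ) Defs.^ suc i) j ≡ P
      P≡ = trans (seq-^ (fromℕ 1 Defs.+ Defs.fromℚ (ℤ.+ 1 / suc i) Defs.* ℓ) (suc i) j)
        (cong (λ t → (1ℚ + t * seq ℓ j) ^ suc i) (sym (rcp-suc≡/ i)))
      close : ∣ seq ℓ j - seq ℓ n ∣ ≤ ε
      close = ℚ.<⇒≤ (proj₂ (cauchy ℓ ε ε>0) j n M₁≤j M₁≤n)
      upper : seq ℓ j ≤ ι (suc h)
      upper = ℚ.≤-trans (a≤b+∣a-b∣ (seq ℓ j) (seq ℓ n))
        (ℚ.≤-trans (ℚ.+-monoʳ-≤ (seq ℓ n) close) (ℚ.<⇒≤ ℓₙ+ε<h))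
      lower : 0ℚ ≤ ι (suc i) + seq ℓ j
      lower = begin
        0ℚ
          ≤⟨ 0≤b-a (subst (_≤ ε) (∣-∣-comm (seq ℓ j) (seq ℓ n)) close) ⟩
        ε - ∣ seq ℓ n - seq ℓ j ∣
          ≤⟨ ℚ.+-monoʳ-≤ ε (ℚ.neg-antimono-≤ (p≤∣p∣ (seq ℓ n - seq ℓ j))) ⟩
        ε - (seq ℓ n - seq ℓ j)
          ≡⟨ solve 3 (λ e a b → e :- (a :- b) := (e :- a) :+ b) refl ε (seq ℓ n) (seq ℓ j) ⟩
        ε - seq ℓ n + seq ℓ j
          ≤⟨ ℚ.+-monoˡ-≤ (seq ℓ j) (proj₂ (archimedean (ε - seq ℓ n))) ⟩
        ι B + seq ℓ j
          ≤⟨ ℚ.+-monoˡ-≤ (seq ℓ j) (ι-mono (ℕ.≤-trans (ℕ.m≤n⊔m _ B) (ℕ.≤-trans (ℕ.n≤1+n _) m≤1+i))) ⟩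
        ι (suc i) + seq ℓ j ∎
      P≤4^h : P ≤ 4ℚ ^ suc h
      P≤4^h = exponential≤4^ m (suc h)
        (subst (0ℚ ≤_) (trans (ℚ.*-distribˡ-+ (rcp (suc i)) (ι (suc i)) (seq ℓ j))
                         (cong (_+ rcp (suc i) * seq ℓ j) (trans (ℚ.*-comm (rcp (suc i)) (ι (suc i))) (ι*rcp (suc i)))))
          (0≤* (0≤rcp (suc i)) lower))
        upper

  -- Harmonic numbers against powers of 4

  harmonic-double : ∀ n → harmonic (n ℕ.+ n) ≤ harmonic n + 1ℚ
  harmonic-double zero      = 0≤1
  harmonic-double n@(suc _) = begin
    harmonic (n ℕ.+ n)
      ≡⟨ Σ<-split n n (rcp ∘ suc) ⟩
    harmonic n + Σ< n (λ j → rcp (suc (n ℕ.+ j)))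
      ≤⟨ ℚ.+-monoʳ-≤ (harmonic n) (Σ<-mono n (λ j → rcp-anti (ℕ.≤-trans (ℕ.m≤m+n n j) (ℕ.n≤1+n _)))) ⟩
    harmonic n + Σ< n (λ j → rcp n)
      ≡⟨ cong (harmonic n +_) (trans (Σ<-const n (rcp n)) (ι*rcp n)) ⟩
    harmonic n + 1ℚ ∎
    where
    open ℚ.≤-Reasoning
    rcp-anti : ∀ {m} → n ℕ.≤ m → rcp m ≤ rcp n
    rcp-anti {m} n≤m with ℕ.m≤n⇒∃[o]m+o≡n n≤m
    ... | o , refl = go o
      where
      go : ∀ o → rcp (n ℕ.+ o) ≤ rcp n
      go zero    = ℚ.≤-reflexive (cong rcp (ℕ.+-identityʳ n))
      go (suc o) = ℚ.≤-trans (subst (λ t → rcp t ≤ rcp (n ℕ.+ o)) (sym (ℕ.+-suc n o)) (rcp-suc-≤ (ℕ.pred n ℕ.+ o))) (go o)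

  harmonic-4^ : ∀ h → harmonic (4 ℕ.^ h) ≤ 1ℚ + 2ℚ * ι h
  harmonic-4^ zero    = ≤-by (2ℚ * ι 0) (0≤* 0≤2 (0≤ι 0))
    (cong (λ t → t + 0ℚ + 2ℚ * ι 0) (sym (rcp-suc≡/ 0)))
  harmonic-4^ (suc h) = begin
    harmonic (4 ℕ.* n)
      ≡⟨ cong harmonic 4n≡ ⟩
    harmonic ((n ℕ.+ n) ℕ.+ (n ℕ.+ n))
      ≤⟨ ℚ.≤-trans (harmonic-double (n ℕ.+ n)) (ℚ.+-monoˡ-≤ 1ℚ (harmonic-double n)) ⟩
    harmonic n + 1ℚ + 1ℚ
      ≤⟨ ℚ.+-monoˡ-≤ 1ℚ (ℚ.+-monoˡ-≤ 1ℚ (harmonic-4^ h)) ⟩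
    1ℚ + 2ℚ * ι h + 1ℚ + 1ℚ
      ≡⟨ solve 1 (λ h → con 1ℚ :+ con 2ℚ :* h :+ con 1ℚ :+ con 1ℚ := con 1ℚ :+ con 2ℚ :* (con 1ℚ :+ h)) refl (ι h) ⟩
    1ℚ + 2ℚ * (1ℚ + ι h)
      ≡⟨ cong (λ t → 1ℚ + 2ℚ * t) (ι-suc h) ⟨
    1ℚ + 2ℚ * ι (suc h) ∎
    where
    open ℚ.≤-Reasoning
    n : ℕ
    n = 4 ℕ.^ h
    4n≡ : 4 ℕ.* n ≡ (n ℕ.+ n) ℕ.+ (n ℕ.+ n)
    4n≡ = trans (cong (λ t → n ℕ.+ (n ℕ.+ (n ℕ.+ t))) (ℕ.+-identityʳ n)) (sym (ℕ.+-assoc n n (n ℕ.+ n)))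

  -- Base 4 matches `exponential≤4^`. The exponent h + 1 has to be positive, since the logarithm
  -- must dominate a constant, and 4 < N is the origin of the threshold 5.
  log₄ : ∀ {N} → 5 ℕ.≤ N → ∃ λ h → 4 ℕ.^ suc h ℕ.< N × N ℕ.≤ 4 ℕ.^ (2 ℕ.+ h)
  log₄ {N} 5≤N with ℕ.m≤n⇒∃[o]m+o≡n 5≤N
  ... | o , refl = go o
    where
    go : ∀ o → ∃ λ h → 4 ℕ.^ suc h ℕ.< 5 ℕ.+ o × 5 ℕ.+ o ℕ.≤ 4 ℕ.^ (2 ℕ.+ h)
    go zero    = 0 , ℕ.≤-refl , ℕ.m≤m+n 5 11
    go (suc o) with go o
    ... | h , 4^<  , ≤4^ with ℕ.m≤n⇒m<n∨m≡n ≤4^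
    ...   | inj₁ <4^ = h , ℕ.≤-trans 4^< (ℕ.n≤1+n _) , <4^
    ...   | inj₂ ≡4^ = suc h , ℕ.≤-reflexive (cong suc (sym ≡4^)) , subst (λ t → suc t ℕ.≤ 4 ℕ.^ (3 ℕ.+ h)) (sym ≡4^)
                         (ℕ.^-monoʳ-< 4 (s≤s (s≤s z≤n)) (ℕ.n<1+n (2 ℕ.+ h)))

  -- The 7 comes from 2 + 1 + 2 (h + 2) = 7 + 2 h ≤ 7 (h + 1).
  logBound≤ : ∀ {N h} → N ℕ.≤ 4 ℕ.^ (2 ℕ.+ h) → logBound N ≤ ι 7 * ι (suc h)
  logBound≤ {N} {h} N≤ with ℕ.m≤n⇒∃[o]m+o≡n N≤
  ... | o , eq = begin
    2ℚ + harmonic N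
      ≤⟨ ℚ.+-monoʳ-≤ 2ℚ (a≤a+b {harmonic N} (Σ<-0≤ o (λ j → 0≤rcp (suc (N ℕ.+ j))))) ⟩
    2ℚ + (harmonic N + Σ< o (λ j → rcp (suc (N ℕ.+ j))))
      ≡⟨ cong (2ℚ +_) (trans (sym (Σ<-split N o (rcp ∘ suc))) (cong harmonic eq)) ⟩
    2ℚ + harmonic (4 ℕ.^ (2 ℕ.+ h))
      ≤⟨ ℚ.+-monoʳ-≤ 2ℚ (harmonic-4^ (2 ℕ.+ h)) ⟩
    2ℚ + (1ℚ + 2ℚ * ι (2 ℕ.+ h))
      ≡⟨ cong (λ t → 2ℚ + (1ℚ + 2ℚ * t)) (trans (ι-suc (suc h)) (cong (1ℚ +_) (ι-suc h))) ⟩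
    2ℚ + (1ℚ + 2ℚ * (1ℚ + (1ℚ + ι h)))
      ≤⟨ ≤-by (5ℚ * ι h) (0≤* (ℚ.nonNegative⁻¹ 5ℚ) (0≤ι h))
           (solve 1 (λ h → con 7ℚ :* (con 1ℚ :+ h)
             := con 2ℚ :+ (con 1ℚ :+ con 2ℚ :* (con 1ℚ :+ (con 1ℚ :+ h))) :+ con 5ℚ :* h) refl (ι h)) ⟩
    7ℚ * (1ℚ + ι h)
      ≡⟨ cong₂ _*_ (ι≡/1 7) (ι-suc h) ⟨
    ι 7 * ι (suc h) ∎
    where
    open ℚ.≤-Reasoning
    5ℚ 7ℚ : ℚ
    5ℚ = ℤ.+ 5 / 1
    7ℚ = ℤ.+ 7 / 1

  -- The density and the estimate

  module Density (r k : ℕ) where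

    -- The number 3^r in its role as an exponent in `powerBound`; `K` is the same number as a
    -- rational coefficient.
    κ₀ : ℕ
    κ₀ = 3 ℕ.^ r

    K : ℚ
    K = 3ℚ ^ r

    ικ₀ : ι κ₀ ≡ K
    ικ₀ = trans (ι-^ 3 r) (cong (_^ r) (ι≡/1 3))

    0≤K : 0ℚ ≤ K
    0≤K = 0≤^ r (ℚ.nonNegative⁻¹ 3ℚ)

    E : ℕ → ℚ
    E = eulerProduct r (2 ℕ.+ k)

    eulerFactor-1 : ∀ m → let a = rcp (suc m) in ∣ eulerFactor r (2 ℕ.+ k) (suc m) - 1ℚ ∣ ≤ K * (a * a)
    eulerFactor-1 m = begin
      ∣ eulerFactor r (2 ℕ.+ k) (suc m) - 1ℚ ∣
        ≡⟨ cong (λ t → ∣ t - 1ℚ ∣) (eulerFactor≡binomial r (suc k) (suc m)) ⟩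
      ∣ binomial a w r - 1ℚ ∣
        -- The linear term is absent because the weight at 1 is 0.
        ≡⟨ cong (λ t → ∣ binomial a w r - t ∣)
             (solve 2 (λ n a → con 1ℚ := con 1ℚ :+ n :* (a :* con 0ℚ)) refl (ι r) a) ⟩
      ∣ binomial a w r - (1ℚ + ι r * (a * 0ℚ)) ∣
        ≤⟨ binomial-bound₂ (0≤rcp (suc m)) (rcp≤1 (suc m)) r 1ℚ w (∣ψ∣≤2^ (2 ℕ.+ k)) ⟩
      a * a * (1ℚ * K)
        ≡⟨ solve 2 (λ a t → a :* a :* (con 1ℚ :* t) := t :* (a :* a)) refl a K ⟩
      K * (a * a) ∎
      where
      open ℚ.≤-Reasoning
      a : ℚ
      a = rcp (suc m)
      w : ℕ → ℚ
      w = ψ (2 ℕ.+ k)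

    ∣eulerProduct∣≤powerBound : ∀ m → ∣ E (suc m) ∣ ≤ powerBound κ₀ (suc m)
    ∣eulerProduct∣≤powerBound zero    = powerBound-1 κ₀
    ∣eulerProduct∣≤powerBound (suc m) = step (prime? (2 ℕ.+ m))
      where
      open ℚ.≤-Reasoning
      a f : ℚ
      a = rcp (2 ℕ.+ m)
      f = eulerFactor r (2 ℕ.+ k) (2 ℕ.+ m)
      ∣f∣≤ : ∣ f ∣ ≤ 1ℚ + ι κ₀ * (a * a)
      ∣f∣≤ = begin
        ∣ f ∣                      ≡⟨ cong ∣_∣ (solve 1 (λ f → f := con 1ℚ :+ (f :- con 1ℚ)) refl f) ⟩
        ∣ 1ℚ + (f - 1ℚ) ∣          ≤⟨ ∣+∣≤ {1ℚ} ℚ.≤-refl (eulerFactor-1 (suc m)) ⟩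
        1ℚ + K * (a * a)           ≡⟨ cong (λ t → 1ℚ + t * (a * a)) ικ₀ ⟨
        1ℚ + ι κ₀ * (a * a)        ∎
      step : Dec (Prime (2 ℕ.+ m)) → ∣ E (2 ℕ.+ m) ∣ ≤ powerBound κ₀ (2 ℕ.+ m)
      step (no ¬p) = begin
        ∣ E (2 ℕ.+ m) ∣            ≡⟨ cong ∣_∣ (if-nonPrime (2 ℕ.+ m) ¬p) ⟩
        ∣ E (suc m) ∣              ≤⟨ ∣eulerProduct∣≤powerBound m ⟩
        powerBound κ₀ (suc m)      ≤⟨ powerBound-mono κ₀ (suc m) ⟩
        powerBound κ₀ (2 ℕ.+ m)    ∎
      step (yes p) = begin
        ∣ E (2 ℕ.+ m) ∣            ≡⟨ cong ∣_∣ (trans (if-prime (2 ℕ.+ m) p) (ℚ.*-comm (E (suc m)) f)) ⟩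
        ∣ f * E (suc m) ∣          ≤⟨ ∣*∣≤ ∣f∣≤ (∣eulerProduct∣≤powerBound m) ⟩
        (1ℚ + ι κ₀ * (a * a)) * powerBound κ₀ (suc m) ≤⟨ powerBound-step κ₀ (suc m) ⟩
        powerBound κ₀ (2 ℕ.+ m)    ∎

    ∣eulerProduct∣≤ : ∀ m → ∣ E m ∣ ≤ 2ℚ ^ κ₀
    ∣eulerProduct∣≤ zero    = 1≤^ κ₀ (a≤a+b 0≤1)
    ∣eulerProduct∣≤ (suc m) = ℚ.≤-trans (∣eulerProduct∣≤powerBound m) (powerBound≤ κ₀ (suc m))

    W : ℚ
    W = 2ℚ ^ κ₀ * K

    0≤W : 0ℚ ≤ W
    0≤W = 0≤* (0≤^ κ₀ 0≤2) 0≤K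

    eulerProduct-increment : ∀ m → ∣ E (suc m) - E m ∣ ≤ W * (rcp (suc m) * rcp (suc m))
    eulerProduct-increment m = step (prime? (suc m))
      where
      open ℚ.≤-Reasoning
      a f : ℚ
      a = rcp (suc m)
      f = eulerFactor r (2 ℕ.+ k) (suc m)
      step : Dec (Prime (suc m)) → ∣ E (suc m) - E m ∣ ≤ W * (a * a)
      step (no ¬p) = begin
        ∣ E (suc m) - E m ∣   ≡⟨ cong (λ t → ∣ t - E m ∣) (if-nonPrime (suc m) ¬p) ⟩
        ∣ E m - E m ∣         ≡⟨ cong ∣_∣ (ℚ.+-inverseʳ (E m)) ⟩
        0ℚ                    ≤⟨ 0≤* 0≤W (0≤* (0≤rcp (suc m)) (0≤rcp (suc m))) ⟩
        W * (a * a)           ∎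
      step (yes p) = begin
        ∣ E (suc m) - E m ∣   ≡⟨ cong (λ t → ∣ t - E m ∣) (if-prime (suc m) p) ⟩
        ∣ E m * f - E m ∣     ≡⟨ cong ∣_∣ (solve 2 (λ e f → e :* f :- e := e :* (f :- con 1ℚ)) refl (E m) f) ⟩
        ∣ E m * (f - 1ℚ) ∣    ≤⟨ ∣*∣≤ {E m} (∣eulerProduct∣≤ m) (eulerFactor-1 m) ⟩
        2ℚ ^ κ₀ * (K * (a * a)) ≡⟨ ℚ.*-assoc (2ℚ ^ κ₀) K (a * a) ⟨
        W * (a * a)           ∎

    eulerProduct-tail : ∀ m n → ∣ E (suc m ℕ.+ n) - E (suc m) ∣ ≤ W * (rcp (suc m) - rcp (suc m ℕ.+ n))
    eulerProduct-tail m zero    rewrite ℕ.+-identityʳ m = ℚ.≤-reflexive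
      (trans (cong ∣_∣ (ℚ.+-inverseʳ (E (suc m))))
        (solve 2 (λ w a → con 0ℚ := w :* (a :- a)) refl W (rcp (suc m))))
    eulerProduct-tail m (suc n) rewrite ℕ.+-suc m n = begin
      ∣ E (suc j) - E (suc m) ∣
        ≡⟨ cong ∣_∣ (solve 3 (λ a b c → a :- c := (a :- b) :+ (b :- c)) refl (E (suc j)) (E j) (E (suc m))) ⟩
      ∣ (E (suc j) - E j) + (E j - E (suc m)) ∣
        ≤⟨ ∣+∣≤ (ℚ.≤-trans (eulerProduct-increment j) (*-monoˡ W 0≤W (rcp²≤ (m ℕ.+ n)))) (eulerProduct-tail m n) ⟩
      W * (rcp j - rcp (suc j)) + W * (rcp (suc m) - rcp j)
        ≡⟨ solve 4 (λ w a b c → w :* (b :- c) :+ w :* (a :- b) := w :* (a :- c)) refl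
             W (rcp (suc m)) (rcp j) (rcp (suc j)) ⟩
      W * (rcp (suc m) - rcp (suc j)) ∎
      where
      open ℚ.≤-Reasoning
      j : ℕ
      j = suc (m ℕ.+ n)

    eulerProduct-close : ∀ m {n} → suc m ℕ.≤ n → ∣ E n - E (suc m) ∣ ≤ W * rcp (suc m)
    eulerProduct-close m 1+m≤n with ℕ.m≤n⇒∃[o]m+o≡n 1+m≤n
    ... | o , refl = ℚ.≤-trans (eulerProduct-tail m o) (*-monoˡ W 0≤W
      (≤-by (rcp (suc m ℕ.+ o)) (0≤rcp (suc m ℕ.+ o))
        (solve 2 (λ a b → a := a :- b :+ b) refl (rcp (suc m)) (rcp (suc m ℕ.+ o)))))

    eulerProduct-cauchy : IsCauchy E
    eulerProduct-cauchy ε ε>0 = suc M , λ m n M<m M<n → begin-strict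
      ∣ E m - E n ∣
        ≡⟨ cong ∣_∣ (solve 3 (λ a b c → a :- b := (a :- c) :+ (c :- b)) refl (E m) (E n) (E (suc M))) ⟩
      ∣ (E m - E (suc M)) + (E (suc M) - E n) ∣
        ≤⟨ ∣+∣≤ (eulerProduct-close M M<m)
                (subst (_≤ W * rcp (suc M)) (∣-∣-comm (E n) (E (suc M))) (eulerProduct-close M M<n)) ⟩
      W * rcp (suc M) + W * rcp (suc M)
        ≡⟨ solve 2 (λ w a → w :* a :+ w :* a := a :* (con 2ℚ :* w)) refl W (rcp (suc M)) ⟩
      rcp (suc M) * (2ℚ * W)
        ≡⟨ cong (rcp (suc M) *_) 2W≡ ⟩
      rcp (suc M) * (Q * ε)
        ≤⟨ *-monoˡ _ (0≤rcp (suc M)) (*-monoʳ ε (ℚ.<⇒≤ ε>0) (proj₂ (archimedean Q))) ⟩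
      rcp (suc M) * (ι M * ε)
        <⟨ ℚ.*-monoʳ-<-pos (rcp (suc M)) {{rcp-pos}} (ℚ.*-monoˡ-<-pos ε (ι-mono-< (ℕ.n<1+n M))) ⟩
      rcp (suc M) * (ι (suc M) * ε)
        ≡⟨ trans (solve 3 (λ a n e → a :* (n :* e) := n :* a :* e) refl (rcp (suc M)) (ι (suc M)) ε)
             (trans (cong (_* ε) (ι*rcp (suc M))) (ℚ.*-identityˡ ε)) ⟩
      ε ∎
      where
      open ℚ.≤-Reasoning
      instance
        posε : Positive ε
        posε = positive ε>0
        nzε : NonZero ε
        nzε = ℚ.pos⇒nonZero ε
      -- M ≥ 2W/ε makes two tails of size W/(M + 1) add up to less than ε.
      Q : ℚ
      Q = 2ℚ * W * 1/ ε
      M : ℕ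
      M = proj₁ (archimedean Q)
      rcp-pos : Positive (rcp (suc M))
      rcp-pos = subst Positive (sym (rcp-suc≡/ M)) (ℚ.normalize-pos 1 (suc M))
      2W≡ : 2ℚ * W ≡ Q * ε
      2W≡ = sym (trans (ℚ.*-assoc (2ℚ * W) (1/ ε) ε) (trans (cong (2ℚ * W *_) (ℚ.*-inverseˡ ε)) (ℚ.*-identityʳ (2ℚ * W))))

    density : ℝ
    density = mkℝ E eulerProduct-cauchy

    density-isA : IsA r (2 ℕ.+ k) density
    density-isA ε ε>0 = proj₁ c , λ n M≤n δ δ>0 → proj₁ c , λ m M≤m →
      ℚ.≤-trans (ℚ.<⇒≤ (proj₂ c n m M≤n M≤m)) (a≤a+b (ℚ.<⇒≤ δ>0))
      where
      c : _
      c = eulerProduct-cauchy ε ε>0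

  -- From the integer N to the real number x

  ^-difference : ∀ {a b c d} → 0ℚ ≤ a → a ≤ c → 0ℚ ≤ b → b ≤ c → ∣ a - b ∣ ≤ d → ∀ n →
    ∣ a ^ suc n - b ^ suc n ∣ ≤ ι (suc n) * (d * c ^ n)
  ^-difference {a} {b} {c} {d} 0≤a a≤c 0≤b b≤c ∣a-b∣≤d zero    = begin
    ∣ a * 1ℚ - b * 1ℚ ∣     ≡⟨ cong₂ (λ s t → ∣ s - t ∣) (ℚ.*-identityʳ a) (ℚ.*-identityʳ b) ⟩
    ∣ a - b ∣               ≤⟨ ∣a-b∣≤d ⟩
    d                       ≡⟨ solve 1 (λ d → d := con 1ℚ :* (d :* con 1ℚ)) refl d ⟩
    1ℚ * (d * 1ℚ)           ≡⟨ cong (_* (d * 1ℚ)) ι1 ⟨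
    ι 1 * (d * 1ℚ)          ∎
    where open ℚ.≤-Reasoning
  ^-difference {a} {b} {c} {d} 0≤a a≤c 0≤b b≤c ∣a-b∣≤d (suc n) = begin
    ∣ a * a ^ suc n - b * b ^ suc n ∣
      ≡⟨ cong ∣_∣ (solve 4 (λ a s b t → a :* s :- b :* t := a :* (s :- t) :+ (a :- b) :* t) refl
           a (a ^ suc n) b (b ^ suc n)) ⟩
    ∣ a * (a ^ suc n - b ^ suc n) + (a - b) * b ^ suc n ∣
      ≤⟨ ∣+∣≤ (∣*∣≤ {a} (subst (_≤ c) (sym (ℚ.0≤p⇒∣p∣≡p 0≤a)) a≤c) (^-difference 0≤a a≤c 0≤b b≤c ∣a-b∣≤d n))
              (∣*∣≤ {a - b} ∣a-b∣≤d (subst (_≤ c ^ suc n) (sym (ℚ.0≤p⇒∣p∣≡p (0≤^ (suc n) 0≤b))) (^-mono (suc n) 0≤b b≤c))) ⟩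
    c * (ι (suc n) * (d * c ^ n)) + d * c ^ suc n
      ≡⟨ solve 4 (λ c m d t → c :* (m :* (d :* t)) :+ d :* (c :* t) := (con 1ℚ :+ m) :* (d :* (c :* t))) refl
           c (ι (suc n)) d (c ^ n) ⟩
    (1ℚ + ι (suc n)) * (d * c ^ suc n)
      ≡⟨ cong (_* (d * c ^ suc n)) (ι-suc (suc n)) ⟨
    ι (suc (suc n)) * (d * c ^ suc n) ∎
    where open ℚ.≤-Reasoning

  -- With r = n + 1: r 2^(3^r) comes from the sieve at the integer N, and the same times 2^n from
  -- replacing N^r by x^r.
  factor : ℕ → ℚ
  factor n = ι (suc n) * (2ℚ ^ (3 ℕ.^ suc n) * (1ℚ + 2ℚ ^ n))

  0≤factor : ∀ n → 0ℚ ≤ factor n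
  0≤factor n = 0≤* (0≤ι (suc n)) (0≤* (0≤^ (3 ℕ.^ suc n) 0≤2) (0≤+ 0≤1 (0≤^ n 0≤2)))

  -- The exponent s of the logarithm treats both cases of R at once: it will be 0 for k ≥ 3 and n =
  -- r - 1 for k = 2.
  module Estimate (n k s : ℕ) (∣ψ₂∣≤ : ι n * ∣ ψ (2 ℕ.+ k) 2 ∣ ≤ ι s) where

    open Density (suc n) k

    integer-estimate : ∀ {N j} → 1 ℕ.≤ N → N ℕ.≤ j →
      ∣ ι (sumTuples (suc n) N (ϱ (2 ℕ.+ k))) - E j * ι N ^ suc n ∣
      ≤ ι (suc n) * (2ℚ ^ κ₀ * (ι N ^ n * logBound N ^ s))
    integer-estimate {N} {zero}  1≤N N≤0 = contradiction (ℕ.≤-trans 1≤N N≤0) λ ()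
    integer-estimate {N} {j@(suc j-1)} 1≤N N≤j = begin
      ∣ ι (sumTuples (suc n) N (ϱ (2 ℕ.+ k))) - E j * ι N ^ suc n ∣
        ≡⟨ cong₂ (λ u v → ∣ u - E j * v ∣) (sumTuples≡sievedCount (suc n) (suc k) N≤j) (sym (∏-replicate (ι N) (suc n))) ⟩
      ∣ sievedCount (2 ℕ.+ k) j (Vec.replicate (suc n) N) - E j * ∏ (Vec.replicate (suc n) (ι N)) ∣
        ≤⟨ sievedCount-approx n k (0≤ι s) ∣ψ₂∣≤ j (floors (suc n)) ⟩
      leaveOneOut (envelope K (ι s) j) (Vec.replicate (suc n) (ι N))
        ≡⟨ leaveOneOut-replicate (envelope K (ι s) j) (ι N) n ⟩
      ι (suc n) * (ι N ^ n * envelope K (ι s) j (ι N))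
        ≤⟨ *-monoˡ _ (0≤ι (suc n)) (*-monoˡ _ (0≤^ n (0≤ι N)) envelope≤) ⟩
      ι (suc n) * (ι N ^ n * (2ℚ ^ κ₀ * logBound N ^ s))
        ≡⟨ cong (ι (suc n) *_)
             (solve 3 (λ a b c → a :* (b :* c) := b :* (a :* c)) refl (ι N ^ n) (2ℚ ^ κ₀) (logBound N ^ s)) ⟩
      ι (suc n) * (2ℚ ^ κ₀ * (ι N ^ n * logBound N ^ s)) ∎
      where
      open ℚ.≤-Reasoning
      floors : ∀ m → Pointwise Floor (Vec.replicate m N) (Vec.replicate m (ι N))
      floors zero    = []
      floors (suc m) = (ℚ.≤-refl , ι-mono (ℕ.n≤1+n N)) ∷ floors m
      envelope≤ : envelope K (ι s) j (ι N) ≤ 2ℚ ^ κ₀ * logBound N ^ s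
      envelope≤ = begin
        envelope K (ι s) j (ι N)
          ≡⟨ cong (λ t → envelope t (ι s) j (ι N)) ικ₀ ⟨
        envelope (ι κ₀) (ι s) j (ι N)
          ≤⟨ envelope-split κ₀ (0≤ι s) j-1 (0≤ι N) ⟩
        powerBound κ₀ j * envelope 0ℚ (ι s) j (ι N)
          ≤⟨ *-mono (0≤powerBound κ₀ j) (powerBound≤ κ₀ j) (envelope-0≤ ℚ.≤-refl (0≤ι s) j (0≤ι N))
               (envelope-bound N s j (0≤ι N) ℚ.≤-refl) ⟩
        2ℚ ^ κ₀ * (logBound N ^ s * (1ℚ ⊓ ι N))
          ≤⟨ *-monoˡ _ (0≤^ κ₀ 0≤2) (*-monoˡ _ (0≤^ s (0≤logBound N)) (ℚ.p⊓q≤p 1ℚ (ι N))) ⟩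
        2ℚ ^ κ₀ * (logBound N ^ s * 1ℚ)
          ≡⟨ cong (2ℚ ^ κ₀ *_) (ℚ.*-identityʳ (logBound N ^ s)) ⟩
        2ℚ ^ κ₀ * logBound N ^ s ∎

    -- Replacing N^r by x^r costs at most r (N + 1)^n times the bounded partial product, and N + 1 ≤
    -- 2N brings this under the error already present.
    rational-estimate : ∀ {N j x} → 1 ℕ.≤ N → N ℕ.≤ j → 0ℚ ≤ x → x ≤ ι (suc N) → ∣ ι N - x ∣ ≤ 1ℚ →
      ∣ ι (sumTuples (suc n) N (ϱ (2 ℕ.+ k))) - E j * x ^ suc n ∣ ≤ factor n * (ι N ^ n * logBound N ^ s)
    rational-estimate {N} {j} {x} 1≤N N≤j 0≤x x≤1+N ∣N-x∣≤1 = begin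
      ∣ S - E j * x ^ suc n ∣
        ≡⟨ cong ∣_∣ (solve 4 (λ s e u v → s :- e :* v := (s :- e :* u) :+ e :* (u :- v)) refl
             S (E j) (ι N ^ suc n) (x ^ suc n)) ⟩
      ∣ (S - E j * ι N ^ suc n) + E j * (ι N ^ suc n - x ^ suc n) ∣
        ≤⟨ ∣+∣≤ (integer-estimate 1≤N N≤j) (∣*∣≤ {E j} (∣eulerProduct∣≤ j)
             (^-difference (0≤ι N) (ι-mono (ℕ.n≤1+n N)) 0≤x x≤1+N ∣N-x∣≤1 n)) ⟩
      ι (suc n) * (B * (ι N ^ n * L)) + B * (ι (suc n) * (1ℚ * ι (suc N) ^ n))
        ≤⟨ ℚ.+-monoʳ-≤ (ι (suc n) * (B * (ι N ^ n * L)))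
             (*-monoˡ B 0≤B (*-monoˡ _ (0≤ι (suc n)) (*-monoˡ 1ℚ 0≤1 power≤))) ⟩
      ι (suc n) * (B * (ι N ^ n * L)) + B * (ι (suc n) * (1ℚ * (2ℚ ^ n * ι N ^ n * L)))
        ≡⟨ solve 5 (λ m b p l t → m :* (b :* (p :* l)) :+ b :* (m :* (con 1ℚ :* (t :* p :* l)))
             := m :* (b :* (con 1ℚ :+ t)) :* (p :* l)) refl (ι (suc n)) B (ι N ^ n) L (2ℚ ^ n) ⟩
      factor n * (ι N ^ n * L) ∎
      where
      open ℚ.≤-Reasoning
      S B L : ℚ
      S = ι (sumTuples (suc n) N (ϱ (2 ℕ.+ k)))
      B = 2ℚ ^ κ₀
      L = logBound N ^ s
      0≤B : 0ℚ ≤ B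
      0≤B = 0≤^ κ₀ 0≤2
      power≤ : ι (suc N) ^ n ≤ 2ℚ ^ n * ι N ^ n * L
      power≤ = begin
        ι (suc N) ^ n
          ≤⟨ ^-mono n (0≤ι (suc N)) (≤-by (ι N - 1ℚ) (0≤b-a (1≤ι 1≤N))
               (trans (solve 1 (λ t → con 2ℚ :* t := con 1ℚ :+ t :+ (t :- con 1ℚ)) refl (ι N))
                      (cong (_+ (ι N - 1ℚ)) (sym (ι-suc N))))) ⟩
        (2ℚ * ι N) ^ n
          ≡⟨ ^-distrib-* 2ℚ (ι N) n ⟩
        2ℚ ^ n * ι N ^ n
          ≤⟨ a≤b*a (0≤* (0≤^ n 0≤2) (0≤^ n (0≤ι N)))
               (1≤^ s (ℚ.≤-trans (a≤a+b 0≤1) (a≤a+b (Σ<-0≤ N (λ j → 0≤rcp (suc j)))))) ⟩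
        L * (2ℚ ^ n * ι N ^ n)
          ≡⟨ ℚ.*-comm L (2ℚ ^ n * ι N ^ n) ⟩
        2ℚ ^ n * ι N ^ n * L ∎

  -- `logBound N` is at most 7 (h + 1), and h + 1 is at most 2 ℓ.
  14ℚ : ℚ
  14ℚ = ι 7 * 2ℚ

  -- 2^n comes from N ≤ 2x, and 14^n from the passage to the logarithm. The latter is at least 1 and
  -- is kept for k ≥ 3 too, so that one constant serves every k.
  constant : ℕ → ℚ
  constant n = factor n * (2ℚ ^ n * 14ℚ ^ n)

  floor≥5 : ∀ {x N} → fromℕ 5 Defs.≤ x → IsFloor x N → 5 ℕ.≤ N
  floor≥5 {x} {N} 5≤x (_ , ε , ε>0 , M , x+ε≤) = ℕ.s≤s⁻¹ (ι-cancel-< (begin-strict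
    ι 5                ≡⟨ ι≡/1 5 ⟩
    ℤ.+ 5 / 1          ≤⟨ proj₂ bound j (ℕ.m≤n⊔m M _) ⟩
    seq x j + δ        <⟨ ℚ.+-monoʳ-< (seq x j) δ<ε ⟩
    seq x j + ε        ≤⟨ x+ε≤ j (ℕ.m≤m⊔n M _) ⟩
    ℤ.+ suc N / 1      ≡⟨ ι≡/1 (suc N) ⟨
    ι (suc N)          ∎))
    where
    open ℚ.≤-Reasoning
    dense : ∃ λ δ → 0ℚ < δ × δ < ε
    dense = ℚ.<-dense ε>0
    δ : ℚ
    δ = proj₁ dense
    δ<ε : δ < ε
    δ<ε = proj₂ (proj₂ dense)
    bound : ∃ λ M → ∀ n → M ℕ.≤ n → ℤ.+ 5 / 1 ≤ seq x n + δ
    bound = 5≤x δ (proj₁ (proj₂ dense))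
    j : ℕ
    j = M ℕ.⊔ proj₁ bound

  -- What the floor relation says about a late term of the sequence of x. Terms obey N ≤ x only up
  -- to an error, taken to be 1; this gives N ≤ q + 1, and N ≤ 2q follows since N ≥ 2.
  record Near (N : ℕ) (q : ℚ) : Set where
    field
      0≤q    : 0ℚ ≤ q
      q≤1+N  : q ≤ ι (suc N)
      ∣N-q∣≤ : ∣ ι N - q ∣ ≤ 1ℚ
      N≤2q   : ι N ≤ 2ℚ * q

  near : ∀ {x N} → 5 ℕ.≤ N → IsFloor x N → ∃ λ M → ∀ j → M ℕ.≤ j → Near N (seq x j)
  near {x} {N} 5≤N (N≤x , ε , ε>0 , M , x+ε≤) = M ℕ.⊔ proj₁ lower , λ j M≤j → let
      q = seq x j
      N≤q+1 : ι N ≤ q + 1ℚ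
      N≤q+1 = subst (_≤ q + 1ℚ) (sym (ι≡/1 N)) (proj₂ lower j (ℕ.≤-trans (ℕ.m≤n⊔m M _) M≤j))
      q≤1+N : q ≤ ι (suc N)
      q≤1+N = ℚ.≤-trans (a≤a+b (ℚ.<⇒≤ ε>0))
        (ℚ.≤-trans (x+ε≤ j (ℕ.≤-trans (ℕ.m≤m⊔n M _) M≤j)) (ℚ.≤-reflexive (sym (ι≡/1 (suc N)))))
    in record
      { 0≤q    = subst (0ℚ ≤_) (solve 1 (λ q → q :+ con 1ℚ :- con 1ℚ := q) refl q)
                   (0≤b-a (ℚ.≤-trans (1≤ι (ℕ.≤-trans (s≤s z≤n) 5≤N)) N≤q+1))
      ; q≤1+N  = q≤1+N
      ; ∣N-q∣≤ = ∣∣≤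
          (≤-by (q + 1ℚ - ι N) (0≤b-a N≤q+1) (solve 2 (λ q n → con 1ℚ := n :- q :+ (q :+ con 1ℚ :- n)) refl q (ι N)))
          (≤-by (1ℚ + ι N - q) (0≤b-a (subst (q ≤_) (ι-suc N) q≤1+N))
            (solve 2 (λ q n → con 1ℚ := :- (n :- q) :+ (con 1ℚ :+ n :- q)) refl q (ι N)))
      ; N≤2q   = ≤-by (2ℚ * (q + 1ℚ - ι N) + (ι N - 2ℚ))
          (0≤+ (0≤* 0≤2 (0≤b-a N≤q+1)) (0≤b-a (subst (_≤ ι N) (ι≡/1 2) (ι-mono (ℕ.≤-trans (s≤s (s≤s z≤n)) 5≤N)))))
          (solve 2 (λ q n → con 2ℚ :* q := n :+ (con 2ℚ :* (q :+ con 1ℚ :- n) :+ (n :- con 2ℚ))) refl q (ι N))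
      }
    where
    lower : ∃ λ M → ∀ j → M ℕ.≤ j → ℤ.+ N / 1 ≤ seq x j + 1ℚ
    lower = N≤x 1ℚ (ℚ.positive⁻¹ 1ℚ)

  -- Proved index by index: the j-th term of `density` is the partial product over the primes p ≤ j,
  -- and for j ≥ N the sieve by these primes already gives the exact count.
  estimate : ∀ n k x → fromℕ 5 Defs.≤ x → ∀ N → IsFloor x N → ∀ R → IsR (suc n) (2 ℕ.+ k) x R →
    Defs.∣ fromℕ (sumTuples (suc n) N (ϱ (2 ℕ.+ k))) Defs.- Density.density (suc n) k Defs.* x Defs.^ suc n ∣
    Defs.≤ fromℚ (constant n) Defs.* R
  estimate n k x 5≤x N isFloor R isR ε ε>0 = main isR
    where
    open ℚ.≤-Reasoning
    open Density (suc n) k using (E)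
    5≤N : 5 ℕ.≤ N
    5≤N = floor≥5 {x} 5≤x isFloor
    1≤N : 1 ℕ.≤ N
    1≤N = ℕ.≤-trans (s≤s z≤n) 5≤N
    M : ℕ
    M = proj₁ (near {x} 5≤N isFloor)
    q : ℕ → ℚ
    q = seq x
    nearN : ∀ {j} → N ℕ.⊔ M ℕ.≤ j → Near N (q j)
    nearN M≤j = proj₂ (near {x} 5≤N isFloor) _ (ℕ.≤-trans (ℕ.m≤n⊔m N M) M≤j)
    deviation : ℕ → ℚ
    deviation j = ∣ ℤ.+ sumTuples (suc n) N (ϱ (2 ℕ.+ k)) / 1 - E j * seq (x Defs.^ suc n) j ∣
    deviation≤ : ∀ s → ι n * ∣ ψ (2 ℕ.+ k) 2 ∣ ≤ ι s → ∀ {j} → N ℕ.⊔ M ℕ.≤ j →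
      deviation j ≤ factor n * (2ℚ ^ n * q j ^ n * logBound N ^ s)
    deviation≤ s ψ₂≤ {j} M≤j = begin
      deviation j
        ≡⟨ cong₂ (λ u v → ∣ u - E j * v ∣) (sym (ι≡/1 _)) (seq-^ x (suc n) j) ⟩
      ∣ ι (sumTuples (suc n) N (ϱ (2 ℕ.+ k))) - E j * q j ^ suc n ∣
        ≤⟨ Estimate.rational-estimate n k s ψ₂≤ 1≤N (ℕ.≤-trans (ℕ.m≤m⊔n N M) M≤j) 0≤q q≤1+N ∣N-q∣≤ ⟩
      factor n * (ι N ^ n * logBound N ^ s)
        ≤⟨ *-monoˡ _ (0≤factor n) (*-monoʳ _ (0≤^ s (0≤logBound N)) (^-mono n (0≤ι N) N≤2q)) ⟩
      factor n * ((2ℚ * q j) ^ n * logBound N ^ s)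
        ≡⟨ cong (λ t → factor n * (t * logBound N ^ s)) (^-distrib-* 2ℚ (q j) n) ⟩
      factor n * (2ℚ ^ n * q j ^ n * logBound N ^ s) ∎
      where open Near (nearN M≤j)
    main : ∀ {R} → IsR (suc n) (2 ℕ.+ k) x R →
      ∃ λ M → ∀ j → M ℕ.≤ j → deviation j ≤ constant n * seq R j + ε
    main (k≥3 (s≤s (s≤s (s≤s z≤n)))) = N ℕ.⊔ M , λ j M≤j → let open Near (nearN M≤j) in begin
      deviation j
        -- For k ≥ 3 the weight of a replaced pair is 0, so no logarithm enters.
        ≤⟨ deviation≤ 0 (ℚ.≤-reflexive (trans (ℚ.*-zeroʳ (ι n)) (sym ι0))) M≤j ⟩
      factor n * (2ℚ ^ n * q j ^ n * 1ℚ)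
        ≤⟨ *-monoˡ _ (0≤factor n) (*-monoˡ _ (0≤* (0≤^ n 0≤2) (0≤^ n 0≤q))
             (1≤^ n (*-mono 0≤1 (1≤ι (s≤s z≤n)) 0≤1 (a≤a+b 0≤1)))) ⟩
      factor n * (2ℚ ^ n * q j ^ n * 14ℚ ^ n)
        ≡⟨ solve 4 (λ f t x u → f :* (t :* x :* u) := f :* (t :* u) :* x) refl
             (factor n) (2ℚ ^ n) (q j ^ n) (14ℚ ^ n) ⟩
      constant n * q j ^ n
        ≡⟨ cong (constant n *_) (seq-^ x n j) ⟨
      constant n * seq (x Defs.^ n) j
        ≤⟨ a≤a+b (ℚ.<⇒≤ ε>0) ⟩
      constant n * seq (x Defs.^ n) j + ε ∎
    main (k≡2 {ℓ} refl isLog) = N ℕ.⊔ M ℕ.⊔ proj₁ lower , λ j M≤j →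
      let M≤j′ = ℕ.≤-trans (ℕ.m≤m⊔n (N ℕ.⊔ M) _) M≤j
          open Near (nearN M≤j′) in begin
      deviation j
        -- For k = 2 the weight of a replaced pair is -1, so the slope is n = r - 1.
        ≤⟨ deviation≤ n (ℚ.≤-reflexive (ℚ.*-identityʳ (ι n))) M≤j′ ⟩
      factor n * (2ℚ ^ n * q j ^ n * logBound N ^ n)
        ≤⟨ *-monoˡ _ (0≤factor n) (*-monoˡ _ (0≤* (0≤^ n 0≤2) (0≤^ n 0≤q))
             (^-mono n (0≤logBound N) (logBound≤14ℓ j (ℕ.≤-trans (ℕ.m≤n⊔m (N ℕ.⊔ M) _) M≤j)))) ⟩
      factor n * (2ℚ ^ n * q j ^ n * (14ℚ * seq ℓ j) ^ n)
        ≡⟨ cong (λ t → factor n * (2ℚ ^ n * q j ^ n * t)) (^-distrib-* 14ℚ (seq ℓ j) n) ⟩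
      factor n * (2ℚ ^ n * q j ^ n * (14ℚ ^ n * seq ℓ j ^ n))
        ≡⟨ solve 5 (λ f t x u l → f :* (t :* x :* (u :* l)) := f :* (t :* u) :* (x :* l)) refl
             (factor n) (2ℚ ^ n) (q j ^ n) (14ℚ ^ n) (seq ℓ j ^ n) ⟩
      constant n * (q j ^ n * seq ℓ j ^ n)
        ≡⟨ cong₂ (λ u v → constant n * (u * v)) (seq-^ x n j) (seq-^ ℓ n j) ⟨
      constant n * (seq (x Defs.^ n) j * seq (ℓ Defs.^ n) j)
        ≤⟨ a≤a+b (ℚ.<⇒≤ ε>0) ⟩
      constant n * (seq (x Defs.^ n) j * seq (ℓ Defs.^ n) j) + ε ∎
      where
      h : ℕ
      h = proj₁ (log₄ 5≤N)
      H : ℚ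
      H = ι (suc h)
      -- Since H ≥ 1, an error of ½ still leaves ℓ_j ≥ H - ½ ≥ H/2.
      lower : ∃ λ M → ∀ j → M ℕ.≤ j → H ≤ seq ℓ j + ½
      lower = log-lower {x} {ℓ} isLog (proj₁ isFloor) h (proj₁ (proj₂ (log₄ 5≤N))) ½ (ℚ.positive⁻¹ ½)
      logBound≤14ℓ : ∀ j → proj₁ lower ℕ.≤ j → logBound N ≤ 14ℚ * seq ℓ j
      logBound≤14ℓ j M≤j = begin
        logBound N                ≤⟨ logBound≤ {N} {h} (proj₂ (proj₂ (log₄ 5≤N))) ⟩
        ι 7 * H                   ≤⟨ *-monoˡ _ (0≤ι 7) H≤2ℓ ⟩
        ι 7 * (2ℚ * seq ℓ j)      ≡⟨ ℚ.*-assoc (ι 7) 2ℚ (seq ℓ j) ⟨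
        14ℚ * seq ℓ j             ∎
        where
        H≤2ℓ : H ≤ 2ℚ * seq ℓ j
        H≤2ℓ = ≤-by (2ℚ * (seq ℓ j + ½ - H) + (H - 1ℚ))
          (0≤+ (0≤* 0≤2 (0≤b-a (proj₂ lower j M≤j))) (0≤b-a (1≤ι (s≤s z≤n))))
          (solve 2 (λ l h → con 2ℚ :* l := h :+ (con 2ℚ :* (l :+ con ½ :- h) :+ (h :- con 1ℚ))) refl (seq ℓ j) H)

open import Defs
open Sieve using (constant; estimate; module Density)

theorem2p2 : ∀ (r : ℕ) → ∃ λ (C : ℝ) → ∃ λ (x₀ : ℝ) →
    ∀ (k : ℕ) → 2 ℕ.≤ k → k ℕ.≤ r →
    ∃ λ (A : ℝ) → IsA r k A ×
    (∀ (x : ℝ) → x₀ ≤ x → ∀ (N : ℕ) → IsFloor x N → ∀ (R : ℝ) → IsR r k x R →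
    ∣ fromℕ (sumTuples r N (ϱ k)) - A * x ^ r ∣ ≤ C * R)
theorem2p2 zero    = fromℕ 0 , fromℕ 0 , λ { _ (s≤s _) () }
theorem2p2 (suc n) = fromℚ (constant n) , fromℕ 5 , λ where
  (suc (suc k)) (s≤s (s≤s z≤n)) _ →
    Density.density (suc n) k , Density.density-isA (suc n) k , estimate n k
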